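{- Let $\mathcal{K}$ be a FUR-class with monster model $\mathbb{M}$. Let $a\in\mathbb{M}$, $A\subset\mathbb{M}$, and let $\alpha=\mathrm{Cb}(a/A)$. Then $a\downarrow_\alpha A$.
   Context: SETTING. $(\mathcal{K},\preccurlyeq)$ is an abstract elementary class (AEC) with monster model $\mathbb{M}$: a $\delta$-model homogeneous and $\delta$-universal member of $\mathcal{K}$, $\delta$ a large cardinal. "Bounded" means of size $<\delta$. "Model" means $\mathcal{A}\in\mathcal{K}$, $\mathcal{A}\preccurlyeq\mathbb{M}$; models and parameter sets are bounded unless $\mathbb{M}$ itself is mentioned. $a\in X$ may be a finite tuple; juxtaposition denotes union or concatenation. TYPES. $\mathrm{Aut}(\mathbb{M}/A)$ is the group of automorphisms of $\mathbb{M}$ fixing $A$ pointwise. $a,b$ have the same Galois type over $A$, $t^g(a/A)=t^g(b/A)$, if $f(a)=b$ for some $f\in\mathrm{Aut}(\mathbb{M}/A)$; they have the same weak type, $t(a/A)=t(b/A)$, if $t^g(a/B)=t^g(b/B)$ for all finite $B\subseteq A$ (types of models are types of enumerations). For $A\subseteq B$ with $A$ finite, $t(a/B)$ splits over $A$ if there are $b,c\in B$ with $t(b/A)=t(c/A)$ but $t(ab/A)\ne t(ac/A)$. $a\downarrow^{ns}_B C$ means that $t(a/B\cup C)$ does not split over some finite $A\subseteq B$; $A\downarrow^{ns}_B C$ means $a\downarrow^{ns}_BC$ for each $a\in A$. FUR-CLASS. $\mathcal{K}$ is a FUR-class if it has AP and JEP, $LS(\mathcal{K})=\omega$, has arbitrarily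 large structures, contains no finite models, and satisfies: (AI) Every countable model $\mathcal{A}$ is s-saturated: for any $b\in\mathbb{M}$ and finite $A\subseteq\mathcal{A}$ there is $a\in\mathcal{A}$ with $t(a/A)=t(b/A)$. (AII) For all $a$ and countable $\mathcal{A}$ there is an s-primary model $\mathcal{B}=\mathcal{A}a\cup\bigcup_{i<\omega}a_i$ over $\mathcal{A}a$. [s-primary: the $a_i$ are singletons and for all $n<\omega$ there is a finite $A_n\subset\mathcal{A}$ such that for all $(a',a_0',\dots,a_n')$ with $t(a'/\mathcal{A})=t(a/\mathcal{A})$: $t(a',a_0',\dots,a_n'/A_n)=t(a,a_0,\dots,a_n/A_n)$ implies $t(a',a_0',\dots,a_n'/\mathcal{A})=t(a,a_0,\dots,a_n/\mathcal{A})$.] (AIII) Let $\mathcal{A},\mathcal{B},\mathcal{C}$ be models with $\mathcal{A}\downarrow^{ns}_{\mathcal{B}}\mathcal{C}$ and $\mathcal{B}=\mathcal{A}\cap\mathcal{C}$. Then there is a unique (not only up to isomorphism) s-prime model $\mathcal{D}$ over $\mathcal{A}\cup\mathcal{C}$; furthermore, if $\mathcal{C}\subseteq\mathcal{C}'$ and $\mathcal{A}\downarrow^{ns}_{\mathcal{B}}\mathcal{C}'$, then $\mathcal{D}\downarrow^{ns}_{\mathcal{C}}\mathcal{C}'$. [For models $\mathcal{A}_i$, $i<\alpha$, and $A=\bigcup_{i<\alpha}\mathcal{A}_i$, a map $f:A\to\mathbb{M}$ is weakly elementary w.r.t. $(\mathcal{A}_i)_{i<\alpha}$ if $t(a/\emptyset)=t(f(a)/\emptyset)$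 for all $a\in A$ and $f(\mathcal{A}_i)\preccurlyeq\mathbb{M}$ for all $i$. A model $\mathcal{D}$ is s-prime over $A$ if for every model $\mathcal{B}$ and every $f:A\to\mathcal{B}$ weakly elementary w.r.t. $(\mathcal{A}_i)_{i<\alpha}$ there is an elementary embedding $g:\mathcal{D}\to\mathcal{B}$ with $f\subseteq g$.] (AIV) For each $a\in\mathbb{M}$ there is $n<\omega$ such that for every countable model $\mathcal{A}$ and finite $A\subset\mathcal{A}$, player II has a winning strategy in $GI(a,A,\mathcal{A})$ in $n$ moves. [$GI(a,A,\mathcal{A})$: start with $a_0=a$, $A_0=A$. At move $n$, player I chooses $a_{n+1}\in\mathbb{M}$ and a finite $A_{n+1}'\subseteq\mathcal{A}$ with $t(a_{n+1}/A_n)=t(a_n/A_n)$, $A_n\subseteq A'_{n+1}$ and $t(a_{n+1}/A'_{n+1})\ne t(a_n/A'_{n+1})$; then player II chooses a finite $A_{n+1}\subseteq\mathcal{A}$ with $A'_{n+1}\subseteq A_{n+1}$. Player II wins if player I can no longer move.] (AV) If $\mathcal{A}\subseteq\mathcal{B}$ are countable models, $a\in\mathbb{M}$ and $\mathcal{B}\downarrow^{ns}_{\mathcal{A}}a$, then $a\downarrow^{ns}_{\mathcal{A}}\mathcal{B}$. (AVI) For all models $\mathcal{A},\mathcal{B},\mathcal{D}$ with $\mathcal{A}\subseteq\mathcal{B}\cap\mathcal{D}$ there is a model $\mathcal{C}$ with $t(\mathcal{C}/\mathcal{A})=t(\mathcal{B}/\mathcal{A})$ and $\mathcal{C}\downarrow^{ns}_{\mathcal{A}}\mathcal{D}$.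 INDEPENDENCE. For finite $A$, $E(A)$ is the set of $\mathrm{Aut}(\mathbb{M}/A)$-invariant equivalence relations on powers $\mathbb{M}^n$ with boundedly many classes; $Lt(a/B)=Lt(b/B)$ means $(a,b)\in E$ for all finite $A\subseteq B$ and $E\in E(A)$. For $A\subseteq B$, $A$ finite, $t(a/B)$ Lascar splits over $A$ if there are $b,c\in B$ with $Lt(b/A)=Lt(c/A)$ and $t(ab/A)\neq t(ac/A)$. $a\downarrow_B C$ means: there is a finite $A\subseteq B$ such that for all $D\supseteq B\cup C$ there is $b$ with $t(b/B\cup C)=t(a/B\cup C)$ and $t(b/D)$ not Lascar splitting over $A$. IMAGINARIES. $\mathcal{E}$ is a countable collection of $\emptyset$-invariant equivalence relations $E\subseteq\mathbb{M}^n\times\mathbb{M}^n$ (various $n$), containing equality, each given by a countable collection $G_E$ of Galois types via $(a,b)\in E$ iff $t^g(ab/\emptyset)\in G_E$. $\mathbb{M}^{eq}=\{a/E:a\in\mathbb{M},E\in\mathcal{E}\}$, with $a$ identified with $a/{=}$, the structure of $\mathbb{M}$ on $P_=$, and predicates $P_E$ for $\{a/E:a\in\mathbb{M}\}$ and functions $F_E(a)=a/E$. All notions above also apply in $\mathbb{M}^{eq}$, with models $\mathcal{A}^{eq}=\{a/E:a\in\mathcal{A},E\in\mathcal{E}\}$; $a\downarrow_\alpha A$ is understood in $\mathbb{M}^{eq}$. GLOBAL TYPES. The supermonster $\mathbb{M}'\in\mathcal{K}$ is a $|\mathbb{M}'|$-model homogeneous and universal structure with $\mathbb{M}\preccurlyeq\mathbb{M}'$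 and $|\mathbb{M}'|>|\mathbb{M}|$. Types, Lascar types and independence for elements of $\mathbb{M}'$ are computed in $\mathbb{M}'$. A global type $p$ is a maximal collection $\{p_A:A\subset\mathbb{M}\text{ finite}\}$ such that $p_A$ is a Galois type over $A$, whenever $A\subseteq B$ and $b\in\mathbb{M}$ realizes $p_B$ then $b$ realizes $p_A$, and some single $b\in\mathbb{M}'$ realizes $p_A$ for every finite $A\subset\mathbb{M}$. For $f\in\mathrm{Aut}(\mathbb{M}^{eq})$, $f(p)=p$ means: for all finite $A,B\subset\mathbb{M}$ with $f(B)=A$ and all $b$ realizing $p_B$, $f(b)$ realizes $p_A$. $\alpha\in\mathbb{M}^{eq}$ is a canonical base for $p$ if for every $f\in\mathrm{Aut}(\mathbb{M}^{eq})$: $f(p)=p$ iff $f(\alpha)=\alpha$. For $a\in\mathbb{M}$ and $A\subset\mathbb{M}$, there is $b\in\mathbb{M}'$ with $Lt(b/A)=Lt(a/A)$ and $b\downarrow_A\mathbb{M}$; a canonical base for $a$ over $A$, written $\alpha=\mathrm{Cb}(a/A)$, is a canonical base of $t(b/\mathbb{M})$. STANDING CHOICE OF $\mathcal{E}$ (ensuring canonical bases exist in $\mathbb{M}^{eq}$). For a global type $p$ realized by $b\in\mathbb{M}'$ with $t(b/\mathbb{M})$ not splitting over a finite tuple $a\in\mathbb{M}$: for $c\in\mathbb{M}$ let $q_c=t(bc/\emptyset)$ and let $q_i^c$, $i<\omega$, be types over $\emptyset$ such that for all $d\in\mathbb{M}$, $bd$ realizes $q_c$ iff $ad$ realizes some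 $q_i^c$. Let $(a_0,a_1)\in E$ iff for all $c,d\in\mathbb{M}$: $a_0d$ realizes some $q_i^c$ iff $a_1d$ realizes some $q_i^c$. These $E$ depend only on $t(ba/\emptyset)$; $\mathcal{E}$ contains all of them. -}

module Defs where

open import Level using (Level; _⊔_; suc)
open import Data.Bool using (Bool; if_then_else_)
open import Data.Fin using (Fin; toℕ) renaming (zero to fzero)
open import Data.List using (List; [])
open import Data.List.Relation.Unary.All using (All)
import Data.List.Membership.Setoid as SetoidMembership
open import Data.Nat using (ℕ; zero) renaming (suc to 1+; _+_ to _+ⁿ_)
open import Data.Product using (Σ; ∃; ∃₂; _×_; _,_)
open import Data.Sum using (_⊎_)
open import Data.Vec.Functional using (Vector; _++_; toList)
open import Function using (_∘_)
open import Function.Bundles using (_⇔_; _↣_; _↔_; Inverse)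
open import Induction.WellFounded using (WellFounded)
open import Relation.Binary using (Rel; Setoid; IsEquivalence; IsStrictTotalOrder)
open import Relation.Binary.PropositionalEquality
  using (_≡_; setoid; _≗_)
open import Relation.Nullary using (¬_)
open import Relation.Unary using (Pred; _⊆_; _≐_; _∪_; _∩_)

------------------------------------------------------------------------
-- Cardinality.  Cardinals are represented by types; `X <# Y` is |X| < |Y|.  These
-- definitions, and the negations below, are meant for classical mathematics: excluded
-- middle (for all types, hence with choice) and function extensionality are to be
-- assumed wherever the notions are used.

infix 4 _<#_

_<#_ : ∀ {a b} → Set a → Set b → Set (a ⊔ b)
X <# Y = (X ↣ Y) × ¬ (Y ↣ X)

Finite : ∀ {a} → Set a → Set a
Finite X = ∃ λ n → X ↔ Fin n

Countable : ∀ {a} → Set a → Set a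
Countable X = X ↣ ℕ

-- "Large cardinal" in its basic sense: a strongly inaccessible cardinal.
record Inaccessible {ℓ} (δ : Set ℓ) : Set (suc ℓ) where
  field
    uncountable : ℕ <# δ
    regular     : ∀ (I : Set ℓ) (F : I → Set ℓ) → I <# δ → (∀ i → F i <# δ) → Σ I F <# δ
    strongLimit : ∀ (X : Set ℓ) → X <# δ → (X → Bool) <# δ

------------------------------------------------------------------------
-- First-order structures

record Language (ℓ : Level) : Set (suc ℓ) where
  field
    FunSym : Set ℓ
    RelSym : Set ℓ
    funAr  : FunSym → ℕ
    relAr  : RelSym → ℕ

module _ {ℓ} (L : Language ℓ) where
  open Language L

  record Structure : Set (suc ℓ) where
    field
      Carrier : Set ℓ
      fun     : (f : FunSym) → Vector Carrier (funAr f) → Carrier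
      rel     : (r : RelSym) → Vector Carrier (relAr r) → Set ℓ

open Structure public using (Carrier)

module _ {ℓ} {L : Language ℓ} where
  open Language L

  record IsEmbedding (A B : Structure L) (f : Carrier A → Carrier B) : Set ℓ where
    private
      module A = Structure A
      module B = Structure B
    field
      injective : ∀ {x y} → f x ≡ f y → x ≡ y
      fun-hom   : ∀ s xs → f (A.fun s xs) ≡ B.fun s (f ∘ xs)
      rel-iff   : ∀ r xs → A.rel r xs ⇔ B.rel r (f ∘ xs)

  record IsIsomorphism (A B : Structure L) (f : Carrier A → Carrier B) : Set ℓ where
    field
      isEmbedding : IsEmbedding A B f
      surjective  : ∀ y → ∃ λ x → f x ≡ y

  record Automorphism (A : Structure L) : Set ℓ where
    field
      to    : Carrier A → Carrier A
      isIso : IsIsomorphism A A to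

------------------------------------------------------------------------
-- Abstract elementary classes

-- The strong-substructure relation is recorded along injections rather than literal
-- inclusions: `Strong A B f` says that f is an isomorphism of A onto some A′ ≼ B.
-- `isomorphism`, `transitive` and `respects` together express that ≼ is reflexive and
-- transitive and that K and ≼ are closed under isomorphism.
record AEC {ℓ} (L : Language ℓ) (k : Level) : Set (suc (ℓ ⊔ k)) where
  field
    K      : Structure L → Set k
    Strong : (A B : Structure L) → (Carrier A → Carrier B) → Set k

    strong-K    : ∀ {A B f} → Strong A B f → K A × K B
    embedding   : ∀ {A B f} → Strong A B f → IsEmbedding A B f
    respects    : ∀ {A B f g} → f ≗ g → Strong A B f → Strong A B g
    isomorphism : ∀ {A B f} → IsIsomorphism A B f → K A → Strong A B f
    transitive  : ∀ {A B C f g} → Strong A B f → Strong B C g → Strong A C (g ∘ f)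
    coherence   : ∀ {A B C f g} → IsEmbedding A B f → Strong B C g →
                  Strong A C (g ∘ f) → Strong A B f

    -- A nonempty ≼-increasing chain (A i), indexed by a well-order, with union N:
    -- e i is the inclusion of A i into N.
    union : (I : Set ℓ) (_<_ : Rel I ℓ) → IsStrictTotalOrder _≡_ _<_ → WellFounded _<_ → I →
            (A : I → Structure L) (N : Structure L) (e : ∀ i → Carrier (A i) → Carrier N) →
            (∀ i → K (A i)) →
            (∀ i → IsEmbedding (A i) N (e i)) →
            (∀ {i j} → i < j → ∃ λ h → Strong (A i) (A j) h × (∀ x → e j (h x) ≡ e i x)) →
            (∀ y → ∃₂ λ i x → e i x ≡ y) →
            K N ×
            (∀ i → Strong (A i) N (e i)) ×
            (∀ B (g : Carrier N → Carrier B) → K B →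
               (∀ i → Strong (A i) B (g ∘ e i)) → Strong N B g)

  -- Every subset X of A ∈ K lies in some A′ ≼ A of size at most |X| + κ.
  LöwenheimSkolem : ∀ {c} → Set c → Set (suc ℓ ⊔ k ⊔ c)
  LöwenheimSkolem κ = ∀ A → K A → (X : Set ℓ) (x : X → Carrier A) →
    (∀ {i j} → x i ≡ x j → i ≡ j) →
    ∃₂ λ A′ f → Strong A′ A f × (∀ i → ∃ λ y → f y ≡ x i) × (Carrier A′ ↣ (X ⊎ κ))

  field
    löwenheimSkolem : ∃ λ (κ : Set ℓ) → LöwenheimSkolem κ

module _ {ℓ k} {L : Language ℓ} (𝒦 : AEC L k) where
  open AEC 𝒦

  AmalgamationProperty : Set (suc ℓ ⊔ k)
  AmalgamationProperty = ∀ {A B C f g} → Strong A B f → Strong A C g →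
    ∃ λ D → ∃₂ λ f′ g′ → Strong B D f′ × Strong C D g′ × (f′ ∘ f ≗ g′ ∘ g)

  JointEmbeddingProperty : Set (suc ℓ ⊔ k)
  JointEmbeddingProperty = ∀ A B → K A → K B →
    ∃ λ D → ∃₂ λ f g → Strong A D f × Strong B D g

  ModelHomogeneous : Set ℓ → Structure L → Set (suc ℓ ⊔ k)
  ModelHomogeneous δ M = ∀ A B f g h → Carrier A <# δ → Carrier B <# δ →
    Strong A M f → Strong B M g → IsIsomorphism A B h →
    ∃ λ (σ : Automorphism M) → ∀ x → Automorphism.to σ (f x) ≡ g (h x)

  Universal : Set ℓ → Structure L → Set (suc ℓ ⊔ k)
  Universal δ M = ∀ A → K A → Carrier A <# δ → ∃ λ f → Strong A M f

  record MonsterModel : Set (suc ℓ ⊔ k) where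
    field
      δ            : Set ℓ
      inaccessible : Inaccessible δ
      𝕄            : Structure L
      𝕄∈K          : K 𝕄
      homogeneous  : ModelHomogeneous δ 𝕄
      universal    : Universal δ 𝕄

------------------------------------------------------------------------
-- Types, splitting and independence.  These only refer to the points, the
-- automorphisms and the bound on "bounded" sets, so they are defined once and used
-- for 𝕄, for 𝕄ᵉᑫ and for the supermonster.

record Space (ℓ : Level) : Set (suc ℓ) where
  field
    points : Setoid ℓ ℓ
    Auto   : Set ℓ
    act    : Auto → Setoid.Carrier points → Setoid.Carrier points
    δ      : Set ℓ

module Types {ℓ} (S : Space ℓ) where
  open Space S
  open Setoid points using (_≈_) renaming (Carrier to Pt)
  open SetoidMembership points using (_∈_)

  Tuple : ℕ → Set ℓ
  Tuple = Vector Pt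

  Subset : Set (suc ℓ)
  Subset = Pred Pt ℓ

  ⟨_⟩ : List Pt → Subset
  ⟨ xs ⟩ x = x ∈ xs

  range : ∀ {i} {I : Set i} → (I → Pt) → Pred Pt (ℓ ⊔ i)
  range a x = ∃ λ i → a i ≈ x

  infix 4 _⊏_

  -- a ∈ X for a tuple a
  _⊏_ : ∀ {i} {I : Set i} → (I → Pt) → Subset → Set (ℓ ⊔ i)
  a ⊏ X = ∀ i → X (a i)

  Bounded : Subset → Set (suc ℓ)
  Bounded X = ∃ λ (I : Set ℓ) → I <# δ × ∃ λ (s : I → Pt) → X ⊆ range s

  Fixes : ∀ {a} → Auto → Pred Pt a → Set (ℓ ⊔ a)
  Fixes f A = ∀ {x} → A x → act f x ≈ x

  -- tᵍ(a/A) = tᵍ(b/A) and t(a/A) = t(b/A), for families a, b of any length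
  -- (tuples, or enumerations of models).
  SameGalois : ∀ {i} {I : Set i} → Subset → (a b : I → Pt) → Set (ℓ ⊔ i)
  SameGalois A a b = ∃ λ f → Fixes f A × (∀ i → act f (a i) ≈ b i)

  SameType : ∀ {i} {I : Set i} → Subset → (a b : I → Pt) → Set (ℓ ⊔ i)
  SameType A a b = ∀ B → All A B → SameGalois ⟨ B ⟩ a b

  SameType∅ : ∀ {i} {I : Set i} → (a b : I → Pt) → Set (ℓ ⊔ i)
  SameType∅ = SameType ⟨ [] ⟩

  -- t(X/A) = t(Y/A): some enumerations of X and Y have the same type.
  SameSetType : Subset → Subset → Subset → Set (suc ℓ)
  SameSetType A X Y = ∃ λ (I : Set ℓ) → ∃₂ λ (x y : I → Pt) →
    range x ≐ X × range y ≐ Y × SameType A x y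

  Splits : ∀ {n} → Tuple n → Subset → List Pt → Set ℓ
  Splits a B A = ∃ λ m → ∃₂ λ (b c : Tuple m) → b ⊏ B × c ⊏ B ×
    SameType ⟨ A ⟩ b c × ¬ SameType ⟨ A ⟩ (a ++ b) (a ++ c)

  -- a ↓ⁿˢ_B C
  NSIndep : ∀ {n} → Tuple n → Subset → Subset → Set ℓ
  NSIndep a B C = ∃ λ A → All B A × ¬ Splits a (B ∪ C) A

  -- A ↓ⁿˢ_B C
  NSIndepSet : Subset → Subset → Subset → Set ℓ
  NSIndepSet A B C = ∀ {n} (a : Tuple n) → a ⊏ A → NSIndep a B C

  -- The elements of E(A) on Ptⁿ.  `equality` only says that the relation is well
  -- defined with respect to the setoid equality of points.
  record InvariantEquivalence (A : List Pt) (n : ℕ) : Set (suc ℓ) where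
    field
      E             : Rel (Tuple n) ℓ
      isEquivalence : IsEquivalence E
      equality      : ∀ {a b} → (∀ i → a i ≈ b i) → E a b
      invariant     : ∀ f → Fixes f ⟨ A ⟩ → ∀ {a b} → E a b → E (act f ∘ a) (act f ∘ b)
      bounded       : ∃ λ (I : Set ℓ) → I <# δ ×
                      ∃ λ (r : I → Tuple n) → ∀ a → ∃ λ i → E a (r i)

  -- Lt(a/B) = Lt(b/B)
  SameLascar : ∀ {n} → Subset → (a b : Tuple n) → Set (suc ℓ)
  SameLascar {n} B a b = ∀ A → All B A → (E : InvariantEquivalence A n) →
    InvariantEquivalence.E E a b

  LascarSplits : ∀ {n} → Tuple n → Subset → List Pt → Set (suc ℓ)
  LascarSplits a B A = ∃ λ m → ∃₂ λ (b c : Tuple m) → b ⊏ B × c ⊏ B ×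
    SameLascar ⟨ A ⟩ b c × ¬ SameType ⟨ A ⟩ (a ++ b) (a ++ c)

  -- a ↓_B C
  Indep : ∀ {n} → Tuple n → Subset → Subset → Set (suc ℓ)
  Indep {n} a B C = ∃ λ A → All B A ×
    (∀ D → Bounded D → B ∪ C ⊆ D →
       ∃ λ (b : Tuple n) → SameType (B ∪ C) b a × ¬ LascarSplits b D A)

structureSpace : ∀ {ℓ} {L : Language ℓ} → Structure L → Set ℓ → Space ℓ
structureSpace M δ = record
  { points = setoid (Carrier M)
  ; Auto   = Automorphism M
  ; act    = Automorphism.to
  ; δ      = δ
  }

------------------------------------------------------------------------
-- FUR-classes

module FUR {ℓ k} {L : Language ℓ} (𝒦 : AEC L k) (monster : MonsterModel 𝒦) where
  open AEC 𝒦
  open MonsterModel monster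

  𝕄-space : Space ℓ
  𝕄-space = structureSpace 𝕄 δ

  open Types 𝕄-space

  M : Set ℓ
  M = Carrier 𝕄

  record Model : Set (suc ℓ ⊔ k) where
    field
      str    : Structure L
      incl   : Carrier str → M
      strong : Strong str 𝕄 incl
      small  : Carrier str <# δ

    set : Subset
    set = range incl

  open Model

  CountableModel : Model → Set ℓ
  CountableModel 𝒜 = Countable (Carrier (str 𝒜))

  _[_] : (M → M) → Subset → Subset
  (f [ X ]) y = ∃ λ x → X x × f x ≡ y

  IsModel : Subset → Set (suc ℓ ⊔ k)
  IsModel X = ∃ λ 𝒜 → set 𝒜 ≐ X

  -- ℬ = 𝒜a ∪ ⋃ᵢ aᵢ is s-primary over 𝒜a.
  SPrimary : ∀ {n} → Model → Tuple n → Model → Set ℓ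
  SPrimary {n} 𝒜 a ℬ = ∃ λ (s : ℕ → M) →
    set ℬ ≐ (set 𝒜 ∪ range a) ∪ range s ×
    (∀ j → ∃ λ Aⱼ → All (set 𝒜) Aⱼ ×
       (∀ (a′ : Tuple n) (s′ : Tuple (1+ j)) →
          SameType (set 𝒜) a′ a →
          SameType ⟨ Aⱼ ⟩ (a′ ++ s′) (a ++ (s ∘ toℕ)) →
          SameType (set 𝒜) (a′ ++ s′) (a ++ (s ∘ toℕ))))

  ⋃ : {J : Set} → (J → Model) → Subset
  ⋃ 𝒜 x = ∃ λ j → set (𝒜 j) x

  -- A map defined on ⋃ 𝒜 is given by a map f on 𝕄 whose values off ⋃ 𝒜 are ignored.
  WeaklyElementary : {J : Set} → (J → Model) → (M → M) → Set (suc ℓ ⊔ k)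
  WeaklyElementary 𝒜 f =
    (∀ {n} (a : Tuple n) → a ⊏ ⋃ 𝒜 → SameType∅ a (f ∘ a)) ×
    (∀ j → IsModel (f [ set (𝒜 j) ]))

  -- 𝒟 is s-prime over ⋃ 𝒜.
  SPrime : {J : Set} → (J → Model) → Model → Set (suc ℓ ⊔ k)
  SPrime 𝒜 𝒟 = ⋃ 𝒜 ⊆ set 𝒟 ×
    (∀ ℬ f → WeaklyElementary 𝒜 f → (∀ {x} → ⋃ 𝒜 x → set ℬ (f x)) →
       ∃ λ g → Strong (str 𝒟) (str ℬ) g ×
               (∀ d → ⋃ 𝒜 (incl 𝒟 d) → incl ℬ (g d) ≡ f (incl 𝒟 d)))

  pair : Model → Model → Bool → Model
  pair 𝒜 𝒞 b = if b then 𝒜 else 𝒞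

  -- In GI(a, A, 𝒜), player I may move to a′, A′.
  LegalMove : ∀ {n} → Model → (a : Tuple n) (A : List M) (a′ : Tuple n) (A′ : List M) → Set ℓ
  LegalMove 𝒜 a A a′ A′ = SameType ⟨ A ⟩ a′ a × All (set 𝒜) A′ × ⟨ A ⟩ ⊆ ⟨ A′ ⟩ ×
    ¬ SameType ⟨ A′ ⟩ a′ a

  -- Player II has a strategy in GI(a, A, 𝒜) after which player I is out of moves
  -- within the given number of moves.
  WinsII : ∀ {n} → ℕ → Model → Tuple n → List M → Set ℓ
  WinsII zero   𝒜 a A = ∀ a′ A′ → ¬ LegalMove 𝒜 a A a′ A′
  WinsII (1+ r) 𝒜 a A = ∀ a′ A′ → LegalMove 𝒜 a A a′ A′ →
    ∃ λ A″ → All (set 𝒜) A″ × ⟨ A′ ⟩ ⊆ ⟨ A″ ⟩ × WinsII r 𝒜 a′ A″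

  record IsFUR : Set (suc (ℓ ⊔ k)) where
    field
      AP        : AmalgamationProperty 𝒦
      JEP       : JointEmbeddingProperty 𝒦
      LS≡ω      : LöwenheimSkolem ℕ
      large     : (X : Set ℓ) → ∃ λ A → K A × (X ↣ Carrier A)
      no-finite : ∀ A → K A → ¬ Finite (Carrier A)

      AI   : ∀ 𝒜 → CountableModel 𝒜 → ∀ {n} (b : Tuple n) A → All (set 𝒜) A →
             ∃ λ (a : Tuple n) → a ⊏ set 𝒜 × SameType ⟨ A ⟩ a b

      AII  : ∀ {n} (a : Tuple n) 𝒜 → CountableModel 𝒜 → ∃ λ ℬ → SPrimary 𝒜 a ℬ

      AIII : ∀ 𝒜 ℬ 𝒞 → NSIndepSet (set 𝒜) (set ℬ) (set 𝒞) → set ℬ ≐ set 𝒜 ∩ set 𝒞 →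
             ∃ λ 𝒟 → SPrime (pair 𝒜 𝒞) 𝒟 ×
               (∀ 𝒟′ → SPrime (pair 𝒜 𝒞) 𝒟′ → set 𝒟′ ≐ set 𝒟) ×
               (∀ 𝒞′ → set 𝒞 ⊆ set 𝒞′ → NSIndepSet (set 𝒜) (set ℬ) (set 𝒞′) →
                  NSIndepSet (set 𝒟) (set 𝒞) (set 𝒞′))

      AIV  : ∀ {n} (a : Tuple n) → ∃ λ r → ∀ 𝒜 → CountableModel 𝒜 →
             ∀ A → All (set 𝒜) A → WinsII r 𝒜 a A

      AV   : ∀ 𝒜 ℬ → CountableModel 𝒜 → CountableModel ℬ → set 𝒜 ⊆ set ℬ →
             ∀ {n} (a : Tuple n) → NSIndepSet (set ℬ) (set 𝒜) (range a) →
             NSIndep a (set 𝒜) (set ℬ)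

      AVI  : ∀ 𝒜 ℬ 𝒟 → set 𝒜 ⊆ set ℬ ∩ set 𝒟 →
             ∃ λ 𝒞 → SameSetType (set 𝒜) (set 𝒞) (set ℬ) ×
                     NSIndepSet (set 𝒞) (set 𝒜) (set 𝒟)

  ----------------------------------------------------------------------
  -- Imaginaries

  record Imaginaries : Set (suc ℓ) where
    field
      -- ℰ n indexes the members of the collection that are relations on 𝕄ⁿ.
      ℰ             : ℕ → Set ℓ
      countable     : Countable (Σ ℕ ℰ)
      E             : ∀ {n} → ℰ n → Rel (Tuple n) ℓ
      isEquivalence : ∀ {n} (e : ℰ n) → IsEquivalence (E e)
      invariant     : ∀ {n} (e : ℰ n) (f : Automorphism 𝕄) {a b} → E e a b →
                      E e (Automorphism.to f ∘ a) (Automorphism.to f ∘ b)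
      -- The Galois types in G_E are those of the tuples G e i, i < ω.
      G             : ∀ {n} → ℰ n → ℕ → Tuple (n +ⁿ n)
      galois        : ∀ {n} (e : ℰ n) a b →
                      E e a b ⇔ ∃ λ i → SameGalois ⟨ [] ⟩ (a ++ b) (G e i)
      equality      : ℰ 1
      equality-iff  : ∀ a b → E equality a b ⇔ (a fzero ≡ b fzero)

  module Eq (I : Imaginaries) where
    open Imaginaries I

    Sort : Set ℓ
    Sort = Σ ℕ ℰ

    -- (e , a) stands for a/E; classes of different members of ℰ are kept distinct.
    M-eq : Set ℓ
    M-eq = Σ Sort λ { (n , _) → Tuple n }

    data _≈ᵉᑫ_ : Rel M-eq ℓ where
      class : ∀ {n} {e : ℰ n} {a b} → E e a b → ((n , e) , a) ≈ᵉᑫ ((n , e) , b)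

    points : Setoid ℓ ℓ
    points = record
      { Carrier       = M-eq
      ; _≈_           = _≈ᵉᑫ_
      ; isEquivalence = record
        { refl  = λ { {(_ , e) , _} → class (IsEquivalence.refl (isEquivalence e)) }
        ; sym   = λ { (class {e = e} p) → class (IsEquivalence.sym (isEquivalence e) p) }
        ; trans = λ { (class {e = e} p) (class q) →
                        class (IsEquivalence.trans (isEquivalence e) p q) }
        }
      }

    F : ∀ {n} → ℰ n → Tuple n → M-eq
    F {n} e a = (n , e) , a

    P : ∀ {n} → ℰ n → Pred M-eq ℓ
    P e x = ∃ λ a → x ≈ᵉᑫ F e a

    ι₌ : M → M-eq
    ι₌ x = F equality (λ _ → x)

    -- A bijection preserving the structure of 𝕄 on P₌, the predicates P and the
    -- functions F.
    record Automorphism-eq : Set ℓ where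
      field
        bijection : Inverse points points
      open Inverse bijection using (to) public
      field
        onM   : Automorphism 𝕄
        onM-≈ : ∀ x → to (ι₌ x) ≈ᵉᑫ ι₌ (Automorphism.to onM x)
        P-iff : ∀ {n} (e : ℰ n) x → P e x ⇔ P e (to x)
        F-hom : ∀ {n} (e : ℰ n) a → to (F e a) ≈ᵉᑫ F e (Automorphism.to onM ∘ a)

    𝕄-eq-space : Space ℓ
    𝕄-eq-space = record
      { points = points
      ; Auto   = Automorphism-eq
      ; act    = Automorphism-eq.to
      ; δ      = δ
      }

    embed : Subset → Pred M-eq ℓ
    embed A x = ∃ λ a → A a × x ≈ᵉᑫ ι₌ a

  ----------------------------------------------------------------------
  -- Global types

  record SuperMonster : Set (suc ℓ ⊔ k) where
    field
      𝕄′          : Structure L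
      𝕄′∈K        : K 𝕄′
      homogeneous : ModelHomogeneous 𝒦 (Carrier 𝕄′) 𝕄′
      universal   : Universal 𝒦 (Carrier 𝕄′) 𝕄′
      ι           : M → Carrier 𝕄′
      strong      : Strong 𝕄 𝕄′ ι
      larger      : M <# Carrier 𝕄′

  module Global (S : SuperMonster) where
    open SuperMonster S

    𝕄′-space : Space ℓ
    𝕄′-space = structureSpace 𝕄′ (Carrier 𝕄′)

    module T′ = Types 𝕄′-space

    ι[_] : Subset → T′.Subset
    ι[ A ] y = ∃ λ x → A x × ι x ≡ y

    ι[𝕄] : T′.Subset
    ι[𝕄] = T′.range ι

    -- p A is the set of realizations of p_A in 𝕄.  Families with an entry for every
    -- finite A are exactly the maximal ones, as a realization in 𝕄′ of a partial
    -- family provides the missing entries.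
    record GlobalType (n : ℕ) : Set (suc ℓ) where
      field
        p        : List M → Pred (Tuple n) ℓ
        galois   : ∀ A → ∃ λ c → ∀ d → p A d ⇔ SameGalois ⟨ A ⟩ c d
        coherent : ∀ {A B} → ⟨ A ⟩ ⊆ ⟨ B ⟩ → p B ⊆ p A

      Realizes : T′.Tuple n → Set ℓ
      Realizes b = ∀ A → ∃ λ c → p A c × T′.SameGalois ι[ ⟨ A ⟩ ] (ι ∘ c) b

      field
        realized : ∃ Realizes

    open GlobalType

    -- The choice of ℰ that makes canonical bases available: for a global type p, a
    -- realization b and a over which t(b/𝕄) does not split, q c i realizes the type
    -- qᵢᶜ, and the equivalence relation defined from q belongs to ℰ.
    CanonicalChoice : Imaginaries → Set (suc ℓ)
    CanonicalChoice I = ∀ {n l} (p : GlobalType n) (b : T′.Tuple n) → Realizes p b →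
      (a : Tuple l) → ¬ T′.Splits b ι[𝕄] (toList (ι ∘ a)) →
      ∃ λ (q : ∀ {m} → Tuple m → ℕ → Tuple (l +ⁿ m)) →
        (∀ {m} (c d : Tuple m) →
           T′.SameType∅ (b ++ (ι ∘ d)) (b ++ (ι ∘ c)) ⇔
           ∃ λ i → SameType∅ (a ++ d) (q c i)) ×
        (∃ λ (e : ℰ l) → ∀ a₀ a₁ → E e a₀ a₁ ⇔
           (∀ {m} (c d : Tuple m) →
              (∃ λ i → SameType∅ (a₀ ++ d) (q c i)) ⇔
              (∃ λ i → SameType∅ (a₁ ++ d) (q c i))))
      where open Imaginaries I

    module CanonicalBases (I : Imaginaries) where
      open Eq I
      open Automorphism-eq using (to; onM)

      -- f(p) = p
      FixesType : ∀ {n} → Automorphism-eq → GlobalType n → Set ℓ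
      FixesType f p = ∀ A B → (σ [ ⟨ B ⟩ ]) ≐ ⟨ A ⟩ → ∀ b → GlobalType.p p B b →
        GlobalType.p p A (σ ∘ b)
        where σ = Automorphism.to (onM f)

      IsCanonicalBase : ∀ {n r} → Vector M-eq r → GlobalType n → Set ℓ
      IsCanonicalBase α p = ∀ f → FixesType f p ⇔ (∀ i → to f (α i) ≈ᵉᑫ α i)

      -- α = Cb(a/A)
      IsCb : ∀ {n r} → Vector M-eq r → Tuple n → Subset → Set (suc ℓ)
      IsCb {n} α a A = ∃ λ (b : T′.Tuple n) →
        T′.SameLascar ι[ A ] b (ι ∘ a) ×
        T′.Indep b ι[ A ] ι[𝕄] ×
        ∃ λ (p : GlobalType n) → Realizes p b × IsCanonicalBase α p

      infix 4 _↓[_]_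

      -- a ↓_α A, computed in 𝕄ᵉᑫ
      _↓[_]_ : ∀ {n r} → Tuple n → Vector M-eq r → Subset → Set (suc ℓ)
      a ↓[ α ] A = Types.Indep 𝕄-eq-space (ι₌ ∘ a) (Types.range 𝕄-eq-space α) (embed A)

-- Let b′ realize the global type p with canonical base α.  Two facts are needed: some b in 𝕄
-- realizing p over a given bounded set has a type over that set that does not Lascar split over α,
-- and b and a have the same type over α and every finite part of A.
--
-- For the first, call c and d alike if they have the same type over α and a realization of p over
-- c, d and α.  As α is a canonical base, this equivalence relation is invariant under the
-- automorphisms fixing α, and by (AI) it has countably many classes; so Lascar equivalent tuples
-- over α are alike.
--
-- For the second, let A₁ ⊆ A be finite such that p does not Lascar split over A₁.  Lascar types of
-- elements of 𝕄 over A₁ are computed in 𝕄′, where "bounded" means of size less than |𝕄′|, which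
-- need not be inaccessible; still they number fewer than δ.  Otherwise the Erdős–Rado theorem
-- yields indiscernible sequences of pairwise inequivalent tuples with matching Skolem hulls, and the
-- Ehrenfeucht–Mostowski model over a well-order of size |𝕄′| refutes every equivalence relation
-- with fewer than |𝕄′| classes that separates them.  Hence a small family in 𝕄 meets all these
-- Lascar types; an automorphism fixing it, or a conjugate of it over A₁, preserves p and so fixes α.
-- The transitive closure of "same Galois type over some conjugate of the family" is a bounded
-- equivalence relation, so b′ and a, having the same Lascar type over A, are joined by a chain,
-- and each link is realized by an automorphism fixing α.

module Submission where

open import Defs
open import Level using (Level; _⊔_; Lift; lift; lower) renaming (suc to lsuc; zero to lzero)
open import Data.Bool using (Bool; true; false; not; if_then_else_)
open import Data.Bool.Properties using (not-¬)
open import Data.Empty using (⊥; ⊥-elim)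
open import Data.Unit using (⊤; tt)
open import Data.Fin using (Fin; toℕ; _↑ˡ_; _↑ʳ_) renaming (zero to fzero; suc to fsuc)
open import Data.List using (List; []; _∷_; map; length; lookup; tabulate; filter; concat) renaming (_++_ to _++ˡ_)
open import Data.List.Properties using (map-∘; map-cong; map-id; length-map; map-injective; tabulate-lookup; ∷-injective; tabulate-cong; map-tabulate; ++-assoc)
open import Data.List.Relation.Unary.All as All using (All; []; _∷_)
open import Data.List.Relation.Binary.Pointwise using (Pointwise; []; _∷_)
open import Data.List.Relation.Unary.AllPairs using (AllPairs; []; _∷_)
import Data.List.Relation.Unary.All.Properties as Allₚ
open import Data.List.Relation.Unary.Any as Any using (Any; here; there)
import Data.List.Relation.Unary.Any.Properties as Anyₚ
open import Data.List.Membership.Propositional using (_∈_)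
open import Data.List.Membership.Propositional.Properties using (∈-map⁺; ∈-map⁻; ∈-++⁺ˡ; ∈-++⁺ʳ; ∈-++⁻; ∈-tabulate⁺; ∈-tabulate⁻; ∈-lookup; ∈-filter⁺; ∈-filter⁻; ∈-concat⁺′; ∈-concat⁻′)
open import Data.Maybe using (Maybe; just; nothing)
open import Data.Maybe.Properties using (just-injective)
open import Data.Nat using (ℕ; zero; suc; z≤n; s≤s) renaming (_*_ to _*ⁿ_; _<_ to _<ⁿ_; _≤_ to _≤ⁿ_)
import Data.Nat.Properties as ℕₚ
open import Data.Fin.Properties using (toℕ-injective)
open import Data.Product using (Σ; ∃; ∃₂; _×_; _,_; proj₁; proj₂)
open import Data.Sum using (_⊎_; inj₁; inj₂; [_,_]′)
open import Data.Sum.Properties using (inj₁-injective; inj₂-injective)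
import Data.Vec.Functional
open import Data.Vec.Functional using (Vector) renaming (_++_ to _++ᵛ_)
open import Function using (_∘_; id; case_of_)
open import Function.Bundles using (_⇔_; _↣_; mk⇔; mk↣; Equivalence; Injection)
open import Induction.WellFounded using (WellFounded; Acc; acc)
open import Data.Nat.Induction using (<-wellFounded)
import Relation.Binary.Construct.On as On
open import Data.Vec.Functional.Properties using (lookup-++ˡ; lookup-++ʳ)
open import Relation.Binary.Construct.Closure.ReflexiveTransitive as Star using (Star; ε; _◅_; _◅◅_)
open import Relation.Binary using (Rel; IsEquivalence; IsStrictTotalOrder; Setoid; Tri; tri<; tri≈; tri>)
open import Relation.Binary.PropositionalEquality using (_≡_; _≢_; refl; sym; trans; cong; cong₂; subst) renaming (isEquivalence to ≡-isEquivalence)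
open import Relation.Nullary using (¬_; Dec; yes; no; does)
open import Relation.Unary using (Pred)
open import Axiom.ExcludedMiddle using (ExcludedMiddle)
open import Axiom.Extensionality.Propositional using (Extensionality)

-- Homogeneity moves models only: infinite families that agree on finite parts yield no automorphism
-- by themselves. Families are therefore closed to enumerated models (`Hull`) whose indices are
-- fixed in advance; between these, agreement of finite parts defines an isomorphism, which extends
-- (`fin⇒conj`). The stretched model and the count of chain classes both rest on this.
--
-- Partition arguments stay below `δ`, where inaccessibility is available, and deliver finite
-- patterns only. The stretched model is thus assembled from names. It may be as large as `𝕄′`, so
-- universality cannot place it there; it is amalgamated with a model of representatives, and only
-- pieces smaller than `𝕄′` are copied into `𝕄′`.
--
-- Lascar equivalence of `b′` and `a` speaks of `𝕄′`, while the conclusion asks for automorphisms of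
-- `𝕄`: `pull`, `up` and `down` carry small configurations across. A link of a chain fixes a
-- conjugate of the small family, not the family itself, because the relation must be invariant over
-- the finite set `A₁₂` alone.

module Classical (em : ∀ a → ExcludedMiddle a) (ext : ∀ a b → Extensionality a b) where

  dec : ∀ {a} (P : Set a) → Dec P
  dec _ = em _

  dne : ∀ {a} {P : Set a} → ¬ ¬ P → P
  dne {P = P} ¬¬p with dec P
  ... | yes p = p
  ... | no ¬p = ⊥-elim (¬¬p ¬p)

  ¬∀⇒∃¬ : ∀ {a b} {X : Set a} {P : X → Set b} → ¬ (∀ x → P x) → ∃ λ x → ¬ P x
  ¬∀⇒∃¬ ¬∀ = dne λ ¬∃ → ¬∀ λ x → dne λ ¬p → ¬∃ (x , ¬p)

  -- Boolean truth values turn predicates into functions, so that `ext` makes equivalent predicates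
  -- equal.
  ⌜_⌝ : ∀ {a} → Set a → Bool
  ⌜ P ⌝ = does (dec P)

  ⌜⌝-intro : ∀ {a} {P : Set a} → P → ⌜ P ⌝ ≡ true
  ⌜⌝-intro {P = P} p with dec P
  ... | yes _ = refl
  ... | no ¬p = ⊥-elim (¬p p)

  ⌜⌝-elim : ∀ {a} {P : Set a} → ⌜ P ⌝ ≡ true → P
  ⌜⌝-elim {P = P} eq with dec P
  ... | yes p = p

  ⌜⌝-false : ∀ {a} {P : Set a} → ¬ P → ⌜ P ⌝ ≡ false
  ⌜⌝-false {P = P} ¬p with dec P
  ... | yes p = ⊥-elim (¬p p)
  ... | no _ = refl

  ⌜⌝-cong : ∀ {a b} {P : Set a} {Q : Set b} → (P → Q) → (Q → P) → ⌜ P ⌝ ≡ ⌜ Q ⌝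
  ⌜⌝-cong {P = P} {Q} f g with dec P | dec Q
  ... | yes _ | yes _ = refl
  ... | no _  | no _  = refl
  ... | yes p | no ¬q = ⊥-elim (¬q (f p))
  ... | no ¬p | yes q = ⊥-elim (¬p (g q))

  true-irrelevant : ∀ {b : Bool} (p q : b ≡ true) → p ≡ q
  true-irrelevant refl refl = refl

  -- Unlike P, ∥ P ∥ has at most one proof.
  ∥_∥ : ∀ {a} → Set a → Set
  ∥ P ∥ = ⌜ P ⌝ ≡ true

  Σ∥∥-≡ : ∀ {a b} {X : Set a} {P : X → Set b} {u v : Σ X λ x → ∥ P x ∥} →
          proj₁ u ≡ proj₁ v → u ≡ v
  Σ∥∥-≡ {P = P} {x , p} {.x , q} refl = cong (x ,_) (true-irrelevant p q)

  choice-or : ∀ {a b} {X : Set a} (P : X → Set b) → X → X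
  choice-or P d with dec (∃ P)
  ... | yes (x , _) = x
  ... | no _ = d

  choice-or-spec : ∀ {a b} {X : Set a} (P : X → Set b) d → ∃ P → P (choice-or P d)
  choice-or-spec P d e with dec (∃ P)
  ... | yes (_ , p) = p
  ... | no ¬e = ⊥-elim (¬e e)

  choice-or-default : ∀ {a b} {X : Set a} (P : X → Set b) d → ¬ ∃ P → choice-or P d ≡ d
  choice-or-default P d ¬e with dec (∃ P)
  ... | yes e = ⊥-elim (¬e e)
  ... | no _ = refl

  abstract
    representatives : ∀ {a b} {X : Set a} {Y : Set b} (g : X → Y) → X →
      ∃ λ (r : Y → X) → ∀ x → g x ≡ g (r (g x))
    representatives g d = (λ y → choice-or (λ x → g x ≡ y) d) ,
      λ x → sym (choice-or-spec (λ z → g z ≡ g x) d (x , refl))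

  -- Quotients

  record Quotient {a r} (X : Set a) (_~_ : Rel X r) : Set (lsuc a ⊔ r) where
    field
      Q        : Set a
      [_]      : X → Q
      rep      : Q → X
      [rep]    : ∀ q → [ rep q ] ≡ q
      sound    : ∀ {x y} → x ~ y → [ x ] ≡ [ y ]
      complete : ∀ {x y} → [ x ] ≡ [ y ] → x ~ y

  -- The class of `x` is a Boolean function, and equivalent points have the same one. Choosing from
  -- that function gives a canonical member `norm x`; the quotient consists of the fixed points of
  -- `norm`.
  quotient : ∀ {a r} {X : Set a} {_~_ : Rel X r} → IsEquivalence _~_ → Quotient X _~_
  quotient {a} {r} {X} {_~_} isEq = record
    { Q = Σ X λ x → norm x ≡ x
    ; [_] = λ x → norm x , norm-idem x
    ; rep = proj₁
    ; [rep] = λ { (x , p) → pair-≡ p }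
    ; sound = λ x~y → pair-≡ (norm-cong x~y)
    ; complete = λ {x} {y} eq → trans~ (norm-~ x)
        (subst (_~ y) (sym (cong proj₁ eq)) (sym~ (norm-~ y)))
    }
    where
    open IsEquivalence isEq using () renaming (refl to refl~; sym to sym~; trans to trans~)

    member : X → X → Bool
    member x y = ⌜ x ~ y ⌝

    norm : X → X
    norm x = choice-or (λ y → member x y ≡ true) x

    norm-~ : ∀ x → x ~ norm x
    norm-~ x = ⌜⌝-elim (choice-or-spec (λ y → member x y ≡ true) x (x , ⌜⌝-intro refl~))

    choice-default-irrelevant : ∀ (χ : X → Bool) d d′ → ∃ (λ y → χ y ≡ true) →
      choice-or (λ y → χ y ≡ true) d ≡ choice-or (λ y → χ y ≡ true) d′
    choice-default-irrelevant χ d d′ e with dec (∃ λ y → χ y ≡ true)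
    ... | yes _ = refl
    ... | no ¬e = ⊥-elim (¬e e)

    norm-cong : ∀ {x y} → x ~ y → norm x ≡ norm y
    norm-cong {x} {y} x~y = trans
      (choice-default-irrelevant (member x) x y (x , ⌜⌝-intro refl~))
      (cong (λ χ → choice-or (λ z → χ z ≡ true) y)
        (ext a lzero λ z → ⌜⌝-cong (trans~ (sym~ x~y)) (trans~ x~y)))

    norm-idem : ∀ x → norm (norm x) ≡ norm x
    norm-idem x = sym (norm-cong (norm-~ x))

    pair-≡ : ∀ {x y} {p : norm x ≡ x} {q : norm y ≡ y} → x ≡ y → (x , p) ≡ (y , q)
    pair-≡ {p = p} {q} refl = cong (_ ,_) (uip p q)
      where
      uip : ∀ {x y : X} (p q : x ≡ y) → p ≡ q
      uip refl refl = refl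

  -- Well-founded recursion and well-orders

  module Recursion {a r} {X : Set a} {_<_ : Rel X r} (wf : WellFounded _<_)
                   {b} {B : X → Set b} (step : ∀ x → (∀ y → y < x → B y) → B x) where
    private
      go : ∀ x → Acc _<_ x → B x
      go x (acc rs) = step x λ y y<x → go y (rs y<x)

      go-irr : ∀ x (p q : Acc _<_ x) → go x p ≡ go x q
      go-irr x (acc rs) (acc rs′) = cong (step x)
        (ext _ _ λ y → ext _ _ λ y<x → go-irr y (rs y<x) (rs′ y<x))

    abstract
      wfix : ∀ x → B x
      wfix x = go x (wf x)

      wfix-unfold : ∀ x → wfix x ≡ step x (λ y _ → wfix y)
      wfix-unfold x with wf x
      ... | acc rs = cong (step x) (ext _ _ λ y → ext _ _ λ y<x → go-irr y (rs y<x) (wf y))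

  least : ∀ {a r p} {X : Set a} {_<_ : Rel X r} → WellFounded _<_ → (P : X → Set p) → ∃ P →
          ∃ λ x → P x × ∀ y → y < x → ¬ P y
  least {_<_ = _<_} wf P (x , px) = go x (wf x) px
    where
    go : ∀ x → Acc _<_ x → P x → ∃ λ x → P x × ∀ y → y < x → ¬ P y
    go x (acc rs) px with dec (∃ λ y → y < x × P y)
    ... | yes (y , y<x , py) = go y (rs y<x) py
    ... | no none = x , px , λ y y<x py → none (y , y<x , py)

  record WellOrder {a} (X : Set a) : Set (lsuc a) where
    field
      _<_   : Rel X a
      isSTO : IsStrictTotalOrder _≡_ _<_
      wf    : WellFounded _<_
    open IsStrictTotalOrder isSTO public using (compare) renaming (trans to <-trans; irrefl to <-irrefl′)

    <-irrefl : ∀ {x} → ¬ x < x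
    <-irrefl = <-irrefl′ refl

  mkWellOrder : ∀ {a} {X : Set a} (_<_ : Rel X a) → WellFounded _<_ →
    (∀ {x y z} → x < y → y < z → x < z) → (∀ x y → x < y ⊎ x ≡ y ⊎ y < x) → WellOrder X
  mkWellOrder {X = X} _<_ wf <-trans total = record
    { _<_ = _<_ ; wf = wf
    ; isSTO = record
      { isStrictPartialOrder = record
        { isEquivalence = ≡-isEquivalence
        ; irrefl = λ { refl → irr }
        ; trans = <-trans
        ; <-resp-≈ = (λ { refl p → p }) , λ { refl p → p } }
      ; compare = cmp } }
    where
    irr′ : ∀ x → Acc _<_ x → ¬ x < x
    irr′ x (acc rs) x<x = irr′ x (rs x<x) x<x
    irr : ∀ {x} → ¬ x < x
    irr {x} = irr′ x (wf x)
    cmp : ∀ x y → Tri (x < y) (x ≡ y) (y < x)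
    cmp x y with total x y
    ... | inj₁ p = tri< p (λ { refl → irr p }) (λ q → irr (<-trans p q))
    ... | inj₂ (inj₁ refl) = tri≈ irr refl irr
    ... | inj₂ (inj₂ q) = tri> (λ p → irr (<-trans p q)) (λ { refl → irr q }) q

  pullback : ∀ {a} {X Y : Set a} (f : X → Y) → (∀ {x y} → f x ≡ f y → x ≡ y) → WellOrder Y → WellOrder X
  pullback f f-inj w = mkWellOrder (λ x y → f x < f y) (λ x → go x (wf (f x))) <-trans total
    where
    open WellOrder w
    go : ∀ x → Acc _<_ (f x) → Acc (λ x y → f x < f y) x
    go x (acc rs) = acc λ p → go _ (rs p)
    total : ∀ x y → f x < f y ⊎ x ≡ y ⊎ f y < f x
    total x y with compare (f x) (f y)
    ... | tri< p _ _ = inj₁ p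
    ... | tri≈ _ e _ = inj₂ (inj₁ (f-inj e))
    ... | tri> _ _ q = inj₂ (inj₂ q)

  -- The well-ordering theorem, by transfinite exhaustion along Brouwer-style ordinals

  data Ord (ℓ : Level) : Set (lsuc ℓ) where
    sup : (A : Set ℓ) → (A → Ord ℓ) → Ord ℓ

  module Ordinals {ℓ : Level} where
    infix 4 _≤ᵒ_ _<ᵒ_
    _≤ᵒ_ _<ᵒ_ : Ord ℓ → Ord ℓ → Set ℓ
    sup A f ≤ᵒ β = ∀ a → f a <ᵒ β
    α <ᵒ sup B g = ∃ λ b → α ≤ᵒ g b

    total : ∀ α β → α ≤ᵒ β ⊎ β <ᵒ α
    total (sup A f) β with dec (∀ a → f a <ᵒ β)
    ... | yes p = inj₁ p
    ... | no ¬p with ¬∀⇒∃¬ ¬p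
    ...   | a , fa≮β with total β (f a)
    ...     | inj₁ β≤fa = inj₂ (a , β≤fa)
    ...     | inj₂ fa<β = ⊥-elim (fa≮β fa<β)

    mutual
      ≤-transᵒ : ∀ α β γ → α ≤ᵒ β → β ≤ᵒ γ → α ≤ᵒ γ
      ≤-transᵒ (sup A f) β γ p q a = <-≤-transᵒ (f a) β γ (p a) q

      <-≤-transᵒ : ∀ α β γ → α <ᵒ β → β ≤ᵒ γ → α <ᵒ γ
      <-≤-transᵒ α (sup B g) γ (b , α≤gb) q = ≤-<-transᵒ α (g b) γ α≤gb (q b)

      ≤-<-transᵒ : ∀ α β γ → α ≤ᵒ β → β <ᵒ γ → α <ᵒ γ
      ≤-<-transᵒ α β (sup C h) p (c , β≤hc) = c , ≤-transᵒ α β (h c) p β≤hc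

    ≤-reflᵒ : ∀ α → α ≤ᵒ α
    ≤-reflᵒ (sup A f) a = a , ≤-reflᵒ (f a)

    <⇒≤ᵒ : ∀ α β → α <ᵒ β → α ≤ᵒ β
    <⇒≤ᵒ (sup A f) (sup B g) (b , p) a =
      b , <⇒≤ᵒ (f a) (g b) (p a)

    mutual
      acc-≤ᵒ : ∀ α β → α ≤ᵒ β → Acc _<ᵒ_ α
      acc-≤ᵒ α (sup B g) α≤β = acc λ {γ} γ<α → acc-<ᵒ γ (sup B g) (<-≤-transᵒ γ α (sup B g) γ<α α≤β)

      acc-<ᵒ : ∀ α β → α <ᵒ β → Acc _<ᵒ_ α
      acc-<ᵒ α (sup B g) (b , p) = acc-≤ᵒ α (g b) p

    <ᵒ-wellFounded : WellFounded _<ᵒ_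
    <ᵒ-wellFounded α = acc-≤ᵒ α α (≤-reflᵒ α)

  module Exhaustion {ℓ : Level} (X : Set ℓ) where
    open Ordinals {ℓ}

    -- The choice depends on the characteristic function alone, so stages with the same past
    -- enumerate the same element.
    fresh : (X → Bool) → Maybe X
    fresh χ with dec (∃ λ x → χ x ≡ false)
    ... | yes (x , _) = just x
    ... | no _ = nothing

    fresh-new : ∀ χ {x} → fresh χ ≡ just x → χ x ≡ false
    fresh-new χ eq with dec (∃ λ x → χ x ≡ false)
    fresh-new χ refl | yes (_ , p) = p

    fresh-just : ∀ χ {x} → χ x ≡ false → ∃ λ y → fresh χ ≡ just y
    fresh-just χ p with dec (∃ λ x → χ x ≡ false)
    ... | yes (y , _) = y , refl
    ... | no none = ⊥-elim (none (_ , p))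

    mutual
      -- The elements enumerated before stage α, and the one enumerated at stage α.
      V : Ord ℓ → X → Set ℓ
      V (sup A f) x = ∃ λ a → V (f a) x ⊎ at (f a) ≡ just x

      at : Ord ℓ → Maybe X
      at α = fresh λ x → ⌜ V α x ⌝

    at-cong : ∀ α β → (∀ x → V α x → V β x) → (∀ x → V β x → V α x) → at α ≡ at β
    at-cong α β f g = cong fresh (ext ℓ lzero λ x → ⌜⌝-cong (f x) (g x))

    mutual
      V-mono : ∀ α β → α ≤ᵒ β → ∀ x → V α x → V β x
      V-mono (sup A f) β p x (a , inj₁ v) = V-mono (f a) β (<⇒≤ᵒ (f a) β (p a)) x v
      V-mono (sup A f) β p x (a , inj₂ e) = at-∈V (f a) β (p a) x e

      at-∈V : ∀ α β → α <ᵒ β → ∀ x → at α ≡ just x → V β x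
      at-∈V α (sup B g) (b , α≤gb) x e with total (g b) α
      ... | inj₂ α<gb = b , inj₁ (at-∈V α (g b) α<gb x e)
      ... | inj₁ gb≤α = b , inj₂ (trans (at-cong (g b) α (V-mono (g b) α gb≤α) (V-mono α (g b) α≤gb)) e)

    V-hit : ∀ α x → V α x → ∃ λ β → at β ≡ just x
    V-hit (sup A f) x (a , inj₁ v) = V-hit (f a) x v
    V-hit (sup A f) x (a , inj₂ e) = f a , e

    private
      Hit : X → Set (lsuc ℓ)
      Hit x = ∃ λ β → at β ≡ just x

      Ω : Ord ℓ
      Ω = sup (Σ X λ x → ∥ Hit x ∥) λ { (x , h) → proj₁ (⌜⌝-elim h) }

      hit⇒VΩ : ∀ x → Hit x → V Ω x
      hit⇒VΩ x h = (x , ⌜⌝-intro h) , inj₂ (proj₂ (⌜⌝-elim (⌜⌝-intro h)))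

      -- `Ω` lies above one hitting stage of each element that is ever hit. If something were still
      -- missing, stage `Ω` would enumerate a new element; being hit, that element was enumerated
      -- before `Ω`.
      all-VΩ : ∀ x → V Ω x
      all-VΩ x with dec (V Ω x)
      ... | yes v = v
      ... | no ¬v with fresh-just (λ x → ⌜ V Ω x ⌝) {x} (⌜⌝-false ¬v)
      ...   | y , e with trans (sym (⌜⌝-intro (hit⇒VΩ y (Ω , e)))) (fresh-new (λ x → ⌜ V Ω x ⌝) e)
      ...     | ()

    rank : X → Ord ℓ
    rank x = proj₁ (V-hit Ω x (all-VΩ x))

    at-rank : ∀ x → at (rank x) ≡ just x
    at-rank x = proj₂ (V-hit Ω x (all-VΩ x))

    rank-injective : ∀ {x y} → rank x ≤ᵒ rank y → rank y ≤ᵒ rank x → x ≡ y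
    rank-injective {x} {y} p q = just-injective
      (trans (sym (at-rank x)) (trans (at-cong (rank x) (rank y) (V-mono _ _ p) (V-mono _ _ q)) (at-rank y)))

    wellOrder : WellOrder X
    wellOrder = mkWellOrder (λ x y → rank x <ᵒ rank y) wf
      (λ {x} {y} {z} p q → <-≤-transᵒ (rank x) (rank y) (rank z) p (<⇒≤ᵒ (rank y) (rank z) q))
      total′
      where
      wf : WellFounded λ x y → rank x <ᵒ rank y
      wf x = go x (<ᵒ-wellFounded (rank x))
        where
        go : ∀ x → Acc _<ᵒ_ (rank x) → Acc (λ x y → rank x <ᵒ rank y) x
        go x (acc rs) = acc λ {y} p → go y (rs p)
      total′ : ∀ x y → rank x <ᵒ rank y ⊎ x ≡ y ⊎ rank y <ᵒ rank x
      total′ x y with total (rank x) (rank y) | total (rank y) (rank x)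
      ... | inj₂ p | _ = inj₂ (inj₂ p)
      ... | inj₁ _ | inj₂ q = inj₁ q
      ... | inj₁ p | inj₁ q = inj₂ (inj₁ (rank-injective p q))

-- Cardinal arithmetic with injections

module Cardinals (em : ∀ a → ExcludedMiddle a) (ext : ∀ a b → Extensionality a b) where
  open Classical em ext

  infixr 9 _⊚_
  _⊚_ : ∀ {a b c} {A : Set a} {B : Set b} {C : Set c} → B ↣ C → A ↣ B → A ↣ C
  g ⊚ f = mk↣ λ eq → Injection.injective f (Injection.injective g eq)

  ↣-refl : ∀ {a} {A : Set a} → A ↣ A
  ↣-refl = mk↣ id

  lift↣ : ∀ {a} b {A : Set a} → Lift b A ↣ A
  lift↣ b = mk↣ {to = lower} λ { refl → refl }

  lower↣ : ∀ {a} b {A : Set a} → A ↣ Lift b A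
  lower↣ b = mk↣ {to = lift} λ { refl → refl }

  ∥∥↣ : ∀ {a b} {X : Set a} {P : X → Set b} → Σ X (λ x → ∥ P x ∥) ↣ X
  ∥∥↣ {P = P} = mk↣ {to = proj₁} (Σ∥∥-≡ {P = P})

  ⊎↣ : ∀ {a b c d} {A : Set a} {B : Set b} {C : Set c} {D : Set d} →
       A ↣ C → B ↣ D → (A ⊎ B) ↣ (C ⊎ D)
  ⊎↣ {A = A} {B} {C} {D} f g = mk↣ {to = h} h-inj
    where
    h : A ⊎ B → C ⊎ D
    h (inj₁ x) = inj₁ (Injection.to f x)
    h (inj₂ y) = inj₂ (Injection.to g y)
    h-inj : ∀ {x y} → h x ≡ h y → x ≡ y
    h-inj {inj₁ _} {inj₁ _} eq = cong inj₁ (Injection.injective f (inj₁-injective eq))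
    h-inj {inj₂ _} {inj₂ _} eq = cong inj₂ (Injection.injective g (inj₂-injective eq))

  ×↣ : ∀ {a b c d} {A : Set a} {B : Set b} {C : Set c} {D : Set d} →
       A ↣ C → B ↣ D → (A × B) ↣ (C × D)
  ×↣ f g = mk↣ {to = λ { (x , y) → Injection.to f x , Injection.to g y }}
    λ eq → cong₂ _,_ (Injection.injective f (cong proj₁ eq)) (Injection.injective g (cong proj₂ eq))

  -- Countable sets

  -- Bijective base 2, with digits 1 and 2: leading digits are never lost.
  bits : List Bool → ℕ
  bits [] = 0
  bits (false ∷ l) = suc (2 *ⁿ bits l)
  bits (true ∷ l) = suc (suc (2 *ⁿ bits l))

  bits-injective : ∀ {l l′} → bits l ≡ bits l′ → l ≡ l′
  bits-injective {[]} {[]} _ = refl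
  bits-injective {[]} {false ∷ _} ()
  bits-injective {[]} {true ∷ _} ()
  bits-injective {false ∷ _} {[]} ()
  bits-injective {true ∷ _} {[]} ()
  bits-injective {false ∷ l} {false ∷ l′} eq =
    cong (false ∷_) (bits-injective (ℕₚ.*-cancelˡ-≡ _ _ 2 (ℕₚ.suc-injective eq)))
  bits-injective {true ∷ l} {true ∷ l′} eq =
    cong (true ∷_) (bits-injective (ℕₚ.*-cancelˡ-≡ _ _ 2 (ℕₚ.suc-injective (ℕₚ.suc-injective eq))))
  bits-injective {false ∷ l} {true ∷ l′} eq =
    ⊥-elim (ℕₚ.even≢odd (bits l) (bits l′) (ℕₚ.suc-injective eq))
  bits-injective {true ∷ l} {false ∷ l′} eq =
    ⊥-elim (ℕₚ.even≢odd (bits l′) (bits l) (sym (ℕₚ.suc-injective eq)))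

  -- A prefix code, so that concatenated numbers can be separated again.
  unary : ℕ → List Bool → List Bool
  unary zero l = false ∷ l
  unary (suc n) l = true ∷ unary n l

  unary-injective : ∀ n n′ {l l′} → unary n l ≡ unary n′ l′ → n ≡ n′ × l ≡ l′
  unary-injective zero zero refl = refl , refl
  unary-injective (suc n) (suc n′) eq with unary-injective n n′ (proj₂ (∷-injective eq))
  ... | refl , eq′ = refl , eq′

  nats : List ℕ → List Bool
  nats [] = []
  nats (n ∷ ns) = unary n (nats ns)

  nats-injective : ∀ {l l′} → nats l ≡ nats l′ → l ≡ l′
  nats-injective {[]} {[]} _ = refl
  nats-injective {[]} {zero ∷ _} ()
  nats-injective {[]} {suc _ ∷ _} ()
  nats-injective {zero ∷ _} {[]} ()
  nats-injective {suc _ ∷ _} {[]} ()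
  nats-injective {n ∷ l} {n′ ∷ l′} eq with unary-injective n n′ eq
  ... | refl , eq′ = cong (n ∷_) (nats-injective eq′)

  countable-List : ∀ {a} {A : Set a} → A ↣ ℕ → List A ↣ ℕ
  countable-List f = mk↣ {to = λ l → bits (nats (map (Injection.to f) l))}
    λ eq → map-injective (Injection.injective f) (nats-injective (bits-injective eq))

  countable-× : ∀ {a b} {A : Set a} {B : Set b} → A ↣ ℕ → B ↣ ℕ → (A × B) ↣ ℕ
  countable-× f g = countable-List ↣-refl ⊚
    mk↣ {to = λ { (x , y) → Injection.to f x ∷ Injection.to g y ∷ [] }}
      λ eq → cong₂ _,_ (Injection.injective f (proj₁ (∷-injective eq)))
                       (Injection.injective g (proj₁ (∷-injective (proj₂ (∷-injective eq)))))

  bool↣ℕ : Bool ↣ ℕ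
  bool↣ℕ = mk↣ {to = λ b → if b then 1 else 0} λ { {false} {false} _ → refl ; {true} {true} _ → refl }

  fin↣ℕ : ∀ n → Fin n ↣ ℕ
  fin↣ℕ n = mk↣ {to = toℕ} toℕ-injective

  ⊎↣× : ∀ {a b} {A : Set a} {B : Set b} → A → B → (A ⊎ B) ↣ (Bool × A × B)
  ⊎↣× {A = A} {B} a₀ b₀ = mk↣ {to = h} h-inj
    where
    h : A ⊎ B → Bool × A × B
    h (inj₁ a) = true , a , b₀
    h (inj₂ b) = false , a₀ , b
    h-inj : ∀ {x y} → h x ≡ h y → x ≡ y
    h-inj {inj₁ _} {inj₁ _} refl = refl
    h-inj {inj₂ _} {inj₂ _} refl = refl
    h-inj {inj₁ _} {inj₂ _} ()
    h-inj {inj₂ _} {inj₁ _} ()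

  countable-⊎ : ∀ {a b} {A : Set a} {B : Set b} → A ↣ ℕ → B ↣ ℕ → (A ⊎ B) ↣ ℕ
  countable-⊎ f g = countable-× bool↣ℕ (countable-× ↣-refl ↣-refl) ⊚ ⊎↣× 0 0 ⊚ ⊎↣ f g

  -- Multiplication of infinite cardinals by ℕ

  ℕ↣-from-fresh : ∀ {a} {X : Set a} → (∀ (l : List X) → ∃ λ x → ¬ x ∈ l) → ℕ ↣ X
  ℕ↣-from-fresh {X = X} fresh = mk↣ {to = f} f-inj
    where
    stage : ℕ → List X
    stage zero = []
    stage (suc n) = proj₁ (fresh (stage n)) ∷ stage n
    f : ℕ → X
    f n = proj₁ (fresh (stage n))
    earlier : ∀ {m n} → m <ⁿ n → f m ∈ stage n
    earlier {m} {suc n} m<1+n with ℕₚ.m≤n⇒m<n∨m≡n m<1+n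
    ... | inj₁ (s≤s m<n) = there (earlier m<n)
    ... | inj₂ refl = here refl
    distinct : ∀ {m n} → m <ⁿ n → f m ≢ f n
    distinct {m} {n} m<n eq = proj₂ (fresh (stage n)) (subst (_∈ stage n) eq (earlier m<n))
    f-inj : ∀ {m n} → f m ≡ f n → m ≡ n
    f-inj {m} {n} eq with ℕₚ.<-cmp m n
    ... | tri< m<n _ _ = ⊥-elim (distinct m<n eq)
    ... | tri≈ _ m≡n _ = m≡n
    ... | tri> _ _ n<m = ⊥-elim (distinct n<m (sym eq))

  ∈-list↣ℕ : ∀ {a} {X : Set a} (l : List X) → (∀ x → x ∈ l) → X ↣ ℕ
  ∈-list↣ℕ l all∈ = mk↣ {to = λ x → toℕ (index (all∈ x))} λ {x} {y} eq →
    trans (lookup-index (all∈ x))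
      (trans (cong (lookup l) (toℕ-injective eq)) (sym (lookup-index (all∈ y))))
    where open import Data.List.Relation.Unary.Any using (index)
          open import Data.List.Relation.Unary.Any.Properties using (lookup-index)

  infinite-or-countable : ∀ {a} (X : Set a) → ℕ ↣ X ⊎ X ↣ ℕ
  infinite-or-countable X with dec (∀ (l : List X) → ∃ λ x → ¬ x ∈ l)
  ... | yes fresh = inj₁ (ℕ↣-from-fresh fresh)
  ... | no ¬fresh with ¬∀⇒∃¬ ¬fresh
  ...   | l , none = inj₂ (∈-list↣ℕ l λ x → dne λ x∉l → none (x , x∉l))

  -- The selected sequences cover `Z` up to a countable rest, so `Z` has the size of `S × ℕ`, and a
  -- further factor `ℕ` is absorbed by `ℕ × ℕ ↣ ℕ`.
  module Absorb {a} {Z : Set a} (e : ℕ ↣ Z) where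
    private
      open WellOrder (Exhaustion.wellOrder (ℕ → Z)) using (_<_; compare; wf)

      Disjoint : (f g : ℕ → Z) → Set a
      Disjoint f g = ∀ m n → f m ≢ g n

      Inj : (ℕ → Z) → Set a
      Inj f = ∀ {m n} → f m ≡ f n → m ≡ n

      selectStep : ∀ f → (∀ g → g < f → Set a) → Set a
      selectStep f rec = Inj f × ∀ g (g<f : g < f) → rec g g<f → Disjoint f g

      open Recursion wf selectStep

      -- A maximal family of disjoint sequences, chosen greedily.
      Sel : (ℕ → Z) → Set a
      Sel = wfix

      sel-elim : ∀ {f} → Sel f → Inj f × ∀ g → g < f → Sel g → Disjoint f g
      sel-elim {f} s = subst (λ X → X) (wfix-unfold f) s

      sel-intro : ∀ {f} → Inj f × (∀ g → g < f → Sel g → Disjoint f g) → Sel f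
      sel-intro {f} s = subst (λ X → X) (sym (wfix-unfold f)) s

      S : Set a
      S = Σ (ℕ → Z) λ f → ∥ Sel f ∥

      Covered : Z → Set a
      Covered z = ∃ λ (s : S) → ∃ λ n → proj₁ s n ≡ z

      Rest : Set a
      Rest = Σ Z λ z → ∥ ¬ Covered z ∥

      ¬ℕ↣Rest : ¬ (ℕ ↣ Rest)
      ¬ℕ↣Rest r = ⌜⌝-elim (proj₂ (Injection.to r 0)) ((f , ⌜⌝-intro sel-f) , 0 , refl)
        where
        f : ℕ → Z
        f n = proj₁ (Injection.to r n)
        sel-f : Sel f
        sel-f = sel-intro ((λ eq → Injection.injective r (Σ∥∥-≡ {P = λ z → ¬ Covered z} eq)) ,
          λ g _ sel-g m n eq →
            ⌜⌝-elim (proj₂ (Injection.to r m)) ((g , ⌜⌝-intro sel-g) , n , sym eq))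

      rest↣ℕ : Rest ↣ ℕ
      rest↣ℕ with infinite-or-countable Rest
      ... | inj₁ r = ⊥-elim (¬ℕ↣Rest r)
      ... | inj₂ r = r

      s₀ : S
      s₀ = dne λ none → ¬ℕ↣Rest (mk↣ {to = λ n → Injection.to e n , ⌜⌝-intro (λ { (s , _) → none s })}
        λ eq → Injection.injective e (cong proj₁ eq))

      S×ℕ↣Z : (S × ℕ) ↣ Z
      S×ℕ↣Z = mk↣ {to = λ { ((f , _) , n) → f n }} λ { {(f , p) , m} {(g , q) , n} eq → go f p m g q n eq }
        where
        go : ∀ f p m g q n → f m ≡ g n → ((f , p) , m) ≡ ((g , q) , n)
        go f p m g q n eq with compare f g
        ... | tri< f<g _ _ = ⊥-elim (proj₂ (sel-elim (⌜⌝-elim q)) f f<g (⌜⌝-elim p) n m (sym eq))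
        ... | tri> _ _ g<f = ⊥-elim (proj₂ (sel-elim (⌜⌝-elim p)) g g<f (⌜⌝-elim q) m n eq)
        ... | tri≈ _ refl _ = cong₂ _,_ (Σ∥∥-≡ {P = Sel} refl) (proj₁ (sel-elim (⌜⌝-elim p)) eq)

      Z↣S×ℕ⊎ℕ : Z ↣ ((S × ℕ) ⊎ ℕ)
      Z↣S×ℕ⊎ℕ = mk↣ {to = λ z → place z (dec (Covered z))} λ {x} {y} → place-inj (dec (Covered x)) (dec (Covered y))
        where
        place : ∀ z → Dec (Covered z) → (S × ℕ) ⊎ ℕ
        place z (yes (s , n , _)) = inj₁ (s , n)
        place z (no ¬c) = inj₂ (Injection.to rest↣ℕ (z , ⌜⌝-intro ¬c))
        place-inj : ∀ {x y} (p : Dec (Covered x)) (q : Dec (Covered y)) → place x p ≡ place y q → x ≡ y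
        place-inj (yes (s , n , e)) (yes (.s , .n , e′)) refl = trans (sym e) e′
        place-inj {x} {y} (no _) (no _) eq = cong proj₁ (Injection.injective rest↣ℕ (inj₂-injective eq))

      -- The sequences retreat to even positions; the rest moves to the odd positions of `s₀`.
      S×ℕ⊎ℕ↣S×ℕ : ((S × ℕ) ⊎ ℕ) ↣ (S × ℕ)
      S×ℕ⊎ℕ↣S×ℕ = mk↣ {to = h} h-inj
        where
        h : (S × ℕ) ⊎ ℕ → S × ℕ
        h (inj₁ (s , n)) = s , 2 *ⁿ n
        h (inj₂ n) = s₀ , suc (2 *ⁿ n)
        h-inj : ∀ {x y} → h x ≡ h y → x ≡ y
        h-inj {inj₁ (s , m)} {inj₁ (t , n)} eq =
          cong inj₁ (cong₂ _,_ (cong proj₁ eq) (ℕₚ.*-cancelˡ-≡ m n 2 (cong proj₂ eq)))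
        h-inj {inj₂ m} {inj₂ n} eq = cong inj₂ (ℕₚ.*-cancelˡ-≡ m n 2 (ℕₚ.suc-injective (cong proj₂ eq)))
        h-inj {inj₁ (_ , m)} {inj₂ n} eq = ⊥-elim (ℕₚ.even≢odd m n (cong proj₂ eq))
        h-inj {inj₂ m} {inj₁ (_ , n)} eq = ⊥-elim (ℕₚ.even≢odd n m (sym (cong proj₂ eq)))

    ×ℕ↣ : (Z × ℕ) ↣ Z
    ×ℕ↣ = S×ℕ↣Z ⊚ ×↣ ↣-refl (countable-× ↣-refl ↣-refl) ⊚
      mk↣ {to = λ { ((s , m) , n) → s , m , n }} (λ { refl → refl }) ⊚
      ×↣ (S×ℕ⊎ℕ↣S×ℕ ⊚ Z↣S×ℕ⊎ℕ) ↣-refl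

  -- Strict inequality of cardinals

  cantor : ∀ {a} {X : Set a} → ¬ ((X → Bool) ↣ X)
  cantor {X = X} f = diag (dec _) refl
    where
    d : X → Bool
    pick : ∀ x → Dec (∃ λ g → Injection.to f g ≡ x) → Bool
    pick x (yes (g , _)) = not (g x)
    pick x (no _) = true
    d x = pick x (dec _)
    diag : (p : Dec (∃ λ g → Injection.to f g ≡ Injection.to f d)) →
           d (Injection.to f d) ≡ pick (Injection.to f d) p → ⊥
    diag (no ¬e) _ = ¬e (d , refl)
    diag (yes (g , eq)) p with Injection.injective f eq
    ... | refl = not-¬ refl p

  <#-down : ∀ {a b c} {A : Set a} {B : Set b} {C : Set c} → A ↣ B → B <# C → A <# C
  <#-down f (g , ¬h) = g ⊚ f , λ h → ¬h (f ⊚ h)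

  -- Used below `|𝕄′|`, which need be neither regular nor a limit. One bound `Z` that absorbs
  -- countable factors replaces closure of the smaller cardinals under sums.
  absorbing : ∀ {a c} {X : Set a} {C : Set c} → ℕ <# C → X <# C →
    ∃ λ (Z : Set a) → Z <# C × X ↣ Z × (Z × ℕ) ↣ Z × ℕ ↣ Z
  absorbing {a} {X = X} ℕ<C X<C with infinite-or-countable X
  ... | inj₁ e = X , X<C , ↣-refl , Absorb.×ℕ↣ e , e
  ... | inj₂ X↣ℕ = Lift a ℕ , <#-down (lift↣ a) ℕ<C , lower↣ a ⊚ X↣ℕ ,
    lower↣ a ⊚ countable-× (lift↣ a) ↣-refl , lower↣ a

  absorb-⊎ : ∀ {a b c} {X : Set a} {Y : Set b} {Z : Set c} → (Z × ℕ) ↣ Z → Z →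
    X ↣ Z → Y ↣ Z → (X ⊎ Y) ↣ Z
  absorb-⊎ {Z = Z} m z₀ f g = m ⊚ mk↣ {to = h} h-inj ⊚ ⊎↣ f g
    where
    h : Z ⊎ Z → Z × ℕ
    h (inj₁ x) = x , 0
    h (inj₂ y) = y , 1
    h-inj : ∀ {x y} → h x ≡ h y → x ≡ y
    h-inj {inj₁ _} {inj₁ _} refl = refl
    h-inj {inj₂ _} {inj₂ _} refl = refl

  module Small {ℓ} {δ : Set ℓ} (inacc : Inaccessible δ) where
    open Inaccessible inacc

    small-↣ : ∀ {a b} {A : Set a} {B : Set b} → A ↣ B → B <# δ → A <# δ
    small-↣ = <#-down

    small-countable : ∀ {a} {A : Set a} → A ↣ ℕ → A <# δ
    small-countable f = small-↣ f uncountable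

    small-Σ : ∀ {I : Set ℓ} {F : I → Set ℓ} → I <# δ → (∀ i → F i <# δ) → Σ I F <# δ
    small-Σ = regular _ _

    -- The image in `δ` is a copy at level `ℓ`, the level at which `regular` and `strongLimit`
    -- apply.
    resize : ∀ {a} {A : Set a} → A <# δ → ∃ λ (B : Set ℓ) → A ↣ B × B ↣ A
    resize {A = A} (f , _) = (Σ δ λ d → ∥ (∃ λ c → Injection.to f c ≡ d) ∥) ,
      mk↣ {to = λ c → Injection.to f c , ⌜⌝-intro (c , refl)}
        (λ eq → Injection.injective f (cong proj₁ eq)) ,
      mk↣ {to = λ { (d , p) → proj₁ (⌜⌝-elim p) }} (λ { {d , p} {d′ , q} eq →
        Σ∥∥-≡ {P = λ d → ∃ λ c → Injection.to f c ≡ d}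
          (trans (sym (proj₂ (⌜⌝-elim p))) (trans (cong (Injection.to f) eq) (proj₂ (⌜⌝-elim q)))) })

    small-⊎ : ∀ {a b} {A : Set a} {B : Set b} → A <# δ → B <# δ → (A ⊎ B) <# δ
    small-⊎ A<δ B<δ with resize A<δ | resize B<δ
    ... | A′ , f , f′ | B′ , g , g′ = small-↣ (mk↣ {to = h} h-inj ⊚ ⊎↣ f g)
      (small-Σ {F = F} (small-countable (bool↣ℕ ⊚ lift↣ ℓ)) F<δ)
      where
      F : Lift ℓ Bool → Set ℓ
      F (lift b) = if b then A′ else B′
      F<δ : ∀ i → F i <# δ
      F<δ (lift true) = small-↣ f′ A<δ
      F<δ (lift false) = small-↣ g′ B<δ
      h : A′ ⊎ B′ → Σ (Lift ℓ Bool) F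
      h (inj₁ a) = lift true , a
      h (inj₂ b) = lift false , b
      h-inj : ∀ {x y} → h x ≡ h y → x ≡ y
      h-inj {inj₁ _} {inj₁ _} refl = refl
      h-inj {inj₂ _} {inj₂ _} refl = refl
      h-inj {inj₁ _} {inj₂ _} ()
      h-inj {inj₂ _} {inj₁ _} ()

    small-× : ∀ {A B : Set ℓ} → A <# δ → B <# δ → (A × B) <# δ
    small-× A<δ B<δ = small-Σ A<δ λ _ → B<δ

    small-→Bool : ∀ {A : Set ℓ} → A <# δ → (A → Bool) <# δ
    small-→Bool = strongLimit _

    small-→ : ∀ {A B : Set ℓ} → A <# δ → B <# δ → (A → B) <# δ
    small-→ {A} {B} A<δ B<δ = small-↣ (mk↣ {to = graph} graph-inj) (small-→Bool (small-× A<δ B<δ))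
      where
      graph : (A → B) → A × B → Bool
      graph f (x , y) = ⌜ f x ≡ y ⌝
      graph-inj : ∀ {f g} → graph f ≡ graph g → f ≡ g
      graph-inj {f} {g} eq = ext ℓ ℓ λ x → sym (⌜⌝-elim
        (trans (sym (cong (λ h → h (x , f x)) eq)) (⌜⌝-intro refl)))

    small-→ℕ : ∀ {A : Set ℓ} → A <# δ → (A → ℕ) <# δ
    small-→ℕ A<δ = small-↣ (mk↣ {to = λ f x → lift (f x)} λ eq → ext _ _ λ x → cong (λ h → lower (h x)) eq)
      (small-→ A<δ (small-countable (lift↣ ℓ)))

    small-List : ∀ {A : Set ℓ} → A <# δ → List A <# δ
    small-List {A} A<δ = small-↣ (mk↣ {to = λ l n → at l (lower n)} λ {l} {l′} eq → at-inj l l′ (λ n → cong (λ h → h (lift n)) eq))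
      (small-→ {Lift ℓ ℕ} (small-countable (lift↣ ℓ)) Maybe<δ)
      where
      Maybe<δ : Maybe A <# δ
      Maybe<δ = small-↣ (mk↣ {to = tag} tag-inj) (small-⊎ A<δ (small-countable (↣-refl {A = ℕ})))
        where
        tag : Maybe A → A ⊎ ℕ
        tag (just x) = inj₁ x
        tag nothing = inj₂ 0
        tag-inj : ∀ {x y} → tag x ≡ tag y → x ≡ y
        tag-inj {just _} {just _} refl = refl
        tag-inj {nothing} {nothing} refl = refl
      at : List A → ℕ → Maybe A
      at [] _ = nothing
      at (x ∷ _) zero = just x
      at (_ ∷ l) (suc n) = at l n
      at-inj : ∀ l l′ → (∀ n → at l n ≡ at l′ n) → l ≡ l′
      at-inj [] [] _ = refl
      at-inj [] (_ ∷ _) eq with eq 0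
      ... | ()
      at-inj (_ ∷ _) [] eq with eq 0
      ... | ()
      at-inj (x ∷ l) (y ∷ l′) eq = cong₂ _∷_ (just-injective (eq 0)) (at-inj l l′ (eq ∘ suc))

-- Automorphisms, strong embeddings and enumerated submodels

module AECTools (em : ∀ a → ExcludedMiddle a) (ext : ∀ a b → Extensionality a b) where
  open Classical em ext
  open Cardinals em ext
  open Automorphism using (to; isIso)
  open IsIsomorphism
  open IsEmbedding

  to⇔ : ∀ {a b} {A : Set a} {B : Set b} → A ⇔ B → A → B
  to⇔ = Equivalence.to

  from⇔ : ∀ {a b} {A : Set a} {B : Set b} → A ⇔ B → B → A
  from⇔ = Equivalence.from

  _⇔∘_ : ∀ {a b c} {A : Set a} {B : Set b} {C : Set c} → B ⇔ C → A ⇔ B → A ⇔ C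
  g ⇔∘ f = mk⇔ (to⇔ g ∘ to⇔ f) (from⇔ f ∘ from⇔ g)

  map≡⇒∈ : ∀ {a b c} {W : Set a} {B : Set b} {C : Set c} {s : B → C} {w : W → B} {w′ : W → C} (l : List W) →
    map s (map w l) ≡ map w′ l → ∀ {k} → k ∈ l → s (w k) ≡ w′ k
  map≡⇒∈ (_ ∷ _) eq (here refl) = proj₁ (∷-injective eq)
  map≡⇒∈ (_ ∷ l) eq (there k∈l) = map≡⇒∈ l (proj₂ (∷-injective eq)) k∈l

  ∈⇒map≡ : ∀ {a b c} {W : Set a} {B : Set b} {C : Set c} {s : B → C} {w : W → B} {w′ : W → C} (l : List W) →
    (∀ {k} → k ∈ l → s (w k) ≡ w′ k) → map s (map w l) ≡ map w′ l
  ∈⇒map≡ [] eq = refl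
  ∈⇒map≡ (_ ∷ l) eq = cong₂ _∷_ (eq (here refl)) (∈⇒map≡ l (eq ∘ there))

  module _ {ℓ : Level} {L : Language ℓ} where

    id-iso : ∀ {A : Structure L} → IsIsomorphism A A id
    id-iso = record
      { isEmbedding = record { injective = id ; fun-hom = λ _ _ → refl ; rel-iff = λ _ _ → mk⇔ id id }
      ; surjective = λ y → y , refl }

    ∘-embedding : ∀ {A B C : Structure L} {f g} →
      IsEmbedding A B f → IsEmbedding B C g → IsEmbedding A C (g ∘ f)
    ∘-embedding {f = f} {g} p q = record
      { injective = injective p ∘ injective q
      ; fun-hom = λ s xs → trans (cong g (fun-hom p s xs)) (fun-hom q s (f ∘ xs))
      ; rel-iff = λ r xs → rel-iff q r (f ∘ xs) ⇔∘ rel-iff p r xs }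

    ∘-iso : ∀ {A B C : Structure L} {f g} →
      IsIsomorphism A B f → IsIsomorphism B C g → IsIsomorphism A C (g ∘ f)
    ∘-iso {f = f} {g} p q = record
      { isEmbedding = ∘-embedding (isEmbedding p) (isEmbedding q)
      ; surjective = λ z → let y , gy = surjective q z ; x , fx = surjective p y in
          x , trans (cong g fx) gy }

    rel-cong : ∀ (A : Structure L) r {xs ys} → (∀ i → xs i ≡ ys i) → Structure.rel A r xs → Structure.rel A r ys
    rel-cong A r eq = subst (Structure.rel A r) (ext _ _ eq)

    fun-cong : ∀ (A : Structure L) s {xs ys} → (∀ i → xs i ≡ ys i) → Structure.fun A s xs ≡ Structure.fun A s ys
    fun-cong A s eq = cong (Structure.fun A s) (ext _ _ eq)

    inverse-iso : ∀ {A B : Structure L} {f} (p : IsIsomorphism A B f) →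
      IsIsomorphism B A (proj₁ ∘ surjective p)
    inverse-iso {A} {B} {f} p = record
      { isEmbedding = record
        { injective = λ {x} {y} eq → trans (sym (fg x)) (trans (cong f eq) (fg y))
        ; fun-hom = λ s xs → injective e (trans (fg _)
            (trans (fun-cong B s (sym ∘ fg ∘ xs)) (sym (fun-hom e s (g ∘ xs)))))
        ; rel-iff = λ r xs → mk⇔
            (λ R → from⇔ (rel-iff e r (g ∘ xs)) (rel-cong B r (sym ∘ fg ∘ xs) R))
            (λ R → rel-cong B r (fg ∘ xs) (to⇔ (rel-iff e r (g ∘ xs)) R)) }
      ; surjective = λ x → f x , injective e (fg (f x)) }
      where
      e = isEmbedding p
      g = proj₁ ∘ surjective p
      fg : ∀ y → f (g y) ≡ y
      fg = proj₂ ∘ surjective p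

    idᵃ : (A : Structure L) → Automorphism A
    idᵃ A = record { to = id ; isIso = id-iso }

    infixr 9 _∘ᵃ_
    _∘ᵃ_ : ∀ {A : Structure L} → Automorphism A → Automorphism A → Automorphism A
    σ ∘ᵃ τ = record { to = to σ ∘ to τ ; isIso = ∘-iso (isIso τ) (isIso σ) }

    _⁻¹ : ∀ {A : Structure L} → Automorphism A → Automorphism A
    σ ⁻¹ = record { to = proj₁ ∘ surjective (isIso σ) ; isIso = inverse-iso (isIso σ) }

    σσ⁻¹ : ∀ {A : Structure L} (σ : Automorphism A) y → to σ (to (σ ⁻¹) y) ≡ y
    σσ⁻¹ σ y = proj₂ (surjective (isIso σ) y)

    auto-injective : ∀ {A : Structure L} (σ : Automorphism A) {x y} → to σ x ≡ to σ y → x ≡ y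
    auto-injective σ = injective (isEmbedding (isIso σ))

    σ⁻¹σ : ∀ {A : Structure L} (σ : Automorphism A) x → to (σ ⁻¹) (to σ x) ≡ x
    σ⁻¹σ σ x = auto-injective σ (σσ⁻¹ σ (to σ x))

    auto-back : ∀ {A : Structure L} (σ : Automorphism A) {x y} → to σ x ≡ y → to (σ ⁻¹) y ≡ x
    auto-back σ {x} refl = σ⁻¹σ σ x

    -- Equality of Galois types over ∅.
    Conj : ∀ (A : Structure L) {i} {I : Set i} → (u v : I → Carrier A) → Set (ℓ ⊔ i)
    Conj A u v = ∃ λ (σ : Automorphism A) → ∀ i → to σ (u i) ≡ v i

    ConjL : (A : Structure L) → (u v : List (Carrier A)) → Set ℓ
    ConjL A u v = ∃ λ (σ : Automorphism A) → map (to σ) u ≡ v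

    conjL-sym : ∀ {A : Structure L} {u v} → ConjL A u v → ConjL A v u
    conjL-sym {u = u} (σ , refl) = σ ⁻¹ , trans (sym (map-∘ u)) (trans (map-cong (σ⁻¹σ σ) u) (map-id u))

    conjL-trans : ∀ {A : Structure L} {u v w} → ConjL A u v → ConjL A v w → ConjL A u w
    conjL-trans {u = u} (σ , refl) (τ , refl) = τ ∘ᵃ σ , map-∘ u

    -- Each finite part may need its own automorphism. `fin⇒conj` finds a common one when the
    -- families enumerate models.
    FinConj : ∀ (A : Structure L) {i} {I : Set i} → (u v : I → Carrier A) → Set (ℓ ⊔ i)
    FinConj A {I = I} u v = ∀ (l : List I) → ConjL A (map u l) (map v l)

    fin-at : ∀ {A : Structure L} {i} {I : Set i} {u v : I → Carrier A} → FinConj A u v →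
      ∀ {n} k (ks : Fin n → I) →
      ∃ λ (σ : Automorphism A) → to σ (u k) ≡ v k × ∀ i → to σ (u (ks i)) ≡ v (ks i)
    fin-at fc k ks = let σ , eq = fc (k ∷ tabulate ks) in
      σ , map≡⇒∈ (k ∷ tabulate ks) eq (here refl) ,
      λ i → map≡⇒∈ (k ∷ tabulate ks) eq (there (∈-tabulate⁺ i))

  module Strongs {ℓ k : Level} {L : Language ℓ} (𝒦 : AEC L k) where
    open AEC 𝒦

    -- Coherence, for two strong submodels of `U` one of which contains the other.
    factor : ∀ {A B U f g} → Strong A U f → Strong B U g → (∀ x → ∃ λ y → g y ≡ f x) →
      ∃ λ h → Strong A B h × (∀ x → g (h x) ≡ f x)
    factor {A} {B} {U} {f} {g} sf sg f⊆g = h , coherence h-emb sg (respects (sym ∘ gh) sf) , gh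
      where
      h = proj₁ ∘ f⊆g
      gh : ∀ x → g (h x) ≡ f x
      gh = proj₂ ∘ f⊆g
      ef = embedding sf
      eg = embedding sg
      h-emb : IsEmbedding A B h
      h-emb = record
        { injective = λ {x} {y} eq → injective ef (trans (sym (gh x)) (trans (cong g eq) (gh y)))
        ; fun-hom = λ s xs → injective eg (trans (gh _)
            (trans (fun-hom ef s xs) (trans (fun-cong U s (sym ∘ gh ∘ xs)) (sym (fun-hom eg s (h ∘ xs))))))
        ; rel-iff = λ r xs → mk⇔
            (λ R → from⇔ (rel-iff eg r (h ∘ xs)) (rel-cong U r (sym ∘ gh ∘ xs) (to⇔ (rel-iff ef r xs) R)))
            (λ R → from⇔ (rel-iff ef r xs) (rel-cong U r (gh ∘ xs) (to⇔ (rel-iff eg r (h ∘ xs)) R))) }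

    strong-∘auto : ∀ {A U f} → Strong A U f → (σ : Automorphism U) → Strong A U (to σ ∘ f)
    strong-∘auto sf σ = transitive sf (isomorphism (isIso σ) (proj₂ (strong-K sf)))

    module LS (LSω : LöwenheimSkolem ℕ) where
      -- The axiom asks for a family without repetitions; the index set is first divided by equality
      -- of values.
      ls : ∀ {U} → K U → {X : Set ℓ} (x : X → Carrier U) →
        ∃₂ λ A f → Strong A U f × (∀ i → ∃ λ y → f y ≡ x i) × (Carrier A ↣ (X ⊎ ℕ))
      ls {U} KU {X} x with quotient {_~_ = λ i j → x i ≡ x j} (record { refl = refl ; sym = sym ; trans = trans })
      ... | Qt with LSω U KU (Quotient.Q Qt) (x ∘ Quotient.rep Qt)
                 (λ {q} {q′} eq → trans (sym (Quotient.[rep] Qt q)) (trans (Quotient.sound Qt eq) (Quotient.[rep] Qt q′)))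
      ...   | A , f , sf , cov , size = A , f , sf ,
        (λ i → let y , fy = cov [ i ] in y , trans fy (complete ([rep] [ i ]))) ,
        ⊎↣ (mk↣ {to = rep} λ {q} {q′} eq → trans (sym ([rep] q)) (trans (cong [_] eq) ([rep] q′))) ↣-refl ⊚ size
        where open Quotient Qt

    -- The index set `W` is chosen before the model and repetitions are allowed, so that two models
    -- can be compared index by index.
    record Hull {a} {W : Set a} (U : Structure L) (w : W → Carrier U) : Set (lsuc ℓ ⊔ k ⊔ a) where
      field
        A      : Structure L
        f      : Carrier A → Carrier U
        strong : Strong A U f
        onto   : ∀ y → ∃ λ c → w c ≡ f y
        into   : ∀ c → ∃ λ y → f y ≡ w c

      size : Carrier A ↣ W
      size = mk↣ {to = proj₁ ∘ onto} λ {x} {y} eq →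
        injective (embedding strong) (trans (sym (proj₂ (onto x))) (trans (cong w eq) (proj₂ (onto y))))

    open Hull

    hull-∘ : ∀ {a b} {W : Set a} {V : Set b} {U} {w : W → Carrier U} (h : V → W) →
      (∀ c → ∃ λ d → h d ≡ c) → Hull U w → Hull U (w ∘ h)
    hull-∘ {w = w} h sur H = record
      { A = A H ; f = f H ; strong = strong H
      ; onto = λ y → let c , p = onto H y ; d , q = sur c in d , trans (cong w q) p
      ; into = into H ∘ h }

    module _ (LSω : LöwenheimSkolem ℕ) where
      open LS LSω

      enumerate : ∀ {U} → K U → ∀ {b} {V : Set ℓ} {Y : Set b} (x : V → Carrier U) → V → (V ⊎ ℕ) ↣ Y →
        ∃ λ (e : Y → Carrier U) → Hull U [ x , e ]′
      enumerate {U} KU {V = V} {Y} x v₀ i = case ls KU x of λ { (B , g , sg , cov , size) →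
        build B g sg cov (i ⊚ size) }
        where
        build : ∀ B g → Strong B U g → (∀ v → ∃ λ y → g y ≡ x v) → Carrier B ↣ Y →
          ∃ λ (e : Y → Carrier U) → Hull U [ x , e ]′
        build B g sg cov s = e , record
          { A = B ; f = g ; strong = sg ; onto = λ y → inj₂ (Injection.to s y) , named y
          ; into = λ { (inj₁ v) → cov v ; (inj₂ c) → into-e c } }
          where
          Names : Y → Carrier U → Set ℓ
          Names c m = ∃ λ a → g a ≡ m × ∥ Injection.to s a ≡ c ∥
          e : Y → Carrier U
          -- An index that names nothing falls back to `x v₀`, a point of the model, so the
          -- enumeration never leaves it.
          e c = choice-or (Names c) (x v₀)
          named : ∀ y → e (Injection.to s y) ≡ g y
          named y = case choice-or-spec (Names (Injection.to s y)) (x v₀) (g y , y , refl , ⌜⌝-intro refl) of λ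
            { (a , ga , eq) → trans (sym ga) (cong g (Injection.injective s (⌜⌝-elim eq))) }
          into-e : ∀ c → ∃ λ y → g y ≡ e c
          into-e c with dec (∃ (Names c))
          ... | yes (_ , a , ga , _) = a , ga
          ... | no _ = cov v₀

    module Homogeneous {U : Structure L} (KU : K U) {θ : Set ℓ} (hom : ModelHomogeneous 𝒦 θ U) where

      extend : ∀ {A f g} → Carrier A <# θ → Strong A U f → Strong A U g →
        ∃ λ (σ : Automorphism U) → ∀ x → to σ (f x) ≡ g x
      extend {A} A<θ sf sg = hom A A _ _ id A<θ A<θ sf sg id-iso

      -- Equalities, function values and relations concern finitely many entries at a time, so
      -- agreement of finite parts makes the matching of indices an isomorphism of the two models;
      -- homogeneity extends it to an automorphism.
      fin⇒conj : ∀ {a} {W : Set a} {w w′ : W → Carrier U} → W <# θ → Hull U w → Hull U w′ →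
        FinConj U w w′ → Conj U w w′
      fin⇒conj {w = w} {w′} W<θ H H′ fc = σ , λ c →
        let y , p = into H c ; c′ , q = onto H y ; y′ , r = into H′ c′ in
        trans (cong (to σ) (sym p)) (trans (σh y) (trans r (same (trans q p))))
        where
        h : Carrier (A H) → Carrier (A H′)
        h x = proj₁ (into H′ (proj₁ (onto H x)))
        at : ∀ x → w (proj₁ (onto H x)) ≡ f H x
        at = proj₂ ∘ onto H
        fh : ∀ x → f H′ (h x) ≡ w′ (proj₁ (onto H x))
        fh x = proj₂ (into H′ (proj₁ (onto H x)))
        same : ∀ {c d} → w c ≡ w d → w′ c ≡ w′ d
        same {c} {d} eq = let τ , p , q = fin-at fc {n = 1} c (λ _ → d) in
          trans (sym p) (trans (cong (to τ) eq) (q fzero))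
        along : ∀ {n} x (xs : Fin n → Carrier (A H)) → ∃ λ (τ : Automorphism U) →
          to τ (f H x) ≡ f H′ (h x) × ∀ i → to τ (f H (xs i)) ≡ f H′ (h (xs i))
        along x xs = let τ , p , q = fin-at fc (proj₁ (onto H x)) (proj₁ ∘ onto H ∘ xs) in
          τ , trans (cong (to τ) (sym (at x))) (trans p (sym (fh x))) ,
          λ i → trans (cong (to τ) (sym (at (xs i)))) (trans (q i) (sym (fh (xs i))))
        eH = embedding (strong H)
        eH′ = embedding (strong H′)
        h-iso : IsIsomorphism (A H) (A H′) h
        h-iso = record
          { isEmbedding = record
            { injective = λ {x} {y} eq → let τ , p , q = along {1} x (λ _ → y) in
                injective eH (auto-injective τ (trans p (trans (cong (f H′) eq) (sym (q fzero)))))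
            ; fun-hom = λ s xs → let τ , p , q = along (Structure.fun (A H) s xs) xs in
                injective eH′ (trans (sym p) (trans (cong (to τ) (fun-hom eH s xs))
                  (trans (fun-hom (isEmbedding (isIso τ)) s (f H ∘ xs))
                    (trans (fun-cong U s q) (sym (fun-hom eH′ s (h ∘ xs)))))))
            ; rel-iff = λ r xs → mk⇔
                (λ R → let τ , q = tuple xs in from⇔ (rel-iff eH′ r (h ∘ xs))
                  (rel-cong U r q (to⇔ (rel-iff (isEmbedding (isIso τ)) r (f H ∘ xs)) (to⇔ (rel-iff eH r xs) R))))
                (λ R → let τ , q = tuple xs in from⇔ (rel-iff eH r xs)
                  (from⇔ (rel-iff (isEmbedding (isIso τ)) r (f H ∘ xs))
                    (rel-cong U r (sym ∘ q) (to⇔ (rel-iff eH′ r (h ∘ xs)) R)))) }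
          ; surjective = λ y → let c , p = onto H′ y ; x , q = into H c in
              x , injective eH′ (trans (fh x) (trans (same (trans (at x) q)) p)) }
          where
          tuple : ∀ {n} (xs : Fin n → Carrier (A H)) → ∃ λ (τ : Automorphism U) →
            ∀ i → to τ (f H (xs i)) ≡ f H′ (h (xs i))
          tuple {zero} xs = idᵃ U , λ ()
          tuple {suc n} xs = let τ , _ , q = along (xs fzero) xs in τ , q
        ext-h = hom (A H) (A H′) (f H) (f H′) h (<#-down (size H) W<θ) (<#-down (size H′) W<θ)
                  (strong H) (strong H′) h-iso
        σ = proj₁ ext-h
        σh : ∀ x → to σ (f H x) ≡ f H′ (h x)
        σh = proj₂ ext-h

-- Small configurations in the monster and the supermonster

module Monsters (em : ∀ a → ExcludedMiddle a) (ext : ∀ a b → Extensionality a b)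
    {ℓ k : Level} {L : Language ℓ} (𝒦 : AEC L k) (monster : MonsterModel 𝒦)
    (fur : FUR.IsFUR 𝒦 monster) (super : FUR.SuperMonster 𝒦 monster) where
  open Classical em ext
  open Cardinals em ext
  open AECTools em ext
  open Automorphism using (to)
  open AEC 𝒦
  open MonsterModel monster
  open FUR 𝒦 monster
  open FUR.SuperMonster super using (𝕄′; 𝕄′∈K; ι)
  open Strongs 𝒦
  open LS (IsFUR.LS≡ω fur) public
  open Small inaccessible public
  open IsEmbedding

  M′ : Set ℓ
  M′ = Carrier 𝕄′

  ι-strong : Strong 𝕄 𝕄′ ι
  ι-strong = FUR.SuperMonster.strong super

  ι-injective : ∀ {x y} → ι x ≡ ι y → x ≡ y
  ι-injective = injective (embedding ι-strong)

  module HM = Homogeneous 𝕄∈K homogeneous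
  module HM′ = Homogeneous 𝕄′∈K (FUR.SuperMonster.homogeneous super)

  ℕ<δ : ℕ <# δ
  ℕ<δ = Inaccessible.uncountable inaccessible

  small-⊎ℕ : ∀ {a} {X : Set a} → X <# δ → (X ⊎ ℕ) <# δ
  small-⊎ℕ X<δ = small-⊎ X<δ ℕ<δ

  -- Some structure in the class is at least as large as `X`; a small strong submodel containing the
  -- image of `X` embeds into `𝕄` by universality.
  small↣M : ∀ {X : Set ℓ} → X <# δ → X ↣ M
  small↣M {X} X<δ =
    case IsFUR.large fur X of λ { (A , KA , e) →
    case ls KA (Injection.to e) of λ { (B , f , sf , cov , size) →
    case universal B (proj₁ (strong-K sf)) (small-↣ size (small-⊎ℕ X<δ)) of λ { (g , sg) →
      mk↣ {to = g} (injective (embedding sg)) ⊚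
      mk↣ {to = λ x → proj₁ (cov x)} λ {x} {y} eq →
        Injection.injective e (trans (sym (proj₂ (cov x))) (trans (cong f eq) (proj₂ (cov y)))) }}}

  m₀ : M
  m₀ = Injection.to (small↣M {Lift ℓ ℕ} (small-countable (lift↣ ℓ))) (lift 0)

  -- The power set of a small set is small, hence embeds into `𝕄` and then into `𝕄′`; Cantor's
  -- theorem makes the inequality strict.
  small′ : ∀ {a} {X : Set a} → X <# δ → X <# M′
  small′ {X = X} X<δ with resize X<δ
  ... | Y , f , g = Y↣M′ ⊚ f , λ h → cantor (f ⊚ h ⊚ mk↣ {to = ι} ι-injective ⊚ small↣M (small-→Bool (small-↣ g X<δ)))
    where
    Y↣M′ : Y ↣ M′
    Y↣M′ = mk↣ {to = ι} ι-injective ⊚ small↣M (small-↣ g X<δ)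

  -- Universality puts a copy of a small model around `c` and `v` into `𝕄`. The copy may displace
  -- `c`, so `ρ` first moves it back over a model containing `c`; homogeneity of `𝕄′` then realizes
  -- the whole map by an automorphism.
  pull : ∀ {X Y : Set ℓ} (c : X → M) (v : Y → M′) → X <# δ → Y <# δ →
    ∃ λ (σ : Automorphism 𝕄′) → (∀ x → to σ (ι (c x)) ≡ ι (c x)) × (∀ y → ∃ λ m → to σ (v y) ≡ ι m)
  pull {X} {Y} c v X<δ Y<δ =
    case ls 𝕄∈K c of λ { (A , f , sf , f-cov , A-size) →
    case small-↣ A-size (small-⊎ℕ X<δ) of λ A<δ →
    case ls 𝕄′∈K {Carrier A ⊎ Y} [ (λ x → ι (f x)) , v ]′ of λ { (B , g , sg , g-cov , B-size) →
    case small-↣ B-size (small-⊎ℕ (small-⊎ A<δ Y<δ)) of λ B<δ →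
    case factor (transitive sf ι-strong) sg (λ x → g-cov (inj₁ x)) of λ { (h , sh , gh) →
    case universal B (proj₁ (strong-K sg)) B<δ of λ { (u , su) →
    case HM.extend A<δ (transitive sh su) sf of λ { (ρ , ρuh) →
    case HM′.extend (small′ B<δ) sg (transitive (strong-∘auto su ρ) ι-strong) of λ { (σ , σg) →
      σ ,
      (λ x → case f-cov x of λ { (y , fy) → trans (cong (λ z → to σ (ι z)) (sym fy))
         (trans (cong (to σ) (sym (gh y))) (trans (σg (h y)) (trans (cong ι (ρuh y)) (cong ι fy)))) }) ,
      λ y → to ρ (u (proj₁ (g-cov (inj₂ y)))) ,
        trans (cong (to σ) (sym (proj₂ (g-cov (inj₂ y))))) (σg _) }}}}}}

  up : ∀ {X : Set ℓ} (u : X → M) → X <# δ → (σ : Automorphism 𝕄) →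
    ∃ λ (τ : Automorphism 𝕄′) → ∀ x → to τ (ι (u x)) ≡ ι (to σ (u x))
  up u X<δ σ =
    case ls 𝕄∈K u of λ { (A , f , sf , cov , size) →
    case HM′.extend (small′ (small-↣ size (small-⊎ℕ X<δ)))
           (transitive sf ι-strong) (transitive (strong-∘auto sf σ) ι-strong) of λ { (τ , eq) →
      τ , λ x → case cov x of λ { (y , fy) →
        trans (cong (λ z → to τ (ι z)) (sym fy)) (trans (eq y) (cong (λ z → ι (to σ z)) fy)) } }}

  ι-reflects-strong : ∀ {A w} → Strong A 𝕄′ (λ x → ι (w x)) → Strong A 𝕄 w
  ι-reflects-strong {A} {w} s = coherence w-emb ι-strong s
    where
    e = embedding s
    eι = embedding ι-strong
    w-emb : IsEmbedding A 𝕄 w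
    w-emb = record
      { injective = λ eq → injective e (cong ι eq)
      ; fun-hom = λ s xs → ι-injective (trans (fun-hom e s xs) (sym (fun-hom eι s (w ∘ xs))))
      ; rel-iff = λ r xs → mk⇔ (from⇔ (rel-iff eι r (w ∘ xs)) ∘ to⇔ (rel-iff e r xs))
                               (from⇔ (rel-iff e r xs) ∘ to⇔ (rel-iff eι r (w ∘ xs))) }

  -- Although `τ` keeps the family inside `𝕄`, it may move the surrounding model `A` outside. An
  -- automorphism `ρ` fixing the images of the family brings `A` back, and homogeneity of `𝕄`
  -- applies to the composite.
  down : ∀ {X : Set ℓ} (u : X → M) → X <# δ → (τ : Automorphism 𝕄′) →
    (∀ x → ∃ λ m → to τ (ι (u x)) ≡ ι m) →
    ∃ λ (σ : Automorphism 𝕄) → ∀ x → ι (to σ (u x)) ≡ to τ (ι (u x))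
  down u X<δ τ in-M =
    case ls 𝕄∈K u of λ { (A , f , sf , cov , size) →
    case small-↣ size (small-⊎ℕ X<δ) of λ A<δ →
    case pull (λ x → proj₁ (in-M x)) (λ y → to τ (ι (f y))) X<δ A<δ of λ { (ρ , ρ-fix , ρ-into) →
    case HM.extend A<δ sf (ι-reflects-strong (respects (λ y → proj₂ (ρ-into y))
           (strong-∘auto (strong-∘auto (transitive sf ι-strong) τ) ρ))) of λ { (σ , σf) →
      σ , λ x → case cov x of λ { (y , fy) →
        trans (cong (λ z → ι (to σ z)) (sym fy)) (trans (cong ι (σf y)) (trans (sym (proj₂ (ρ-into y)))
          (trans (cong (λ z → to ρ (to τ (ι z))) fy) (trans (cong (to ρ) (proj₂ (in-M x)))
            (trans (ρ-fix x) (sym (proj₂ (in-M x)))))))) } }}}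

  Elem : ∀ {a} {A : Set a} → List A → Set ℓ
  Elem l = Lift ℓ (Fin (length l))

  elem : ∀ {a} {A : Set a} (l : List A) → Elem l → A
  elem l (lift i) = lookup l i

  elem-∈ : ∀ {a} {A : Set a} {l : List A} {x} → x ∈ l → ∃ λ i → elem l i ≡ x
  elem-∈ {l = l} x∈l = lift (index x∈l) , sym (lookup-index x∈l)
    where open import Data.List.Relation.Unary.Any using (index)
          open import Data.List.Relation.Unary.Any.Properties using (lookup-index)

  Elem-small : ∀ {a} {A : Set a} (l : List A) → Elem l <# δ
  Elem-small l = small-countable (fin↣ℕ (length l) ⊚ lift↣ ℓ)

  tabulate-∃ : ∀ {a b r} {A : Set a} {B : Set b} {R : A → B → Set r} (l : List A) →
    (∀ i → ∃ λ b → R (lookup l i) b) → ∃ λ l′ → Pointwise R l l′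
  tabulate-∃ [] f = [] , []
  tabulate-∃ (x ∷ l) f =
    case tabulate-∃ l (λ i → f (fsuc i)) of λ { (l′ , ps) →
    case f fzero of λ { (b , p) → b ∷ l′ , p ∷ ps } }

  pullL : (c : List M) (v : List M′) → ∃ λ (σ : Automorphism 𝕄′) →
    (∀ x → x ∈ c → to σ (ι x) ≡ ι x) × ∃ λ v° → map (to σ) v ≡ map ι v°
  pullL c v =
    case pull (elem c) (elem v) (Elem-small c) (Elem-small v) of λ { (σ , fix , into) →
    case tabulate-∃ v (λ i → into (lift i)) of λ { (v° , ps) →
      σ ,
      (λ x x∈c → case elem-∈ x∈c of λ { (i , eq) →
        trans (cong (λ z → to σ (ι z)) (sym eq)) (trans (fix i) (cong ι eq)) }) ,
      v° , pointwise⇒map≡ ps }}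
    where
    pointwise⇒map≡ : ∀ {a b c} {A : Set a} {B : Set b} {C : Set c} {f : A → C} {g : B → C} {l l′} →
      Pointwise (λ x y → f x ≡ g y) l l′ → map f l ≡ map g l′
    pointwise⇒map≡ [] = refl
    pointwise⇒map≡ (p ∷ ps) = cong₂ _∷_ p (pointwise⇒map≡ ps)

  upL : (l : List M) (σ : Automorphism 𝕄) →
    ∃ λ (τ : Automorphism 𝕄′) → ∀ x → x ∈ l → to τ (ι x) ≡ ι (to σ x)
  upL l σ = case up (elem l) (Elem-small l) σ of λ { (τ , eq) →
    τ , λ x x∈l → case elem-∈ x∈l of λ { (i , p) →
      trans (cong (λ z → to τ (ι z)) (sym p)) (trans (eq i) (cong (λ z → ι (to σ z)) p)) } }

  downL : (l : List M) (τ : Automorphism 𝕄′) → (∀ x → x ∈ l → ∃ λ m → to τ (ι x) ≡ ι m) →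
    ∃ λ (σ : Automorphism 𝕄) → ∀ x → x ∈ l → ι (to σ x) ≡ to τ (ι x)
  downL l τ in-M = case down (elem l) (Elem-small l) τ (λ { (lift i) → in-M _ (∈-lookup i) }) of λ { (σ , eq) →
    σ , λ x x∈l → case elem-∈ x∈l of λ { (i , p) →
      trans (cong (λ z → ι (to σ z)) (sym p)) (trans (eq i) (cong (λ z → to τ (ι z)) p)) } }

  -- Codes for the types over ∅ of finite tuples, by axiom AI

  private
    ⊥⊎ℕ↣ℕ : (Lift ℓ ⊥ ⊎ ℕ) ↣ ℕ
    ⊥⊎ℕ↣ℕ = mk↣ {to = λ { (inj₂ n) → n }} (λ { {inj₂ _} {inj₂ _} refl → refl })

    𝒜₀ : Σ Model CountableModel
    𝒜₀ = case ls 𝕄∈K {Lift ℓ ⊥} (λ ()) of λ { (A , f , sf , _ , size) →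
      record { str = A ; incl = f ; strong = sf ; small = small-countable (⊥⊎ℕ↣ℕ ⊚ size) } , ⊥⊎ℕ↣ℕ ⊚ size }

    open Model (proj₁ 𝒜₀) using (str; incl)

    codes : List (Carrier str) ↣ ℕ
    codes = countable-List (proj₂ 𝒜₀)

  abstract
    realize : (u : List M) → ∃ λ (x : List (Carrier str)) → ConjL 𝕄 (map incl x) u
    realize u =
      case IsFUR.AI fur (proj₁ 𝒜₀) (proj₂ 𝒜₀) (lookup u) [] [] of λ { (a , a∈ , same) →
      case same [] [] of λ { (f , _ , fa) →
        tabulate (λ i → proj₁ (a∈ i)) , f ,
        trans (cong (map (to f)) (map-tabulate (λ i → proj₁ (a∈ i)) incl))
          (trans (map-tabulate _ (to f)) (trans (tabulate-cong λ i → trans (cong (to f) (proj₂ (a∈ i))) (fa i))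
            (tabulate-lookup u))) }}

    code : List M → ℕ
    code u = Injection.to codes (proj₁ (realize u))

    -- Equal codes mean one common conjugate in the countable model. Conjugate tuples may still
    -- receive different codes; a finer colouring does no harm.
    code-sound : ∀ {u v} → code u ≡ code v → ConjL 𝕄 u v
    code-sound {u} {v} eq = conjL-trans (conjL-sym (proj₂ (realize u)))
      (subst (λ x → ConjL 𝕄 (map incl x) v) (sym (Injection.injective codes eq)) (proj₂ (realize v)))

    pulled : (v : List M′) → ∃ λ v° → ConjL 𝕄′ v (map ι v°)
    pulled v = case pullL [] v of λ { (σ , _ , v° , eq) → v° , σ , eq }

    code′ : List M′ → ℕ
    code′ v = code (proj₁ (pulled v))

    code′-sound : ∀ {u v} → code′ u ≡ code′ v → ConjL 𝕄′ u v
    code′-sound {u} {v} eq = conjL-trans (proj₂ (pulled u))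
      (conjL-trans (lift-conj (code-sound eq)) (conjL-sym (proj₂ (pulled v))))
      where
      lift-conj : ∀ {u v} → ConjL 𝕄 u v → ConjL 𝕄′ (map ι u) (map ι v)
      lift-conj {u} (ρ , refl) = case upL u ρ of λ { (ρ′ , eq) →
        ρ′ , trans (∈⇒map≡ u (eq _)) (map-∘ u) }

-- Partition calculus below an inaccessible cardinal

module Partitions (em : ∀ a → ExcludedMiddle a) (ext : ∀ a b → Extensionality a b)
    {ℓ : Level} {δ : Set ℓ} (inacc : Inaccessible δ) where
  open Classical em ext
  open Cardinals em ext
  open Small inacc
  open WellOrder using (wf; compare; <-trans; <-irrefl)

  Less : ∀ {Λ : Set ℓ} → WellOrder Λ → Rel Λ ℓ
  Less w = WellOrder._<_ w

  -- Finite subsets of a well-order are represented by descending lists.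
  Desc : ∀ {Λ : Set ℓ} → WellOrder Λ → Pred (List Λ) ℓ
  Desc w = AllPairs λ x y → Less w y x

  Mono : ∀ {Λ Λ′ : Set ℓ} → WellOrder Λ → WellOrder Λ′ → (Λ → Λ′) → Set ℓ
  Mono w w′ j = ∀ {x y} → Less w x y → Less w′ (j x) (j y)

  below-map : ∀ {Λ Λ′ : Set ℓ} (w : WellOrder Λ) (w′ : WellOrder Λ′) {j} → Mono w w′ j → ∀ {x} l →
    All (λ y → Less w y x) l → All (λ y → Less w′ y (j x)) (map j l)
  below-map w w′ mono [] [] = []
  below-map w w′ mono (_ ∷ l) (p ∷ ps) = mono p ∷ below-map w w′ mono l ps

  desc-map : ∀ {Λ Λ′ : Set ℓ} (w : WellOrder Λ) (w′ : WellOrder Λ′) {j} → Mono w w′ j → ∀ l →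
    Desc w l → Desc w′ (map j l)
  desc-map w w′ mono [] [] = []
  desc-map w w′ mono (_ ∷ l) (p ∷ ps) = below-map w w′ mono l p ∷ desc-map w w′ mono l ps

  -- The Erdős–Rado theorem

  module EndHomogeneous {Λ₁ Λ′ : Set ℓ} (w₁ : WellOrder Λ₁) (w′ : WellOrder Λ′)
      {C : Set ℓ} (κ : List Λ′ → C) where
    private
      infix 4 _<₁_ _<′_
      _<₁_ = Less w₁
      _<′_ = Less w′

      -- y continues the sequence (rec η) (η < ξ) of predecessors of i, with the same colours as i.
      Continues : ∀ (i : Λ′) ξ → (∀ η → η <₁ ξ → Λ′) → Λ′ → Set ℓ
      Continues i ξ rec y = y <′ i × (∀ η η<ξ → rec η η<ξ <′ y) ×
        (∀ (l : List (∃ λ η → η <₁ ξ)) →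
          κ (y ∷ map (λ { (η , lt) → rec η lt }) l) ≡ κ (i ∷ map (λ { (η , lt) → rec η lt }) l))

      step : ∀ (i : Λ′) ξ → (∀ η → η <₁ ξ → Λ′) → Λ′
      step i ξ rec = choice-or (λ y → Continues i ξ rec y × ∀ z → z <′ y → ¬ Continues i ξ rec z) i

      module R (i : Λ′) = Recursion (wf w₁) (step i)

    -- The value i signals that the sequence has stopped.
    J : Λ′ → Λ₁ → Λ′
    J i = R.wfix i

    Next : Λ′ → Λ₁ → Λ′ → Set ℓ
    Next i ξ y = y <′ i × (∀ η → η <₁ ξ → J i η <′ y) ×
      (∀ l → All (_<₁ ξ) l → κ (y ∷ map (J i) l) ≡ κ (i ∷ map (J i) l))

    private
      Continues⇒Next : ∀ {i ξ y} → Continues i ξ (λ η _ → J i η) y → Next i ξ y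
      Continues⇒Next {i} {ξ} {y} (p , q , r) = p , q , λ l ps →
        subst (λ m → κ (y ∷ m) ≡ κ (i ∷ m)) (sub-map l ps) (r (sub l ps))
        where
        sub : ∀ l → All (_<₁ ξ) l → List (∃ λ η → η <₁ ξ)
        sub [] [] = []
        sub (η ∷ l) (lt ∷ ps) = (η , lt) ∷ sub l ps
        sub-map : ∀ l ps → map (λ { (η , lt) → J i η }) (sub l ps) ≡ map (J i) l
        sub-map [] [] = refl
        sub-map (η ∷ l) (lt ∷ ps) = cong (J i η ∷_) (sub-map l ps)

      Next⇒Continues : ∀ {i ξ y} → Next i ξ y → Continues i ξ (λ η _ → J i η) y
      Next⇒Continues {i} {ξ} {y} (p , q , r) = p , q , λ l →
        subst (λ m → κ (y ∷ m) ≡ κ (i ∷ m)) (sym (map-∘ l))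
          (r (map proj₁ l) (Allₚ.map⁺ (All.universal proj₂ l)))

      Least : ∀ i ξ → Λ′ → Set ℓ
      Least i ξ y = Continues i ξ (λ η _ → J i η) y × ∀ z → z <′ y → ¬ Continues i ξ (λ η _ → J i η) z

    J-next : ∀ i ξ → J i ξ ≢ i → Next i ξ (J i ξ) × ∀ z → z <′ J i ξ → ¬ Next i ξ z
    J-next i ξ J≢i = Continues⇒Next (proj₁ spec) , λ z z<J → proj₂ spec z z<J ∘ Next⇒Continues
      where
      spec : Least i ξ (J i ξ)
      spec = subst (Least i ξ) (sym (R.wfix-unfold i ξ)) (choice-or-spec (Least i ξ) i (dne λ none →
        J≢i (trans (R.wfix-unfold i ξ) (choice-or-default (Least i ξ) i none))))

    J-stop : ∀ i ξ → J i ξ ≡ i → ∀ y → ¬ Next i ξ y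
    J-stop i ξ J≡i y next = <-irrefl w′ (subst (_<′ i) J≡i (proj₁ (proj₁ spec)))
      where
      spec : Least i ξ (J i ξ)
      spec = subst (Least i ξ) (sym (R.wfix-unfold i ξ)) (choice-or-spec (Least i ξ) i
        (least (wf w′) (Continues i ξ (λ η _ → J i η)) (y , Next⇒Continues next)))

    -- A stopped sequence determines i from the stage of stopping and the colours of i.
    stops⇒injects : (∀ i → ∃ λ ξ → J i ξ ≡ i) → Λ′ ↣ (Λ₁ × (List Λ₁ → C))
    stops⇒injects stops = mk↣ {to = record′} λ {i} {i′} eq → inj i i′ (cong proj₁ eq)
      (λ l → cong (λ r → proj₂ r l) eq)
      where
      first : ∀ i → ∃ λ ξ → J i ξ ≡ i × ∀ η → η <₁ ξ → J i η ≢ i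
      first i = least (wf w₁) (λ ξ → J i ξ ≡ i) (stops i)
      record′ : Λ′ → Λ₁ × (List Λ₁ → C)
      record′ i = proj₁ (first i) , λ l → κ (i ∷ map (J i) l)
      -- Minimality makes the two sequences agree up to the common stopping stage. There `i` itself
      -- has all the properties of a next term for `i′`, although the sequence of `i′` has stopped.
      inj< : ∀ i i′ → i <′ i′ → proj₁ (first i) ≡ proj₁ (first i′) →
        (∀ l → κ (i ∷ map (J i) l) ≡ κ (i′ ∷ map (J i′) l)) → ⊥
      inj< i i′ i<i′ eq pat = J-stop i′ ξ (subst (λ ξ → J i′ ξ ≡ i′) (sym eq) (proj₁ (proj₂ (first i′)))) i
        ( i<i′
        , (λ η η<ξ → subst (_<′ i) (same η (wf w₁ η) η<ξ) (proj₁ (proj₁ (J-next i η (run η η<ξ)))))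
        , λ l ps → trans (cong (λ m → κ (i ∷ m)) (sym (same-map l ps))) (pat l))
        where
        ξ = proj₁ (first i)
        run : ∀ η → η <₁ ξ → J i η ≢ i
        run = proj₂ (proj₂ (first i))
        run′ : ∀ η → η <₁ ξ → J i′ η ≢ i′
        run′ η η<ξ = proj₂ (proj₂ (first i′)) η (subst (η <₁_) eq η<ξ)
        map-below : ∀ {ζ} l → All (_<₁ ζ) l → (∀ η → η <₁ ζ → J i η ≡ J i′ η) → map (J i) l ≡ map (J i′) l
        map-below [] [] _ = refl
        map-below (η ∷ l) (p ∷ ps) agree = cong₂ _∷_ (agree η p) (map-below l ps agree)
        same : ∀ η → Acc _<₁_ η → η <₁ ξ → J i η ≡ J i′ η
        same η (acc rs) η<ξ = go (compare w′ (J i η) (J i′ η))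
          where
          agree : ∀ ζ → ζ <₁ η → J i ζ ≡ J i′ ζ
          agree ζ ζ<η = same ζ (rs ζ<η) (<-trans w₁ ζ<η η<ξ)
          at-i = J-next i η (run η η<ξ)
          at-i′ = J-next i′ η (run′ η η<ξ)
          next-i′ : Next i′ η (J i η)
          next-i′ = let p , q , r = proj₁ at-i in <-trans w′ p i<i′ ,
            (λ ζ ζ<η → subst (_<′ J i η) (agree ζ ζ<η) (q ζ ζ<η)) ,
            λ l ps → subst (λ m → κ (J i η ∷ m) ≡ κ (i′ ∷ map (J i′) l)) (map-below l ps agree)
              (trans (r l ps) (pat l))
          next-i : J i′ η <′ J i η → Next i η (J i′ η)
          next-i lt = let p , q , r = proj₁ at-i′ in <-trans w′ lt (proj₁ (proj₁ at-i)) ,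
            (λ ζ ζ<η → subst (_<′ J i′ η) (sym (agree ζ ζ<η)) (q ζ ζ<η)) ,
            λ l ps → subst (λ m → κ (J i′ η ∷ m) ≡ κ (i ∷ map (J i) l)) (sym (map-below l ps agree))
              (trans (r l ps) (sym (pat l)))
          go : Tri _ _ _ → J i η ≡ J i′ η
          go (tri< lt _ _) = ⊥-elim (proj₂ at-i′ (J i η) lt next-i′)
          go (tri≈ _ e _) = e
          go (tri> _ _ gt) = ⊥-elim (proj₂ at-i (J i′ η) gt (next-i gt))
        same-map : ∀ l → All (_<₁ ξ) l → map (J i) l ≡ map (J i′) l
        same-map l ps = map-below l ps λ η η<ξ → same η (wf w₁ η) η<ξ
      inj : ∀ i i′ → proj₁ (first i) ≡ proj₁ (first i′) →
        (∀ l → κ (i ∷ map (J i) l) ≡ κ (i′ ∷ map (J i′) l)) → i ≡ i′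
      inj i i′ eq pat with compare w′ i i′
      ... | tri< lt _ _ = ⊥-elim (inj< i i′ lt eq pat)
      ... | tri≈ _ e _ = e
      ... | tri> _ _ gt = ⊥-elim (inj< i′ i gt (sym eq) (sym ∘ pat))

  module _ {C : Set ℓ} (C<δ : C <# δ) where

    -- `Λ′` is a power set too large for `stops⇒injects`, so the sequence of some `i` never stops.
    -- Along it the largest element of a set may be replaced by `i` without changing the colour,
    -- which leaves a colouring of sets with one element fewer for the induction hypothesis.
    erdős-rado : ∀ n {Λ : Set ℓ} (w : WellOrder Λ) → Λ <# δ →
      ∃ λ (Λ′ : Set ℓ) → ∃ λ (w′ : WellOrder Λ′) → Λ′ <# δ ×
        (∀ (κ : List Λ′ → C) → ∃ λ j → Mono w w′ j ×
           ∃ λ c → ∀ l → Desc w l → length l ≡ n → κ (map j l) ≡ c)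
    erdős-rado zero {Λ} w Λ<δ = Λ , w , Λ<δ , λ κ → id , id , κ [] , λ { [] _ _ → refl }
    erdős-rado (suc n) {Λ} w Λ<δ =
      case erdős-rado n w Λ<δ of λ { (Λ₁ , w₁ , Λ₁<δ , hom) →
        (Λ₁ × (List Λ₁ → C) → Bool) , Exhaustion.wellOrder _ ,
        small-→Bool (small-× Λ₁<δ (small-→ (small-List Λ₁<δ) C<δ)) ,
        λ κ → homogenize w₁ hom (Exhaustion.wellOrder _) κ }
      where
      homogenize : ∀ {Λ₁} (w₁ : WellOrder Λ₁) →
        (∀ (κ : List Λ₁ → C) → ∃ λ j → Mono w w₁ j ×
           ∃ λ c → ∀ l → Desc w l → length l ≡ n → κ (map j l) ≡ c) →
        (w′ : WellOrder (Λ₁ × (List Λ₁ → C) → Bool)) →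
        ∀ κ → ∃ λ j → Mono w w′ j × ∃ λ c → ∀ l → Desc w l → length l ≡ suc n → κ (map j l) ≡ c
      homogenize w₁ hom w′ κ =
        case dne (λ none → cantor (stops⇒injects λ i → dne λ ¬stop → none (i , λ ξ e → ¬stop (ξ , e))))
          of λ { (i , J≢i) →
        case hom (λ l → κ (i ∷ map (J i) l)) of λ { (j , mono , c , hom-c) →
          (λ x → J i (j x)) ,
          (λ {x} {y} x<y → proj₁ (proj₂ (proj₁ (J-next i (j y) (J≢i (j y))))) (j x) (mono x<y)) , c ,
          λ { (x ∷ l) (p ∷ ps) eq →
            trans (cong (λ m → κ (J i (j x) ∷ m)) (map-∘ l))
              (trans (proj₂ (proj₂ (proj₁ (J-next i (j x) (J≢i (j x))))) (map j l) (below-map w w₁ mono l p))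
                (hom-c l ps (ℕₚ.suc-injective eq))) } }}
        where open EndHomogeneous w₁ w′ κ

  -- Sums of well-orders

  module LexSum {I : Set ℓ} (w : WellOrder I) {F : I → Set ℓ} (wF : ∀ i → WellOrder (F i)) where

    data _<ˡ_ : Rel (Σ I F) ℓ where
      left  : ∀ {i j x y} → Less w i j → (i , x) <ˡ (j , y)
      right : ∀ {i x y} → Less (wF i) x y → (i , x) <ˡ (i , y)

    lexSum : WellOrder (Σ I F)
    lexSum = mkWellOrder _<ˡ_ (λ { (i , x) → outer i (wf w i) x }) tr tot
      where
      inner : ∀ i → (∀ {j} → Less w j i → ∀ y → Acc _<ˡ_ (j , y)) → ∀ x → Acc (Less (wF i)) x → Acc _<ˡ_ (i , x)
      inner i rec x (acc ss) = acc λ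
        { (left j<i) → rec j<i _
        ; (right y<x) → inner i rec _ (ss y<x) }
      outer : ∀ i → Acc (Less w) i → ∀ x → Acc _<ˡ_ (i , x)
      outer i (acc rs) x = inner i (λ j<i y → outer _ (rs j<i) y) x (wf (wF i) x)
      tr : ∀ {u v t} → u <ˡ v → v <ˡ t → u <ˡ t
      tr (left p) (left q) = left (<-trans w p q)
      tr (left p) (right _) = left p
      tr (right _) (left q) = left q
      tr (right {i} p) (right q) = right (<-trans (wF i) p q)
      tot : ∀ u v → u <ˡ v ⊎ u ≡ v ⊎ v <ˡ u
      tot (i , x) (j , y) with compare w i j
      ... | tri< lt _ _ = inj₁ (left lt)
      ... | tri> _ _ gt = inj₂ (inj₂ (left gt))
      ... | tri≈ _ refl _ with compare (wF i) x y
      ...   | tri< lt _ _ = inj₁ (right lt)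
      ...   | tri≈ _ refl _ = inj₂ (inj₁ refl)
      ...   | tri> _ _ gt = inj₂ (inj₂ (right gt))

  -- Indiscernible patterns

  select : ∀ {a} {A : Set a} → List Bool → List A → List A
  select (true ∷ μ) (x ∷ l) = x ∷ select μ l
  select (false ∷ μ) (x ∷ l) = select μ l
  select _ _ = []

  select-map : ∀ {a b} {A : Set a} {B : Set b} (f : A → B) μ l → select μ (map f l) ≡ map f (select μ l)
  select-map f [] [] = refl
  select-map f [] (x ∷ l) = refl
  select-map f (true ∷ μ) [] = refl
  select-map f (false ∷ μ) [] = refl
  select-map f (true ∷ μ) (x ∷ l) = cong (f x ∷_) (select-map f μ l)
  select-map f (false ∷ μ) (x ∷ l) = select-map f μ l

  select-All : ∀ {a p} {A : Set a} {P : Pred A p} μ {l} → All P l → All P (select μ l)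
  select-All [] [] = []
  select-All [] (_ ∷ _) = []
  select-All (true ∷ μ) [] = []
  select-All (false ∷ μ) [] = []
  select-All (true ∷ μ) (p ∷ ps) = p ∷ select-All μ ps
  select-All (false ∷ μ) (p ∷ ps) = select-All μ ps

  select-AllPairs : ∀ {a r} {A : Set a} {R : Rel A r} μ {l} → AllPairs R l → AllPairs R (select μ l)
  select-AllPairs [] [] = []
  select-AllPairs [] (_ ∷ _) = []
  select-AllPairs (true ∷ μ) [] = []
  select-AllPairs (false ∷ μ) [] = []
  select-AllPairs (true ∷ μ) (p ∷ ps) = select-All μ p ∷ select-AllPairs μ ps
  select-AllPairs (false ∷ μ) (p ∷ ps) = select-AllPairs μ ps

  select-length : ∀ {a} {A : Set a} μ (l : List A) → length (select μ l) ≤ⁿ length l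
  select-length [] l = z≤n
  select-length (true ∷ μ) [] = z≤n
  select-length (false ∷ μ) [] = z≤n
  select-length (true ∷ μ) (x ∷ l) = s≤s (select-length μ l)
  select-length (false ∷ μ) (x ∷ l) = ℕₚ.m≤n⇒m≤1+n (select-length μ l)

  module Patterns {C : Set ℓ} (C<δ : C <# δ) {P : Set ℓ} {r} (R : Rel P r) (col : List P → C)
      (spread : ∀ {J : Set ℓ} → J <# δ → (f : J → P) → ∃ λ c → ∀ j → ¬ R c (f j)) where

    private
      greedy : ∀ {Λ : Set ℓ} (w : WellOrder Λ) → Λ <# δ →
        ∃ λ (j : Λ → P) → ∀ x y → Less w x y → ¬ R (j y) (j x)
      greedy {Λ} w Λ<δ = wfix , λ x y x<y →
        subst (λ c → ¬ R c (wfix x)) (sym (wfix-unfold y)) (proj₂ (next y (λ z _ → wfix z)) (x , ⌜⌝-intro x<y))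
        where
        next : ∀ y (rec : ∀ x → Less w x y → P) →
          ∃ λ c → ∀ (x : Σ Λ λ x → ∥ Less w x y ∥) → ¬ R c (rec (proj₁ x) (⌜⌝-elim (proj₂ x)))
        next y rec = spread (small-↣ (∥∥↣ {P = λ x → Less w x y}) Λ<δ) λ x → rec (proj₁ x) (⌜⌝-elim (proj₂ x))
        open Recursion (wf w) (λ y rec → proj₁ (next y rec))

      Homogeneous : ∀ {Λ : Set ℓ} → WellOrder Λ → ℕ → (ℕ → C) → (Λ → P) → Set (ℓ ⊔ r)
      Homogeneous w n χ j = (∀ x y → Less w x y → ¬ R (j y) (j x)) ×
        ∀ l → Desc w l → length l <ⁿ n → col (map j l) ≡ χ (length l)

      -- All small well-orders are required at once: fixing the next colour by Erdős-Rado needs a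
      -- longer order to start from than the one obtained.
      Extendible : ℕ → (ℕ → C) → Set (lsuc ℓ ⊔ r)
      Extendible n χ = ∀ (Λ : Set ℓ) (w : WellOrder Λ) → Λ <# δ → ∃ (Homogeneous w n χ)

      update : (ℕ → C) → ℕ → C → ℕ → C
      update χ n c m with m ℕₚ.≟ n
      ... | yes _ = c
      ... | no _ = χ m

      update-here : ∀ χ n c → update χ n c n ≡ c
      update-here χ n c with n ℕₚ.≟ n
      ... | yes _ = refl
      ... | no ¬p = ⊥-elim (¬p refl)

      update-below : ∀ χ n c {m} → m <ⁿ n → update χ n c m ≡ χ m
      update-below χ n c {m} m<n with m ℕₚ.≟ n
      ... | yes refl = ⊥-elim (ℕₚ.<-irrefl refl m<n)
      ... | no _ = refl

      abstract
        -- If every colour failed on some order, the sum of these orders would give a contradiction.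
        extend : ∀ n χ → Extendible n χ → ∃ λ c → Extendible (suc n) (update χ n c)
        extend n χ ext-χ = dne λ none →
          let fail : ∀ c → ∃ λ (Λ : Set ℓ) → ∃ λ (w : WellOrder Λ) → Λ <# δ × ¬ ∃ (Homogeneous w (suc n) (update χ n c))
              fail c = dne λ good → none (c , λ Λ w Λ<δ → dne λ bad → good (Λ , w , Λ<δ , bad))
          in refute fail
          where
          refute : (∀ c → ∃ λ (Λ : Set ℓ) → ∃ λ (w : WellOrder Λ) → Λ <# δ ×
                     ¬ ∃ (Homogeneous w (suc n) (update χ n c))) → ⊥
          refute fail =
            case erdős-rado C<δ n sumOrder sum<δ of λ { (Λ′ , w′ , Λ′<δ , hom) →
            case ext-χ Λ′ w′ Λ′<δ of λ { (i , i-spread , i-hom) →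
            case hom (λ l → col (map i l)) of λ { (j , j-mono , c , j-hom) →
              -- The homogeneous colour of the sum is `c`, and the summand with index `c` is the
              -- very order on which `c` was assumed to fail.
              proj₂ (proj₂ (proj₂ (fail c)))
                ( (λ x → i (j (c , x)))
                , (λ x y x<y → i-spread _ _ (j-mono (LexSum.right x<y)))
                , λ l desc l<1+n →
                    restrict w′ i i-hom j j-mono c j-hom l desc (ℕₚ.m≤n⇒m<n∨m≡n (ℕₚ.≤-pred l<1+n)) ) }}}
            where
            Λ : C → Set ℓ
            Λ c = proj₁ (fail c)
            order : ∀ c → WellOrder (Λ c)
            order c = proj₁ (proj₂ (fail c))
            sumOrder : WellOrder (Σ C Λ)
            sumOrder = LexSum.lexSum (Exhaustion.wellOrder C) order
            sum<δ : Σ C Λ <# δ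
            sum<δ = small-Σ C<δ λ c → proj₁ (proj₂ (proj₂ (fail c)))
            restrict : ∀ {Λ′} (w′ : WellOrder Λ′) i →
              (∀ l → Desc w′ l → length l <ⁿ n → col (map i l) ≡ χ (length l)) →
              ∀ j → Mono sumOrder w′ j → ∀ c →
              (∀ l → Desc sumOrder l → length l ≡ n → col (map i (map j l)) ≡ c) →
              ∀ (l : List (Λ c)) → Desc (order c) l → length l <ⁿ n ⊎ length l ≡ n →
              col (map (λ x → i (j (c , x))) l) ≡ update χ n c (length l)
            restrict w′ i i-hom j j-mono c j-hom l desc (inj₁ l<n) =
              trans (cong col (map-∘ l)) (trans
                (i-hom (map (λ x → j (c , x)) l) (desc-map (order c) w′ (λ p → j-mono (LexSum.right p)) l desc)
                  (subst (_<ⁿ n) (sym (length-map _ l)) l<n))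
                (trans (cong χ (length-map _ l)) (sym (update-below χ n c l<n))))
            restrict w′ i i-hom j j-mono c j-hom l desc (inj₂ l≡n) =
              trans (cong col (trans (map-∘ l) (cong (map i) (map-∘ l)))) (trans
                (j-hom (map (c ,_) l) (desc-map (order c) sumOrder LexSum.right l desc) (trans (length-map _ l) l≡n))
                (trans (sym (update-here χ n c)) (cong (update χ n c) (sym l≡n))))

      stage : ∀ n → ∃ (Extendible n)
      stage zero = (λ _ → col []) , λ Λ w Λ<δ → proj₁ (greedy w Λ<δ) , proj₂ (greedy w Λ<δ) , λ _ _ ()
      stage (suc n) = advance (stage n)
        where
        advance : ∃ (Extendible n) → ∃ (Extendible (suc n))
        advance (χ , e) = update χ n (proj₁ (extend n χ e)) , proj₂ (extend n χ e)

      -- Stage `m + 1` decides the colour of `m`-element sets and later stages keep it, so the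
      -- diagonal `χ` is consistent with all of them.
      stage-stable : ∀ n {m} → m <ⁿ n → proj₁ (stage n) m ≡ proj₁ (stage (suc m)) m
      stage-stable (suc n) {m} m<1+n with ℕₚ.m≤n⇒m<n∨m≡n (ℕₚ.≤-pred m<1+n)
      ... | inj₁ m<n = trans (update-below (proj₁ (stage n)) n _ m<n) (stage-stable n m<n)
      ... | inj₂ refl = refl

      ωOrder : WellOrder (Lift ℓ ℕ)
      ωOrder = mkWellOrder (λ m n → Lift ℓ (lower m <ⁿ lower n)) (λ { (lift n) → go n (<-wellFounded n) })
        (λ { (lift p) (lift q) → lift (ℕₚ.<-trans p q) }) tot
        where
        go : ∀ n → Acc _<ⁿ_ n → Acc (λ m n → Lift ℓ (lower m <ⁿ lower n)) (lift n)
        go n (acc rs) = acc λ { {lift m} (lift m<n) → go m (rs m<n) }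
        tot : ∀ (m n : Lift ℓ ℕ) → Lift ℓ (lower m <ⁿ lower n) ⊎ m ≡ n ⊎ Lift ℓ (lower n <ⁿ lower m)
        tot (lift m) (lift n) with ℕₚ.<-cmp m n
        ... | tri< p _ _ = inj₁ (lift p)
        ... | tri≈ _ refl _ = inj₂ (inj₁ refl)
        ... | tri> _ _ q = inj₂ (inj₂ (lift q))

      downFrom : ℕ → List (Lift ℓ ℕ)
      downFrom zero = []
      downFrom (suc n) = lift n ∷ downFrom n

      downFrom-below : ∀ {m} n → n ≤ⁿ m → All (λ y → Less ωOrder y (lift m)) (downFrom n)
      downFrom-below zero _ = []
      downFrom-below (suc n) n<m = lift n<m ∷ downFrom-below n (ℕₚ.<⇒≤ n<m)

      downFrom-desc : ∀ n → Desc ωOrder (downFrom n)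
      downFrom-desc zero = []
      downFrom-desc (suc n) = downFrom-below n ℕₚ.≤-refl ∷ downFrom-desc n

      downFrom-length : ∀ n → length (downFrom n) ≡ n
      downFrom-length zero = refl
      downFrom-length (suc n) = cong suc (downFrom-length n)

      abstract
        sequence : ∀ n → ∃ (Homogeneous ωOrder (suc n) (proj₁ (stage (suc n))))
        sequence n = proj₂ (stage (suc n)) (Lift ℓ ℕ) ωOrder (small-countable (lift↣ ℓ))

    abstract
      χ : ℕ → C
      χ m = proj₁ (stage (suc m)) m

      -- Each length has its own sequence, homogeneous for sets of at most `n` elements. Patterns of
      -- different lengths share no points; only the colours `χ` tie them together.
      pattern-at : ℕ → List P
      pattern-at n = map (proj₁ (sequence n)) (downFrom n)

      pattern-length : ∀ n → length (pattern-at n) ≡ n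
      pattern-length n = trans (length-map _ (downFrom n)) (downFrom-length n)

      pattern-colour : ∀ n μ → col (select μ (pattern-at n)) ≡ χ (length (select μ (pattern-at n)))
      pattern-colour n μ = trans (cong col (select-map _ μ (downFrom n)))
        (trans (proj₂ (proj₂ (sequence n)) l (select-AllPairs μ (downFrom-desc n)) l<1+n)
          (trans (stage-stable (suc n) l<1+n)
            (cong χ (sym (trans (cong length (select-map _ μ (downFrom n))) (length-map _ l))))))
        where
        l : List (Lift ℓ ℕ)
        l = select μ (downFrom n)
        l<1+n : length l <ⁿ suc n
        l<1+n = s≤s (subst (length l ≤ⁿ_) (downFrom-length n) (select-length μ (downFrom n)))

      -- Lists descend, so `p` was chosen after `q` in the greedy sequence and avoids it.
      pattern-2 : ∃₂ λ p q → pattern-at 2 ≡ p ∷ q ∷ [] × ¬ R p q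
      pattern-2 = _ , _ , refl , proj₁ (proj₂ (sequence 2)) _ _ (lift (s≤s z≤n))

-- Directed unions over finite sets, from unions of chains

module DirectedUnions (em : ∀ a → ExcludedMiddle a) (ext : ∀ a b → Extensionality a b)
    {ℓ k : Level} {L : Language ℓ} (𝒦 : AEC L k) where
  open Classical em ext
  open Cardinals em ext
  open AECTools em ext
  open Strongs 𝒦
  open AEC 𝒦
  open IsEmbedding

  module System (N : Structure L) {I : Set ℓ} (w : WellOrder I)
      (A : List I → Structure L) (g : ∀ T → Carrier (A T) → Carrier N)
      (emb : ∀ T → IsEmbedding (A T) N (g T))
      (mono : ∀ {S T} → (∀ x → x ∈ S → x ∈ T) →
              ∃ λ h → Strong (A S) (A T) h × (∀ x → g T (h x) ≡ g S x))
      (cover : ∀ y → ∃₂ λ T x → g T x ≡ y) where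
    open WellOrder w using (_<_; wf; compare; <-trans)

    KA : ∀ T → K (A T)
    KA T = proj₁ (strong-K (proj₁ (proj₂ (mono {T} {T} λ _ p → p))))

    Z : Pred I ℓ → Pred (Carrier N) ℓ
    Z Y y = ∃ λ T → All Y T × ∃ λ x → g T x ≡ y

    common : ∀ {Y n} (ys : Fin n → Carrier N) → (∀ i → Z Y (ys i)) →
      ∃ λ T → All Y T × ∃ λ (xs : Fin n → Carrier (A T)) → ∀ i → g T (xs i) ≡ ys i
    common ys z = T , Allₚ.concat⁺ (Allₚ.tabulate⁺ λ i → proj₁ (proj₂ (z i))) ,
      (λ i → proj₁ (up i) (proj₁ (proj₂ (proj₂ (z i))))) ,
      λ i → trans (proj₂ (proj₂ (up i)) _) (proj₂ (proj₂ (proj₂ (z i))))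
      where
      T = concat (tabulate λ i → proj₁ (z i))
      up : ∀ i → ∃ λ h → Strong (A (proj₁ (z i))) (A T) h × (∀ x → g T (h x) ≡ g (proj₁ (z i)) x)
      up i = mono λ x x∈ → ∈-concat⁺′ x∈ (∈-tabulate⁺ {f = λ i → proj₁ (z i)} i)

    Z-closed : ∀ {Y} s xs → (∀ i → Z Y (xs i)) → Z Y (Structure.fun N s xs)
    Z-closed s xs z = case common xs z of λ { (T , ps , xs′ , eq) →
      T , ps , Structure.fun (A T) s xs′ , trans (fun-hom (emb T) s xs′) (fun-cong N s eq) }

    Z-mono : ∀ {Y Y′} → (∀ x → Y x → Y′ x) → ∀ {y} → Z Y y → Z Y′ y
    Z-mono Y⊆Y′ (T , ps , x) = T , All.map (Y⊆Y′ _) ps , x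

    Sub : Pred I ℓ → Structure L
    Sub Y = record
      { Carrier = Σ (Carrier N) λ y → ∥ Z Y y ∥
      ; fun = λ s xs → Structure.fun N s (proj₁ ∘ xs) , ⌜⌝-intro (Z-closed s (proj₁ ∘ xs) (λ i → ⌜⌝-elim (proj₂ (xs i))))
      ; rel = λ r xs → Structure.rel N r (proj₁ ∘ xs) }

    sub-≡ : ∀ {Y} {u v : Carrier (Sub Y)} → proj₁ u ≡ proj₁ v → u ≡ v
    sub-≡ {Y} = Σ∥∥-≡ {P = Z Y}

    incl : ∀ {Y Y′} → (∀ x → Y x → Y′ x) → Carrier (Sub Y) → Carrier (Sub Y′)
    incl Y⊆Y′ (y , z) = y , ⌜⌝-intro (Z-mono Y⊆Y′ (⌜⌝-elim z))

    incl-embedding : ∀ {Y Y′} (Y⊆Y′ : ∀ x → Y x → Y′ x) → IsEmbedding (Sub Y) (Sub Y′) (incl {Y} {Y′} Y⊆Y′)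
    incl-embedding {Y} {Y′} Y⊆Y′ = record
      { injective = λ eq → sub-≡ {Y} (cong proj₁ eq)
      ; fun-hom = λ _ _ → sub-≡ {Y′} refl
      ; rel-iff = λ _ _ → mk⇔ id id }

    sub-N : ∀ {Y} → IsEmbedding (Sub Y) N proj₁
    sub-N {Y} = record { injective = sub-≡ {Y} ; fun-hom = λ _ _ → refl ; rel-iff = λ _ _ → mk⇔ id id }

    -- Quantifying over all subsets `Y₀` strengthens the induction: intersecting a chain of good
    -- sets with `Y₀` again gives a chain of strong submodels, to which the union axiom applies.
    Good : Pred I ℓ → Set (lsuc ℓ ⊔ k)
    Good Y = ∀ Y₀ (Y₀⊆Y : ∀ x → Y₀ x → Y x) → Strong (Sub Y₀) (Sub Y) (incl {Y₀} {Y} Y₀⊆Y)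

    between : ∀ {Y} → Good Y → ∀ Y₁ Y₂ (p : ∀ x → Y₁ x → Y₂ x) (q : ∀ x → Y₂ x → Y x) →
      Strong (Sub Y₁) (Sub Y₂) (incl {Y₁} {Y₂} p)
    between {Y} good Y₁ Y₂ p q = coherence (incl-embedding {Y₁} {Y₂} p) (good Y₂ q)
      (respects (λ _ → sub-≡ {Y} refl) (good Y₁ (λ x → q x ∘ p x)))

    presents : ∀ {Y} F → (∀ x → x ∈ F → Y x) → (∀ x → Y x → x ∈ F) →
      ∃ λ θ → IsIsomorphism (A F) (Sub Y) θ × ∀ x → proj₁ (θ x) ≡ g F x
    presents {Y} F F⊆Y Y⊆F = θ , record
      { isEmbedding = record
        { injective = λ eq → injective (emb F) (cong proj₁ eq)
        ; fun-hom = λ s xs → sub-≡ {Y} (fun-hom (emb F) s xs)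
        ; rel-iff = rel-iff (emb F) }
      ; surjective = λ { (y , z) → surj y (⌜⌝-elim z) } } , λ _ → refl
      where
      θ : Carrier (A F) → Carrier (Sub Y)
      θ x = g F x , ⌜⌝-intro (F , All.tabulate (F⊆Y _) , x , refl)
      surj : ∀ y {z} → Z Y y → ∃ λ x → θ x ≡ (y , z)
      surj y (T , ps , x , eq) = case mono {T} {F} (λ t t∈T → Y⊆F t (All.lookup ps t∈T)) of λ { (h , _ , gh) →
        h x , sub-≡ {Y} (trans (gh x) eq) }

    good-finite : ∀ {Y} F → (∀ x → x ∈ F → Y x) → (∀ x → Y x → x ∈ F) → Good Y
    good-finite {Y} F F⊆Y Y⊆F Y₀ Y₀⊆Y =
      case presents {Y} F F⊆Y Y⊆F of λ { (θ , θ-iso , gθ) →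
      case presents {Y₀} F₀ (λ x x∈ → proj₂ (∈-filter⁻ (λ x → dec (Y₀ x)) {xs = F} x∈))
             (λ x y₀ → ∈-filter⁺ (λ x → dec (Y₀ x)) (Y⊆F x (Y₀⊆Y x y₀)) y₀) of λ { (θ₀ , θ₀-iso , gθ₀) →
      case mono {F₀} {F} (λ x x∈ → proj₁ (∈-filter⁻ (λ x → dec (Y₀ x)) {xs = F} x∈)) of λ { (h , sh , gh) →
        respects (λ y → sub-≡ {Y} (trans (gθ _) (trans (gh _) (trans (sym (gθ₀ _))
            (cong proj₁ (proj₂ (IsIsomorphism.surjective θ₀-iso y)))))))
          (transitive (isomorphism (inverse-iso θ₀-iso) (proj₂ (strong-K (isomorphism θ₀-iso (KA F₀)))))
            (transitive sh (isomorphism θ-iso (KA F)))) }}}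
      where
      F₀ = filter (λ x → dec (Y₀ x)) F

    module _ {J : Set ℓ} (wJ : WellOrder J) (j₀ : J) (Y : J → Pred I ℓ)
        (goodY : ∀ j → Good (Y j))
        (Y-mono : ∀ {i j} → WellOrder._<_ wJ i j → ∀ x → Y i x → Y j x)
        (U : Pred I ℓ) (Y⊆U : ∀ j x → Y j x → U x)
        (exhausts : ∀ T → All U T → ∃ λ j → All (Y j) T) where
      private
        _∩Y_ : Pred I ℓ → J → Pred I ℓ
        (Y₀ ∩Y j) x = Y₀ x × Y j x

        -- Two terms of the intersected chain are both strong in the structure of the larger good
        -- set, hence one in the other by coherence.
        restricted : ∀ Y₀ (Y₀⊆U : ∀ x → Y₀ x → U x) →
          K (Sub Y₀) × (∀ j → Strong (Sub (Y₀ ∩Y j)) (Sub Y₀) (incl {Y₀ ∩Y j} {Y₀} λ x → proj₁)) ×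
          (∀ B (h : Carrier (Sub Y₀) → Carrier B) → K B →
            (∀ j → Strong (Sub (Y₀ ∩Y j)) B (h ∘ incl {Y₀ ∩Y j} {Y₀} λ x → proj₁)) → Strong (Sub Y₀) B h)
        restricted Y₀ Y₀⊆U = union J (WellOrder._<_ wJ) (WellOrder.isSTO wJ) (WellOrder.wf wJ) j₀
          (λ j → Sub (Y₀ ∩Y j)) (Sub Y₀) (λ j → incl {Y₀ ∩Y j} {Y₀} λ x → proj₁)
          (λ j → proj₁ (strong-K (goodY j (Y₀ ∩Y j) λ x → proj₂)))
          (λ j → incl-embedding {Y₀ ∩Y j} {Y₀} λ x → proj₁)
          (λ {i} {j} i<j → incl {Y₀ ∩Y i} {Y₀ ∩Y j} (λ { x (p , q) → p , Y-mono i<j x q }) ,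
            between (goodY j) (Y₀ ∩Y i) (Y₀ ∩Y j) (λ { x (p , q) → p , Y-mono i<j x q }) (λ x → proj₂) ,
            λ _ → sub-≡ {Y₀} refl)
          λ { (y , z) → covered y (⌜⌝-elim z) }
          where
          covered : ∀ y {z} → Z Y₀ y → ∃₂ λ j x → incl {Y₀ ∩Y j} {Y₀} (λ x → proj₁) x ≡ (y , z)
          covered y (T , ps , x , eq) = case exhausts T (All.map (Y₀⊆U _) ps) of λ { (j , qs) →
            j , (y , ⌜⌝-intro (T , All.zip (ps , qs) , x , eq)) , sub-≡ {Y₀} refl }

      good-union : Good U
      good-union Y₀ Y₀⊆U = proj₂ (proj₂ (restricted Y₀ Y₀⊆U)) (Sub U) (incl {Y₀} {U} Y₀⊆U)
        (proj₁ (restricted U λ _ p → p))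
        λ j → respects (λ _ → sub-≡ {U} refl)
          (transitive (between (goodY j) (Y₀ ∩Y j) (U ∩Y j) (λ { x (p , q) → Y₀⊆U x p , q }) (λ x → proj₂))
            (proj₁ (proj₂ (restricted U λ _ p → p)) j))

    private
      -- The witness is the largest among `j₀` and the members of `T` listed as lying below `i`.
      directed : ∀ i F j₀ → j₀ < i → ∀ T → All (λ x → x < i ⊎ x ∈ F) T →
        ∃ λ (j : Σ I λ j → ∥ j < i ∥) → All (λ x → x < proj₁ j ⊎ x ∈ (proj₁ j ∷ F)) T
      directed i F j₀ j₀<i [] [] = (j₀ , ⌜⌝-intro j₀<i) , []
      directed i F j₀ j₀<i (x ∷ T) (p ∷ ps) = case directed i F j₀ j₀<i T ps of λ { (j , qs) → add j qs p }
        where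
        add : (j : Σ I λ j → ∥ j < i ∥) → All (λ x → x < proj₁ j ⊎ x ∈ (proj₁ j ∷ F)) T → x < i ⊎ x ∈ F →
          ∃ λ (j : Σ I λ j → ∥ j < i ∥) → All (λ x → x < proj₁ j ⊎ x ∈ (proj₁ j ∷ F)) (x ∷ T)
        add j qs (inj₂ x∈F) = j , inj₂ (there x∈F) ∷ qs
        add (j , j<i) qs (inj₁ x<i) with compare x j
        ... | tri< x<j _ _ = (j , j<i) , inj₁ x<j ∷ qs
        ... | tri≈ _ refl _ = (j , j<i) , inj₂ (here refl) ∷ qs
        ... | tri> _ _ j<x = (x , ⌜⌝-intro x<i) , inj₂ (here refl) ∷ All.map raise qs
          where
          raise : ∀ {y} → y < j ⊎ y ∈ (j ∷ F) → y < x ⊎ y ∈ (x ∷ F)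
          raise (inj₁ y<j) = inj₁ (<-trans y<j j<x)
          raise (inj₂ (here refl)) = inj₁ j<x
          raise (inj₂ (there y∈F)) = inj₂ (there y∈F)

    -- An initial segment plus a finite set F is a union of smaller segments plus
    -- larger finite sets, so successor and limit stages need not be distinguished.
    good-segment : ∀ i → Acc _<_ i → ∀ F → Good (λ x → x < i ⊎ x ∈ F)
    good-segment i (acc rs) F with dec (∃ λ j → j < i)
    ... | no none = good-finite F (λ x → inj₂) λ { x (inj₁ x<i) → ⊥-elim (none (x , x<i)) ; x (inj₂ x∈F) → x∈F }
    ... | yes (j₀ , j₀<i) = good-union {J = Σ I λ j → ∥ j < i ∥}
      (pullback proj₁ (Σ∥∥-≡ {P = _< i}) w) (j₀ , ⌜⌝-intro j₀<i)
      (λ j x → x < proj₁ j ⊎ x ∈ (proj₁ j ∷ F))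
      (λ j → good-segment (proj₁ j) (rs (⌜⌝-elim (proj₂ j))) (proj₁ j ∷ F))
      (λ { i<j x (inj₁ p) → inj₁ (<-trans p i<j) ; i<j x (inj₂ (here refl)) → inj₁ i<j
         ; i<j x (inj₂ (there p)) → inj₂ (there p) })
      _
      (λ { j x (inj₁ p) → inj₁ (<-trans p (⌜⌝-elim (proj₂ j)))
         ; j x (inj₂ (here refl)) → inj₁ (⌜⌝-elim (proj₂ j)) ; j x (inj₂ (there p)) → inj₂ p })
      (directed i F j₀ j₀<i)

    private
      Everything : Pred I ℓ
      Everything _ = Lift ℓ ⊤

    good-all : I → Good Everything
    good-all i₀ = good-union w i₀ (λ j x → x < j ⊎ x ∈ (j ∷ []))
      (λ j → good-segment j (wf j) (j ∷ []))
      (λ { i<j x (inj₁ p) → inj₁ (<-trans p i<j) ; i<j x (inj₂ (here refl)) → inj₁ i<j })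
      Everything (λ _ _ _ → lift tt) λ T _ → bound T
      where
      bound : ∀ T → ∃ λ j → All (λ x → x < j ⊎ x ∈ (j ∷ [])) T
      bound [] = i₀ , []
      bound (x ∷ T) with bound T
      ... | j , ps with compare x j
      ...   | tri< x<j _ _ = j , inj₁ x<j ∷ ps
      ...   | tri≈ _ refl _ = j , inj₂ (here refl) ∷ ps
      ...   | tri> _ _ j<x = x , inj₂ (here refl) ∷ All.map (λ
                { (inj₁ y<j) → inj₁ (<-trans y<j j<x) ; (inj₂ (here refl)) → inj₁ j<x }) ps

    all-iso : IsIsomorphism (Sub Everything) N proj₁
    all-iso = record
      { isEmbedding = sub-N {Everything}
      ; surjective = λ y → case cover y of λ { (T , x , eq) →
          (y , ⌜⌝-intro (T , All.universal (λ _ → lift tt) T , x , eq)) , refl } }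

    directed-union : I → ∀ T → Strong (A T) N (g T)
    directed-union i₀ T =
      case presents {λ x → x ∈ T} T (λ _ p → p) (λ _ p → p) of λ { (θ , θ-iso , gθ) →
        respects gθ (transitive (isomorphism θ-iso (KA T))
          (transitive (good-all i₀ (_∈ T) (λ _ _ → lift tt))
            (isomorphism all-iso (proj₁ (strong-K (good-all i₀ Everything λ _ p → p)))))) }

-- The Ehrenfeucht–Mostowski construction

module Template (em : ∀ a → ExcludedMiddle a) (ext : ∀ a b → Extensionality a b)
    {ℓ k : Level} {L : Language ℓ} (𝒦 : AEC L k) where
  open Classical em ext
  open Cardinals em ext
  open AECTools em ext
  open Strongs 𝒦
  open AEC 𝒦
  open IsEmbedding
  open Hull
  open Automorphism using (to; isIso)
  open IsIsomorphism using (isEmbedding)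

  infix 4 _⊑_
  _⊑_ : ∀ {a} {A : Set a} → List A → List A → Set a
  S ⊑ T = ∀ x → x ∈ S → x ∈ T

  -- (S , c) names the c-th element of the hull of the finite set S, and val T computes the
  -- named elements, for S ⊑ T, in a copy inside U of the hull of T.
  module Construct {U : Structure L} (KU : K U) {θ : Set ℓ} (hom : ModelHomogeneous 𝒦 θ U)
      {W : Set} (W<θ : W <# θ) {I : Set ℓ} (val : List I → List I × W → Carrier U)
      (coherent : ∀ {T T′} → T ⊑ T′ → (l : List (List I × W)) → All (λ g → proj₁ g ⊑ T) l →
        ConjL U (map (val T) l) (map (val T′) l))
      (hull : ∀ {S T} → S ⊑ T → Hull U (λ c → val T (S , c)))
      (within : ∀ {S T} → S ⊑ T → ∀ c → ∃ λ c′ → val T (T , c′) ≡ val T (S , c)) where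

    G : Set ℓ
    G = List I × W

    ⊑-refl : ∀ {T : List I} → T ⊑ T
    ⊑-refl _ p = p

    ⊑-trans : ∀ {R S T : List I} → R ⊑ S → S ⊑ T → R ⊑ T
    ⊑-trans p q x = q x ∘ p x

    ⊑-++ˡ : ∀ {S T : List I} → S ⊑ S ++ˡ T
    ⊑-++ˡ _ = ∈-++⁺ˡ

    ⊑-++ʳ : ∀ (S : List I) {T} → T ⊑ S ++ˡ T
    ⊑-++ʳ S _ = ∈-++⁺ʳ S

    ++-⊑ : ∀ (S : List I) {S′ T} → S ⊑ T → S′ ⊑ T → S ++ˡ S′ ⊑ T
    ++-⊑ S p q x x∈ = [ p x , q x ]′ (∈-++⁻ S x∈)

    along : ∀ {T T′} → T ⊑ T′ → ∀ {n} (g : G) (gs : Fin n → G) → proj₁ g ⊑ T → (∀ i → proj₁ (gs i) ⊑ T) →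
      ∃ λ (σ : Automorphism U) → to σ (val T g) ≡ val T′ g × ∀ i → to σ (val T (gs i)) ≡ val T′ (gs i)
    along T⊑T′ g gs p ps = case coherent T⊑T′ (g ∷ tabulate gs) (p ∷ Allₚ.tabulate⁺ ps) of λ { (σ , eq) →
      σ , map≡⇒∈ (g ∷ tabulate gs) eq (here refl) ,
      λ i → map≡⇒∈ (g ∷ tabulate gs) eq (there (∈-tabulate⁺ i)) }

    along₂ : ∀ {T T′} → T ⊑ T′ → ∀ (g g′ : G) → proj₁ g ⊑ T → proj₁ g′ ⊑ T →
      ∃ λ (σ : Automorphism U) → to σ (val T g) ≡ val T′ g × to σ (val T g′) ≡ val T′ g′
    along₂ T⊑T′ g g′ p p′ = case along T⊑T′ {1} g (λ _ → g′) p (λ _ → p′) of λ { (σ , q , q′) → σ , q , q′ fzero }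

    infix 4 _~_
    -- By `coherent`, two names agree in one set containing both supports exactly when they agree in
    -- every such set.
    _~_ : Rel G ℓ
    (S , c) ~ (S′ , c′) = val (S ++ˡ S′) (S , c) ≡ val (S ++ˡ S′) (S′ , c′)

    ~⇒≡ : ∀ {T g g′} → proj₁ g ⊑ T → proj₁ g′ ⊑ T → g ~ g′ → val T g ≡ val T g′
    ~⇒≡ {T} {g} {g′} p p′ eq =
      case along₂ (++-⊑ (proj₁ g) p p′) g g′ (⊑-++ˡ {proj₁ g}) (⊑-++ʳ (proj₁ g)) of λ { (σ , q , q′) →
        trans (sym q) (trans (cong (to σ) eq) q′) }

    ≡⇒~ : ∀ {T g g′} → proj₁ g ⊑ T → proj₁ g′ ⊑ T → val T g ≡ val T g′ → g ~ g′
    ≡⇒~ {T} {g} {g′} p p′ eq =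
      case along₂ (++-⊑ (proj₁ g) p p′) g g′ (⊑-++ˡ {proj₁ g}) (⊑-++ʳ (proj₁ g)) of λ { (σ , q , q′) →
        auto-injective σ (trans q (trans eq (sym q′))) }

    ~-equiv : IsEquivalence _~_
    ~-equiv = record
      { refl = refl
      ; sym = λ {g} {g′} eq → ≡⇒~ (⊑-++ʳ (proj₁ g)) (⊑-++ˡ {proj₁ g}) (sym eq)
      ; trans = λ {g} {g′} {g″} p q →
          let T = proj₁ g ++ˡ (proj₁ g′ ++ˡ proj₁ g″)
              in₁ = ⊑-++ˡ {proj₁ g} {proj₁ g′ ++ˡ proj₁ g″}
              in₂ = ⊑-trans (⊑-++ˡ {proj₁ g′} {proj₁ g″}) (⊑-++ʳ (proj₁ g))
              in₃ = ⊑-trans (⊑-++ʳ (proj₁ g′) {proj₁ g″}) (⊑-++ʳ (proj₁ g))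
          in ≡⇒~ {T} {g} {g″} in₁ in₃ (trans (~⇒≡ {T} {g} {g′} in₁ in₂ p) (~⇒≡ {T} {g′} {g″} in₂ in₃ q)) }

    abstract
      classes : Quotient G _~_
      classes = quotient ~-equiv

    open Quotient classes

    support : ∀ {n} → (Fin n → G) → List I
    support gs = concat (tabulate (proj₁ ∘ gs))

    support-⊑ : ∀ {n} (gs : Fin n → G) i → proj₁ (gs i) ⊑ support gs
    support-⊑ gs i x x∈ = ∈-concat⁺′ x∈ (∈-tabulate⁺ {f = proj₁ ∘ gs} i)

    -- All arguments lie in the hull of `T` by `within`, and a strong submodel is closed under
    -- functions.
    fun-value : ∀ T s (gs : Fin _ → G) → (∀ i → proj₁ (gs i) ⊑ T) →
      ∃ λ c → val T (T , c) ≡ Structure.fun U s (val T ∘ gs)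
    fun-value T s gs ps = proj₁ named , trans (proj₂ named) (trans (fun-hom (embedding (strong H)) s ys) (fun-cong U s ys-eq))
      where
      H = hull (⊑-refl {T})
      y : ∀ i → ∃ λ y → f H y ≡ val T (gs i)
      y i = case within (ps i) (proj₂ (gs i)) of λ { (c′ , eq) →
        case into H c′ of λ { (y , eq′) → y , trans eq′ eq } }
      ys : Fin _ → Carrier (A H)
      ys = proj₁ ∘ y
      ys-eq : ∀ i → f H (ys i) ≡ val T (gs i)
      ys-eq = proj₂ ∘ y
      named = onto H (Structure.fun (A H) s ys)

    N : Structure L
    N = record
      { Carrier = Q
      ; fun = λ s xs → [ support (rep ∘ xs) , proj₁ (fun-value _ s (rep ∘ xs) (support-⊑ (rep ∘ xs))) ]
      ; rel = λ r xs → Structure.rel U r (val (support (rep ∘ xs)) ∘ (rep ∘ xs)) }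

    private
      rep-~ : ∀ {g q} → [ g ] ≡ q → rep q ~ g
      rep-~ {g} {q} eq = complete (trans ([rep] q) (sym eq))

    -- The chosen representatives and the given names take equal values over the joint support;
    -- `coherent` transports the relation to it and back.
    rel-N : ∀ r (xs : Fin _ → Q) T (gs : Fin _ → G) → (∀ i → proj₁ (gs i) ⊑ T) → (∀ i → [ gs i ] ≡ xs i) →
      Structure.rel N r xs ⇔ Structure.rel U r (val T ∘ gs)
    rel-N r xs T gs ps eq = mk⇔
      (λ R → move⁻ (⊑-++ˡ {T}) gs ps (rel-cong U r same (move (⊑-++ʳ T) (rep ∘ xs) (support-⊑ (rep ∘ xs)) R)))
      (λ R → move⁻ (⊑-++ʳ T) (rep ∘ xs) (support-⊑ (rep ∘ xs)) (rel-cong U r (sym ∘ same) (move (⊑-++ˡ {T}) gs ps R)))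
      where
      T° = support (rep ∘ xs)
      same : ∀ i → val (T ++ˡ T°) (rep (xs i)) ≡ val (T ++ˡ T°) (gs i)
      same i = ~⇒≡ {T ++ˡ T°} {rep (xs i)} {gs i} (⊑-trans (support-⊑ (rep ∘ xs) i) (⊑-++ʳ T)) (⊑-trans (ps i) (⊑-++ˡ {T})) (rep-~ {gs i} (eq i))
      moves : ∀ {n S S′} → S ⊑ S′ → (hs : Fin n → G) → (∀ i → proj₁ (hs i) ⊑ S) →
        ∃ λ (σ : Automorphism U) → ∀ i → to σ (val S (hs i)) ≡ val S′ (hs i)
      moves {zero} _ _ _ = idᵃ U , λ ()
      moves {suc n} S⊑S′ hs qs = case along S⊑S′ (hs fzero) hs (qs fzero) qs of λ { (σ , _ , q) → σ , q }
      move : ∀ {S S′} → S ⊑ S′ → (hs : Fin _ → G) → (∀ i → proj₁ (hs i) ⊑ S) →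
        Structure.rel U r (val S ∘ hs) → Structure.rel U r (val S′ ∘ hs)
      move S⊑S′ hs qs R = case moves S⊑S′ hs qs of λ { (σ , q) →
        rel-cong U r q (to⇔ (rel-iff (isEmbedding (isIso σ)) r _) R) }
      move⁻ : ∀ {S S′} → S ⊑ S′ → (hs : Fin _ → G) → (∀ i → proj₁ (hs i) ⊑ S) →
        Structure.rel U r (val S′ ∘ hs) → Structure.rel U r (val S ∘ hs)
      move⁻ S⊑S′ hs qs R = case moves S⊑S′ hs qs of λ { (σ , q) →
        from⇔ (rel-iff (isEmbedding (isIso σ)) r _) (rel-cong U r (sym ∘ q) R) }

    fun-N : ∀ s (xs : Fin _ → Q) T (gs : Fin _ → G) g → (∀ i → proj₁ (gs i) ⊑ T) → (∀ i → [ gs i ] ≡ xs i) →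
      proj₁ g ⊑ T → val T g ≡ Structure.fun U s (val T ∘ gs) → Structure.fun N s xs ≡ [ g ]
    fun-N s xs T gs g ps eq p val-g = sound (≡⇒~ {T ++ˡ T°} (⊑-++ʳ T) (⊑-trans p (⊑-++ˡ {T}))
      (trans (move (⊑-++ʳ T) (T° , c°) (rep ∘ xs) (λ _ q → q) (support-⊑ (rep ∘ xs)) (proj₂ value))
        (trans (fun-cong U s same) (sym (move (⊑-++ˡ {T}) g gs p ps val-g)))))
      where
      T° = support (rep ∘ xs)
      value = fun-value T° s (rep ∘ xs) (support-⊑ (rep ∘ xs))
      c° = proj₁ value
      same : ∀ i → val (T ++ˡ T°) (rep (xs i)) ≡ val (T ++ˡ T°) (gs i)
      same i = ~⇒≡ {T ++ˡ T°} {rep (xs i)} {gs i} (⊑-trans (support-⊑ (rep ∘ xs) i) (⊑-++ʳ T)) (⊑-trans (ps i) (⊑-++ˡ {T})) (rep-~ {gs i} (eq i))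
      move : ∀ {S S′} → S ⊑ S′ → ∀ h (hs : Fin _ → G) → proj₁ h ⊑ S → (∀ i → proj₁ (hs i) ⊑ S) →
        val S h ≡ Structure.fun U s (val S ∘ hs) → val S′ h ≡ Structure.fun U s (val S′ ∘ hs)
      move S⊑S′ h hs q qs e = case along S⊑S′ h hs q qs of λ { (σ , r , rs) →
        trans (sym r) (trans (cong (to σ) e)
          (trans (fun-hom (isEmbedding (isIso σ)) s _) (fun-cong U s rs))) }

    abstract
      H : ∀ T → Hull U (λ c → val T (T , c))
      H T = hull (⊑-refl {T})

    name : ∀ T → Carrier (A (H T)) → W
    name T x = proj₁ (onto (H T) x)

    name-val : ∀ T x → val T (T , name T x) ≡ f (H T) x
    name-val T x = proj₂ (onto (H T) x)

    include : ∀ T → Carrier (A (H T)) → Q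
    include T x = [ T , name T x ]

    include-embedding : ∀ T → IsEmbedding (A (H T)) N (include T)
    include-embedding T = record
      { injective = λ {x} {y} eq → injective e (trans (sym (name-val T x))
          (trans (~⇒≡ {T} {T , name T x} {T , name T y} (λ _ p → p) (λ _ p → p) (complete eq)) (name-val T y)))
      ; fun-hom = λ s xs → sym (fun-N s (include T ∘ xs) T (λ i → T , name T (xs i)) (T , name T _)
          (λ _ _ p → p) (λ _ → refl) (λ _ p → p)
          (trans (name-val T _) (trans (fun-hom e s xs) (fun-cong U s (λ i → sym (name-val T (xs i)))))))
      ; rel-iff = λ r xs → mk⇔
          (λ R → from⇔ (reln r xs) (rel-cong U r (λ i → sym (name-val T (xs i))) (to⇔ (rel-iff e r xs) R)))
          (λ R → from⇔ (rel-iff e r xs) (rel-cong U r (λ i → name-val T (xs i)) (to⇔ (reln r xs) R))) }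
      where
      e = embedding (strong (H T))
      reln : ∀ r xs → Structure.rel N r (include T ∘ xs) ⇔ Structure.rel U r (λ i → val T (T , name T (xs i)))
      reln r xs = rel-N r (include T ∘ xs) T (λ i → T , name T (xs i)) (λ _ _ p → p) (λ _ → refl)

    abstract
      point : ∀ {T} S c → S ⊑ T → ∃ λ x → f (H T) x ≡ val T (S , c) × include T x ≡ [ S , c ]
      point {T} S c S⊑T = case within S⊑T c of λ { (c′ , eq) → case into (H T) c′ of λ { (x , fx) →
        x , trans fx eq , sound (≡⇒~ {T} (λ _ p → p) S⊑T (trans (name-val T x) (trans fx eq))) } }

      -- The names with support `S`, evaluated over `S` and over `T`, enumerate two models along the
      -- same indices. They are conjugate by `fin⇒conj`, and the second lies in the hull of `T`.
      restrict : ∀ {S T} → S ⊑ T → ∃ λ h → Strong (A (H S)) (A (H T)) h × (∀ x → include T (h x) ≡ include S x)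
      restrict {S} {T} S⊑T =
        case Homogeneous.fin⇒conj KU hom W<θ (H S) (hull S⊑T) fin of λ { (σ , σval) →
        case factor (strong-∘auto (strong (H S)) σ) (strong (H T)) (λ x →
               case point S (name S x) S⊑T of λ { (y , fy , _) → y ,
                 trans fy (trans (sym (σval (name S x))) (cong (to σ) (name-val S x))) }) of λ { (h , sh , fh) →
          h , sh , λ x → sound (≡⇒~ {T} (λ _ p → p) S⊑T (trans (name-val T (h x)) (trans (fh x)
            (trans (cong (to σ) (sym (name-val S x))) (σval (name S x)))))) }}
        where
        fin : FinConj U (λ c → val S (S , c)) (λ c → val T (S , c))
        fin l = case coherent S⊑T (map (S ,_) l) (Allₚ.map⁺ (All.universal (λ _ _ p → p) l)) of λ { (σ , eq) →
          σ , trans (cong (map (to σ)) (map-∘ l)) (trans eq (sym (map-∘ l))) }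

    cover : ∀ y → ∃₂ λ T x → include T x ≡ y
    cover y = case point (proj₁ (rep y)) (proj₂ (rep y)) (λ _ p → p) of λ { (x , _ , eq) →
      proj₁ (rep y) , x , trans eq ([rep] y) }

    include-strong : WellOrder I → I → ∀ T → Strong (A (H T)) N (include T)
    include-strong w = DirectedUnions.System.directed-union em ext 𝒦 N w (A ∘ H) include include-embedding restrict cover

-- Skolem hulls of finite sequences and the template

module Stretching (em : ∀ a → ExcludedMiddle a) (ext : ∀ a b → Extensionality a b)
    {ℓ k : Level} {L : Language ℓ} (𝒦 : AEC L k) (monster : MonsterModel 𝒦)
    (fur : FUR.IsFUR 𝒦 monster) (super : FUR.SuperMonster 𝒦 monster) where
  open Classical em ext
  open Cardinals em ext
  open AECTools em ext
  open Monsters em ext 𝒦 monster fur super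
  open MonsterModel monster using (δ; inaccessible; 𝕄; 𝕄∈K)
  open FUR 𝒦 monster using (M)
  open AEC 𝒦
  open Strongs 𝒦 using (enumerate; hull-∘) renaming (Hull to StrongHull)
  open Partitions em ext inaccessible hiding (module Patterns)
  open Template em ext 𝒦

  Hull : (ℕ ⊎ ℕ → M) → Set (lsuc ℓ ⊔ k)
  Hull = StrongHull 𝕄

  abstract
    enumerateℕ : (x : ℕ → M) → ∃ λ (e : ℕ ⊎ ℕ → M) → Hull e × ∀ n → e (inj₁ n) ≡ x n
    enumerateℕ x = case enumerate (FUR.IsFUR.LS≡ω fur) 𝕄∈K (x ∘ lower) (lift 0) (countable-⊎ (lift↣ ℓ) ↣-refl) of λ
      { (e , H) → [ x ∘ lower , e ]′ ∘ [ inj₁ ∘ lift , inj₂ ]′ ,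
        hull-∘ [ inj₁ ∘ lift , inj₂ ]′ (λ { (inj₁ (lift n)) → inj₁ n , refl ; (inj₂ n) → inj₂ n , refl }) H ,
        λ _ → refl }

  module Hulls (A₁ : List M) (m : ℕ) where

    Point : Set ℓ
    Point = Fin m → M

    W : Set
    W = ℕ ⊎ ℕ

    W↣ℕ : W ↣ ℕ
    W↣ℕ = countable-⊎ ↣-refl ↣-refl

    private
      -- The entries each hull must contain: the parameters `A₁`, the coordinates of the first
      -- point, and the hull entries of proper subsequences. Their indices do not depend on the
      -- sequence, so names keep their meaning from one sequence to another.
      Prescribed : Set
      Prescribed = ℕ ⊎ (Fin m ⊎ (List Bool × W))

      abstract
        prescribed↣ℕ : Prescribed ↣ ℕ
        prescribed↣ℕ = countable-⊎ ↣-refl (countable-⊎ (fin↣ℕ m) (countable-× (countable-List bool↣ℕ) W↣ℕ))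

      encode : Prescribed → ℕ
      encode = Injection.to prescribed↣ℕ

      decode : ℕ → Maybe Prescribed
      decode n with dec (∃ λ u → encode u ≡ n)
      ... | yes (u , _) = just u
      ... | no _ = nothing

      decode-encode : ∀ u → decode (encode u) ≡ just u
      decode-encode u with dec (∃ λ v → encode v ≡ encode u)
      ... | yes (v , eq) = cong just (Injection.injective prescribed↣ℕ eq)
      ... | no none = ⊥-elim (none (u , refl))

      nth : List M → ℕ → M
      nth [] _ = m₀
      nth (a ∷ _) zero = a
      nth (_ ∷ l) (suc n) = nth l n

      nth-∈ : ∀ {a} l → a ∈ l → ∃ λ n → nth l n ≡ a
      nth-∈ (_ ∷ l) (here refl) = 0 , refl
      nth-∈ (_ ∷ l) (there p) = case nth-∈ l p of λ { (n , eq) → suc n , eq }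

      first : List Point → Fin m → M
      first [] _ = m₀
      first (p ∷ _) = p

      _⋖_ : Rel (List Point) lzero
      t ⋖ s = length t <ⁿ length s

      sub : ∀ s → (∀ t → t ⋖ s → W → M) → ∀ μ → W → Dec (select μ s ⋖ s) → M
      sub s rec μ c (yes p) = rec (select μ s) p c
      sub s rec μ c (no _) = m₀

      interpret : ∀ s → (∀ t → t ⋖ s → W → M) → Maybe Prescribed → M
      interpret s rec (just (inj₁ n)) = nth A₁ n
      interpret s rec (just (inj₂ (inj₁ c))) = first s c
      interpret s rec (just (inj₂ (inj₂ (μ , c)))) = sub s rec μ c (dec _)
      interpret s rec nothing = m₀

      step : ∀ s → (∀ t → t ⋖ s → W → M) → W → M
      step s rec = proj₁ (enumerateℕ (interpret s rec ∘ decode))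

      open Recursion (On.wellFounded length <-wellFounded) step

    -- A substitute for Skolem functions, by recursion on length, so that the hull of a sequence
    -- contains the hulls of its subsequences.
    e : List Point → W → M
    e = wfix

    e-hull : ∀ s → Hull (e s)
    e-hull s = subst Hull (sym (wfix-unfold s)) (proj₁ (proj₂ (enumerateℕ _)))

    private
      e-prescribed : ∀ s u → e s (inj₁ (encode u)) ≡ interpret s (λ t _ → e t) (just u)
      e-prescribed s u = trans (cong (λ h → h (inj₁ (encode u))) (wfix-unfold s))
        (trans (proj₂ (proj₂ (enumerateℕ (interpret s (λ t _ → e t) ∘ decode))) (encode u))
          (cong (interpret s λ t _ → e t) (decode-encode u)))

    e-A₁ : ∀ {a} → a ∈ A₁ → ∃ λ c → ∀ s → e s c ≡ a
    e-A₁ a∈ = case nth-∈ A₁ a∈ of λ { (n , eq) → inj₁ (encode (inj₁ n)) , λ s → trans (e-prescribed s _) eq }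

    e-first : ∀ i → ∃ λ c → ∀ p s → e (p ∷ s) c ≡ p i
    e-first i = inj₁ (encode (inj₂ (inj₁ i))) , λ p s → e-prescribed (p ∷ s) _

    e-sub : ∀ μ s c → ∃ λ c′ → e s c′ ≡ e (select μ s) c
    e-sub μ s c with dec (select μ s ⋖ s)
    ... | no ¬p = c , cong (λ t → e t c) (sym (whole μ s ¬p))
      where
      whole : ∀ μ (s : List Point) → ¬ select μ s ⋖ s → select μ s ≡ s
      whole [] [] _ = refl
      whole [] (x ∷ s) ¬p = ⊥-elim (¬p (s≤s z≤n))
      whole (true ∷ μ) [] _ = refl
      whole (false ∷ μ) [] _ = refl
      whole (true ∷ μ) (x ∷ s) ¬p = cong (x ∷_) (whole μ s (¬p ∘ s≤s))
      whole (false ∷ μ) (x ∷ s) ¬p = ⊥-elim (¬p (s≤s (select-length μ s)))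
    ... | yes p = inj₁ (encode (inj₂ (inj₂ (μ , c)))) , trans (e-prescribed s _) (found (dec _))
      where
      found : (d : Dec (select μ s ⋖ s)) → sub s (λ t _ → e t) μ c d ≡ e (select μ s) c
      found (yes _) = refl
      found (no ¬p) = ⊥-elim (¬p p)

    C : Set ℓ
    C = Lift ℓ (List (List Bool × W)) → ℕ

    C<δ : C <# δ
    C<δ = small-→ℕ (small-countable (countable-List (countable-× (countable-List bool↣ℕ) W↣ℕ) ⊚ lift↣ ℓ))

    -- The colour records every finite tuple of entries from the hulls of all subsequences. There
    -- are countably many such tuples of names, so at most continuum many colours.
    col : List Point → C
    col s (lift l) = code (map (λ { (μ , c) → e (select μ s) c }) l)

    module Indiscernible {r} (R : Rel Point r)
        (spread : ∀ {J : Set ℓ} → J <# δ → (f : J → Point) → ∃ λ p → ∀ j → ¬ R p (f j))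
        {I : Set ℓ} (w : WellOrder I) where
      open Partitions.Patterns em ext inaccessible C<δ R col spread
      open WellOrder w using (_<_; compare; <-trans; <-irrefl)

      insert : I → List I → List I
      insert x [] = x ∷ []
      insert x (y ∷ l) with compare x y
      ... | tri< _ _ _ = y ∷ insert x l
      ... | tri≈ _ _ _ = y ∷ l
      ... | tri> _ _ _ = x ∷ y ∷ l

      insert-∈ : ∀ x l → x ∈ insert x l
      insert-∈ x [] = here refl
      insert-∈ x (y ∷ l) with compare x y
      ... | tri< _ _ _ = there (insert-∈ x l)
      ... | tri≈ _ refl _ = here refl
      ... | tri> _ _ _ = here refl

      insert-there : ∀ x l {z} → z ∈ l → z ∈ insert x l
      insert-there x (y ∷ l) z∈ with compare x y
      insert-there x (y ∷ l) (here eq) | tri< _ _ _ = here eq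
      insert-there x (y ∷ l) (there z∈) | tri< _ _ _ = there (insert-there x l z∈)
      insert-there x (y ∷ l) z∈ | tri≈ _ _ _ = z∈
      insert-there x (y ∷ l) z∈ | tri> _ _ _ = there z∈

      insert⁻ : ∀ x l {z} → z ∈ insert x l → z ≡ x ⊎ z ∈ l
      insert⁻ x [] (here eq) = inj₁ eq
      insert⁻ x (y ∷ l) z∈ with compare x y
      insert⁻ x (y ∷ l) (here eq) | tri< _ _ _ = inj₂ (here eq)
      insert⁻ x (y ∷ l) (there z∈) | tri< _ _ _ with insert⁻ x l z∈
      ... | inj₁ eq = inj₁ eq
      ... | inj₂ z∈l = inj₂ (there z∈l)
      insert⁻ x (y ∷ l) z∈ | tri≈ _ _ _ = inj₂ z∈
      insert⁻ x (y ∷ l) (here eq) | tri> _ _ _ = inj₁ eq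
      insert⁻ x (y ∷ l) (there z∈) | tri> _ _ _ = inj₂ z∈

      insert-desc : ∀ x l → Desc w l → Desc w (insert x l)
      insert-desc x [] _ = [] ∷ []
      insert-desc x (y ∷ l) (p ∷ ps) with compare x y
      ... | tri< x<y _ _ = All.tabulate (λ {z} z∈ → below z (insert⁻ x l z∈)) ∷ insert-desc x l ps
        where
        below : ∀ z → z ≡ x ⊎ z ∈ l → z < y
        below z (inj₁ refl) = x<y
        below z (inj₂ z∈l) = All.lookup p z∈l
      ... | tri≈ _ _ _ = p ∷ ps
      ... | tri> _ _ y<x = (y<x ∷ All.map (λ z<y → <-trans z<y y<x) p) ∷ p ∷ ps

      D : List I → List I
      D [] = []
      D (x ∷ T) = insert x (D T)

      D-desc : ∀ T → Desc w (D T)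
      D-desc [] = []
      D-desc (x ∷ T) = insert-desc x (D T) (D-desc T)

      D⁺ : ∀ T {x} → x ∈ T → x ∈ D T
      D⁺ (x ∷ T) (here refl) = insert-∈ x (D T)
      D⁺ (y ∷ T) (there x∈) = insert-there y (D T) (D⁺ T x∈)

      D⁻ : ∀ T {x} → x ∈ D T → x ∈ T
      D⁻ (y ∷ T) x∈ with insert⁻ y (D T) x∈
      ... | inj₁ refl = here refl
      ... | inj₂ x∈D = there (D⁻ T x∈D)

      desc-unique : ∀ l l′ → Desc w l → Desc w l′ → l ⊑ l′ → l′ ⊑ l → l ≡ l′
      desc-unique [] [] _ _ _ _ = refl
      desc-unique [] (y ∷ l′) _ _ _ q with q y (here refl)
      ... | ()
      desc-unique (x ∷ l) [] _ _ p _ with p x (here refl)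
      ... | ()
      desc-unique (x ∷ l) (y ∷ l′) (a ∷ as) (b ∷ bs) p q with p x (here refl) | q y (here refl)
      ... | there x∈l′ | there y∈l = ⊥-elim (<-irrefl (<-trans (All.lookup b x∈l′) (All.lookup a y∈l)))
      ... | here refl | _ = cong (x ∷_) (desc-unique l l′ as bs (tails a p) (tails b q))
        where
        tails : ∀ {l l′} → All (_< x) l → x ∷ l ⊑ x ∷ l′ → l ⊑ l′
        tails a p z z∈ with p z (there z∈)
        ... | here refl = ⊥-elim (<-irrefl (All.lookup a z∈))
        ... | there z∈′ = z∈′
      ... | there x∈l′ | here refl = ⊥-elim (<-irrefl (All.lookup b x∈l′))

      mask : List I → List I → List Bool
      mask l S = map (λ x → ⌜ x ∈ S ⌝) l

      select-[] : ∀ {a} {A : Set a} μ → select {A = A} μ [] ≡ []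
      select-[] [] = refl
      select-[] (true ∷ μ) = refl
      select-[] (false ∷ μ) = refl

      keep⁻ : ∀ l S {x} → x ∈ select (mask l S) l → x ∈ l × x ∈ S
      keep⁻ (y ∷ l) S x∈ with dec (y ∈ S)
      keep⁻ (y ∷ l) S (here refl) | yes y∈S = here refl , y∈S
      keep⁻ (y ∷ l) S (there x∈) | yes _ = case keep⁻ l S x∈ of λ { (p , q) → there p , q }
      keep⁻ (y ∷ l) S x∈ | no _ = case keep⁻ l S x∈ of λ { (p , q) → there p , q }

      keep⁺ : ∀ l S {x} → x ∈ l → x ∈ S → x ∈ select (mask l S) l
      keep⁺ (y ∷ l) S x∈l x∈S with dec (y ∈ S)
      keep⁺ (y ∷ l) S (here refl) x∈S | yes _ = here refl
      keep⁺ (y ∷ l) S (there x∈l) x∈S | yes _ = there (keep⁺ l S x∈l x∈S)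
      keep⁺ (y ∷ l) S (here refl) x∈S | no y∉S = ⊥-elim (y∉S x∈S)
      keep⁺ (y ∷ l) S (there x∈l) x∈S | no _ = keep⁺ l S x∈l x∈S

      keep-D : ∀ S T → S ⊑ T → select (mask (D T) S) (D T) ≡ D S
      keep-D S T S⊑T = desc-unique _ _ (select-AllPairs (mask (D T) S) (D-desc T)) (D-desc S)
        (λ x x∈ → D⁺ S (proj₂ (keep⁻ (D T) S x∈)))
        (λ x x∈ → keep⁺ (D T) S (D⁺ T (S⊑T x (D⁻ S x∈))) (D⁻ S x∈))

      keep-keep : ∀ {a} {A : Set a} S T → S ⊑ T → ∀ l (s : List A) →
        select (mask l S) s ≡ select (mask (select (mask l T) l) S) (select (mask l T) s)
      keep-keep S T S⊑T [] s = refl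
      keep-keep S T S⊑T (x ∷ l) [] =
        trans (select-[] (mask (x ∷ l) S)) (sym (trans (cong (select μ) (select-[] (mask (x ∷ l) T))) (select-[] μ)))
        where μ = mask (select (mask (x ∷ l) T) (x ∷ l)) S
      keep-keep S T S⊑T (x ∷ l) (y ∷ s) with dec (x ∈ T)
      keep-keep S T S⊑T (x ∷ l) (y ∷ s) | yes _ with dec (x ∈ S)
      ... | yes _ = cong (y ∷_) (keep-keep S T S⊑T l s)
      ... | no _ = keep-keep S T S⊑T l s
      keep-keep S T S⊑T (x ∷ l) (y ∷ s) | no x∉T with dec (x ∈ S)
      ... | yes x∈S = ⊥-elim (x∉T (S⊑T x x∈S))
      ... | no _ = keep-keep S T S⊑T l s

      select-length-cong : ∀ {a b} {A : Set a} {B : Set b} μ (l : List A) (l′ : List B) →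
        length l ≡ length l′ → length (select μ l) ≡ length (select μ l′)
      select-length-cong [] _ _ _ = refl
      select-length-cong (true ∷ μ) [] [] _ = refl
      select-length-cong (false ∷ μ) [] [] _ = refl
      select-length-cong (true ∷ μ) (_ ∷ l) (_ ∷ l′) eq = cong suc (select-length-cong μ l l′ (ℕₚ.suc-injective eq))
      select-length-cong (false ∷ μ) (_ ∷ l) (_ ∷ l′) eq = select-length-cong μ l l′ (ℕₚ.suc-injective eq)

      -- T is interpreted by the indiscernible pattern of its size, and S ⊑ T by the subsequence v T S.
      v : List I → List I → List Point
      v T S = select (mask (D T) S) (pattern-at (length (D T)))

      val : List I → List I × W → M
      val T (S , c) = e (v T S) c

      v-length : ∀ S T → S ⊑ T → length (v T S) ≡ length (D S)
      v-length S T S⊑T = trans (select-length-cong (mask (D T) S) _ (D T) (pattern-length _))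
        (cong length (keep-D S T S⊑T))

      v-sub : ∀ S T T′ → S ⊑ T → T ⊑ T′ → v T′ S ≡ select (mask (D T) S) (v T′ T)
      v-sub S T T′ S⊑T T⊑T′ = trans (keep-keep S T S⊑T (D T′) _)
        (cong (λ l → select (mask l S) (v T′ T)) (keep-D T T′ T⊑T′))

      -- Both sequences have as many terms as `D T`, and within a pattern the colour depends on the
      -- number of terms only.
      col-v : ∀ T T′ → T ⊑ T′ → col (v T T) ≡ col (v T′ T)
      col-v T T′ T⊑T′ = trans (pattern-colour _ (mask (D T) T))
        (trans (cong χ (trans (v-length T T (λ _ p → p)) (sym (v-length T T′ T⊑T′))))
          (sym (pattern-colour _ (mask (D T′) T))))

      -- A name supported in `T` is a hull entry of a subsequence whose mask depends on `T` and its
      -- support alone. The equal colours of `v T T` and `v T′ T` thus contain the codes of the two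
      -- tuples under the same key.
      coherent : ∀ {T T′} → T ⊑ T′ → (l : List (List I × W)) → All (λ g → proj₁ g ⊑ T) l →
        ConjL 𝕄 (map (val T) l) (map (val T′) l)
      coherent {T} {T′} T⊑T′ l ps = code-sound
        (trans (cong code (named T (λ _ p → p) l ps))
          (trans (cong (λ c → c (lift (masks l))) (col-v T T′ T⊑T′))
            (sym (cong code (named T′ T⊑T′ l ps)))))
        where
        masks : List (List I × W) → List (List Bool × W)
        masks = map λ { (S , c) → mask (D T) S , c }
        named : ∀ T′ → T ⊑ T′ → ∀ l → All (λ g → proj₁ g ⊑ T) l →
          map (val T′) l ≡ map (λ { (μ , c) → e (select μ (v T′ T)) c }) (masks l)
        named T′ T⊑T′ [] [] = refl
        named T′ T⊑T′ ((S , c) ∷ l) (p ∷ ps) =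
          cong₂ _∷_ (cong (λ s → e s c) (v-sub S T T′ p T⊑T′)) (named T′ T⊑T′ l ps)

      within : ∀ {S T} → S ⊑ T → ∀ c → ∃ λ c′ → val T (T , c′) ≡ val T (S , c)
      within {S} {T} S⊑T c = case e-sub (mask (D T) S) (v T T) c of λ { (c′ , eq) →
        c′ , trans eq (cong (λ s → e s c) (sym (v-sub S T T S⊑T (λ _ p → p)))) }

      hulls : ∀ {S T} → S ⊑ T → Hull (λ c → val T (S , c))
      hulls {S} {T} _ = e-hull (v T S)

      p₁ p₂ : Point
      p₁ = proj₁ pattern-2
      p₂ = proj₁ (proj₂ pattern-2)

      p₁≁p₂ : ¬ R p₁ p₂
      p₁≁p₂ = proj₂ (proj₂ (proj₂ pattern-2))

      hd : Fin m → W
      hd c = proj₁ (e-first c)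

      coordinate : ∀ {i j} → j < i → ∀ c →
        val (i ∷ j ∷ []) (i ∷ [] , hd c) ≡ p₁ c × val (i ∷ j ∷ []) (j ∷ [] , hd c) ≡ p₂ c
      coordinate {i} {j} j<i c =
        trans (cong (λ s → e s _) (trans (v-at (i ∷ [])) left)) (proj₂ (e-first c) p₁ []) ,
        trans (cong (λ s → e s _) (trans (v-at (j ∷ [])) right)) (proj₂ (e-first c) p₂ [])
        where
        T : List I
        T = i ∷ j ∷ []
        D-T : D T ≡ T
        D-T = desc-unique _ _ (D-desc T) ((j<i ∷ []) ∷ [] ∷ []) (λ _ → D⁻ T) (λ _ → D⁺ T)
        v-at : ∀ S → v T S ≡ select (mask T S) (p₁ ∷ p₂ ∷ [])
        v-at S = trans (cong (λ l → select (mask l S) (pattern-at (length l))) D-T)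
          (cong (select (mask T S)) (proj₁ (proj₂ (proj₂ pattern-2))))
        left : select (mask T (i ∷ [])) (p₁ ∷ p₂ ∷ []) ≡ p₁ ∷ []
        left = cong₂ (λ a b → select (a ∷ b ∷ []) (p₁ ∷ p₂ ∷ [])) (⌜⌝-intro (here refl))
          (⌜⌝-false λ { (here refl) → <-irrefl j<i })
        right : select (mask T (j ∷ [])) (p₁ ∷ p₂ ∷ []) ≡ p₂ ∷ []
        right = cong₂ (λ a b → select (a ∷ b ∷ []) (p₁ ∷ p₂ ∷ []))
          (⌜⌝-false λ { (here refl) → <-irrefl j<i }) (⌜⌝-intro (here refl))

      val-A₁ : ∀ {a} → a ∈ A₁ → ∃ λ c → ∀ T → val T ([] , c) ≡ a
      val-A₁ a∈ = case e-A₁ a∈ of λ { (c , eq) → c , λ T → eq (v T []) }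

-- Bounding the number of Lascar types

module Bounding (em : ∀ a → ExcludedMiddle a) (ext : ∀ a b → Extensionality a b)
    {ℓ k : Level} {L : Language ℓ} (𝒦 : AEC L k) (monster : MonsterModel 𝒦)
    (fur : FUR.IsFUR 𝒦 monster) (super : FUR.SuperMonster 𝒦 monster) where
  open Classical em ext
  open Cardinals em ext
  open AECTools em ext
  open Monsters em ext 𝒦 monster fur super
  open MonsterModel monster using (δ; 𝕄; 𝕄∈K; homogeneous)
  open FUR 𝒦 monster using (M; module IsFUR)
  open FUR.SuperMonster super using (𝕄′; 𝕄′∈K; ι)
  module T′ = FUR.Global.T′ 𝒦 monster super
  open AEC 𝒦
  open Strongs 𝒦
  open Stretching em ext 𝒦 monster fur super using (module Hulls)
  open Template em ext 𝒦 using (_⊑_; module Construct)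
  open Automorphism using (to)
  open IsEmbedding
  open T′.InvariantEquivalence using (E)

  ℕ<M′ : ℕ <# M′
  ℕ<M′ = small′ ℕ<δ

  module EquivalenceTools {A′ : List M′} {m : ℕ} (Eq : T′.InvariantEquivalence A′ m) where
    open T′.InvariantEquivalence Eq
    open IsEquivalence isEquivalence public using () renaming (sym to E-sym; trans to E-trans)

    E-resp : ∀ {a a′ b b′} → (∀ i → a i ≡ a′ i) → (∀ i → b i ≡ b′ i) → E Eq a b → E Eq a′ b′
    E-resp p q e = E-trans (equality (sym ∘ p)) (E-trans e (equality q))

    E-act : ∀ σ → (∀ x → x ∈ A′ → to σ x ≡ x) → ∀ {a b} → E Eq a b → E Eq (to σ ∘ a) (to σ ∘ b)
    E-act σ fix = invariant σ (λ {x} → fix x)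

    E-unact : ∀ σ → (∀ x → x ∈ A′ → to σ x ≡ x) → ∀ {a b} → E Eq (to σ ∘ a) (to σ ∘ b) → E Eq a b
    E-unact σ fix e = E-resp (λ i → σ⁻¹σ σ _) (λ i → σ⁻¹σ σ _)
      (E-act (σ ⁻¹) (λ x x∈ → trans (cong (to (σ ⁻¹)) (sym (fix x x∈))) (σ⁻¹σ σ x)) e)

  -- N has a sequence of |𝕄′| points, all of whose pairs look like (p₁ , p₂).  In an amalgam of N
  -- with a model D of representatives, two of these points are equivalent to the same representative.
  module Pigeonhole (A₁ : List M) (m : ℕ) {W : Set} (W↣ℕ : W ↣ ℕ)
      (w : WellOrder M′) (val : List M′ → List M′ × W → M)
      (coherent : ∀ {T T′} → T ⊑ T′ → (l : List (List M′ × W)) → All (λ g → proj₁ g ⊑ T) l →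
        ConjL 𝕄 (map (val T) l) (map (val T′) l))
      (hulls : ∀ {S T} → S ⊑ T → Hull 𝕄 (λ c → val T (S , c)))
      (within : ∀ {S T} → S ⊑ T → ∀ c → ∃ λ c′ → val T (T , c′) ≡ val T (S , c))
      (p₁ p₂ : Fin m → M) (hd : Fin m → W)
      (coordinate : ∀ {i j} → WellOrder._<_ w j i → ∀ c →
        val (i ∷ j ∷ []) (i ∷ [] , hd c) ≡ p₁ c × val (i ∷ j ∷ []) (j ∷ [] , hd c) ≡ p₂ c)
      (val-A₁ : ∀ {a} → a ∈ A₁ → ∃ λ c → ∀ T → val T ([] , c) ≡ a)
      (A′ : List M′) (A′⊆A₁ : ∀ x → x ∈ A′ → x ∈ map ι A₁) (Eq : T′.InvariantEquivalence A′ m) where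
    open T′.InvariantEquivalence Eq using (bounded)
    open EquivalenceTools Eq
    open WellOrder w using (_<_; compare)
    open Hull
    open Construct 𝕄∈K homogeneous (small-countable W↣ℕ) val coherent hulls within

    include-strong′ : ∀ T → Strong (A (H T)) N (include T)
    include-strong′ = include-strong w (ι m₀)

    c : M′ → Fin m → Carrier N
    c i a = [ i ∷ [] , hd a ]
      where open Quotient classes

    -- `D` contains a representative of every class of `Eq`, and `N*` amalgamates it with `N`. Since
    -- `N*` need not embed into `𝕄′`, each argument takes place in a copy of size at most `Z`.
    module Amalgam {Z : Set ℓ} (Z<M′ : Z <# M′) (Z×ℕ↣Z : (Z × ℕ) ↣ Z) (ℕ↣Z : ℕ ↣ Z)
        {D : Structure L} {fD : Carrier D → M′} (sD : Strong D 𝕄′ fD) (D↣Z : Carrier D ↣ Z)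
        {hB : Carrier (A (H [])) → Carrier D} (hB-f : ∀ b → fD (hB b) ≡ ι (f (H []) b))
        {N* : Structure L} {d : Carrier D → Carrier N*} (sd : Strong D N* d)
        {n : Carrier N → Carrier N*} (sn : Strong N N* n)
        (square : ∀ b → d (hB b) ≡ n (include [] b))
        {I₀ : Set ℓ} {reps : I₀ → Fin m → M′} (reps∈D : ∀ i a → ∃ λ d₀ → fD d₀ ≡ reps i a)
        (I₀<M′ : I₀ <# M′) (hits : ∀ a → ∃ λ i → E Eq a (reps i)) where

      ⊎↣Z : ∀ {a b} {X : Set a} {Y : Set b} → X ↣ Z → Y ↣ Z → (X ⊎ Y) ↣ Z
      ⊎↣Z = absorb-⊎ Z×ℕ↣Z (Injection.to ℕ↣Z 0)

      -- A small part of N* containing the family x, copied into 𝕄′ over D.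
      record Copy {X : Set ℓ} (x : X → Carrier N*) : Set (lsuc ℓ ⊔ k) where
        field
          Q    : Structure L
          u    : Carrier Q → Carrier N*
          su   : Strong Q N* u
          v    : Carrier Q → M′
          sv   : Strong Q 𝕄′ v
          at   : ∀ i → ∃ λ q → u q ≡ x i
          over : ∀ d₀ → ∃ λ q → u q ≡ d d₀ × v q ≡ fD d₀
          Q↣Z  : Carrier Q ↣ Z

      abstract
        copy : ∀ {X : Set ℓ} (x : X → Carrier N*) → X ↣ Z → Copy x
        copy {X} x X↣Z =
          case ls (proj₂ (strong-K sd)) {Carrier D ⊎ X} [ d , x ]′ of λ { (Q , u , su , cov , size) →
          case (⊎↣Z (⊎↣Z D↣Z X↣Z) ℕ↣Z ⊚ size) of λ Q↣Z →
          case factor sd su (λ d₀ → cov (inj₁ d₀)) of λ { (h , sh , uh) →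
          case FUR.SuperMonster.universal super Q (proj₁ (strong-K su)) (<#-down Q↣Z Z<M′) of λ { (t , st) →
          case HM′.extend (<#-down D↣Z Z<M′) (transitive sh st) sD of λ { (ρ , ρth) →
            record
            { Q = Q ; u = u ; su = su ; v = to ρ ∘ t ; sv = strong-∘auto st ρ
            ; at = λ i → cov (inj₂ i) ; over = λ d₀ → h d₀ , uh d₀ , ρth d₀ ; Q↣Z = Q↣Z } }}}}

      open Copy

      -- Copies are chosen independently of each other; homogeneity of `𝕄′` matches them wherever
      -- their sources overlap.
      compare-copies : ∀ {X Y : Set ℓ} {x : X → Carrier N*} {y : Y → Carrier N*} (P : Copy x) (P′ : Copy y) →
        (∀ q → ∃ λ q′ → u P′ q′ ≡ u P q) →
        ∃ λ (σ : Automorphism 𝕄′) → ∀ q q′ → u P q ≡ u P′ q′ → to σ (v P q) ≡ v P′ q′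
      compare-copies P P′ sub = case factor (su P) (su P′) sub of λ { (h , sh , uh) →
        case HM′.extend (<#-down (Q↣Z P) Z<M′) (sv P) (transitive sh (sv P′)) of λ { (σ , σv) →
          σ , λ q q′ eq → trans (σv q) (cong (v P′) (injective (embedding (su P′)) (trans (uh q) eq))) } }

      fixes-D : ∀ {X Y : Set ℓ} {x : X → Carrier N*} {y : Y → Carrier N*} (P : Copy x) (P′ : Copy y)
        (σ : Automorphism 𝕄′) → (∀ q q′ → u P q ≡ u P′ q′ → to σ (v P q) ≡ v P′ q′) →
        ∀ d₀ → to σ (fD d₀) ≡ fD d₀
      fixes-D P P′ σ eq d₀ = case over P d₀ of λ { (q , uq , vq) → case over P′ d₀ of λ { (q′ , uq′ , vq′) →
        trans (cong (to σ) (sym vq)) (trans (eq q q′ (trans uq (sym uq′))) vq′) } }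

      A₁∈D : ∀ x → x ∈ A′ → ∃ λ d₀ → fD d₀ ≡ x
      A₁∈D x x∈ = case ∈-map⁻ ι (A′⊆A₁ x x∈) of λ { (a , a∈ , refl) → case val-A₁ a∈ of λ { (γ , eγ) →
        case point {[]} [] γ (λ _ p → p) of λ { (b , fb , _) →
          hB b , trans (hB-f b) (cong ι (trans fb (eγ _))) }}}

      single : ∀ i → Copy {Lift ℓ (Fin m)} (λ a → n (c i (lower a)))
      single i = copy _ (ℕ↣Z ⊚ fin↣ℕ m ⊚ lift↣ ℓ)

      image : M′ → Fin m → M′
      image i a = v (single i) (proj₁ (at (single i) (lift a)))

      class : M′ → I₀
      class i = proj₁ (hits (image i))

      Matches : ∀ {X Y : Set ℓ} {x : X → Carrier N*} {y : Y → Carrier N*} → Copy x → Copy y → Automorphism 𝕄′ → Set ℓ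
      Matches P P′ σ = ∀ q q′ → u P q ≡ u P′ q′ → to σ (v P q) ≡ v P′ q′

      -- `σ` is the identity on `D`, hence on the parameters of `Eq` and on the representative:
      -- transferring the point to the common copy does not change its class.
      to-rep : ∀ {Y : Set ℓ} {y : Y → Carrier N*} (P : Copy y) i σ → Matches (single i) P σ →
        E Eq (to σ ∘ image i) (reps (class i))
      to-rep P i σ σv = E-resp (λ _ → refl)
        (λ a → case reps∈D (class i) a of λ { (d₀ , eq) →
          trans (cong (to σ) (sym eq)) (trans (fixes-D (single i) P σ σv d₀) eq) })
        (E-act σ (λ x x∈ → case A₁∈D x x∈ of λ { (d₀ , eq) →
          trans (cong (to σ) (sym eq)) (trans (fixes-D (single i) P σ σv d₀) eq) })
          (proj₂ (hits (image i))))

      -- `τ` takes the hull of `T` from `𝕄` to its place in the common copy, and with it `p₁` and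
      -- `p₂` to the two chosen points. It fixes the parameters, so the equivalence can be pulled
      -- back to `p₁` and `p₂`.
      module Pair {Y : Set ℓ} {y : Y → Carrier N*} (P : Copy y) (T : List M′)
          (h : Carrier (A (H T)) → Carrier (Q P)) (uh : ∀ x → u P (h x) ≡ n (include T x))
          (τ : Automorphism 𝕄′) (τf : ∀ x → to τ (ι (f (H T) x)) ≡ v P (h x)) where

        τ-point : ∀ i a → i ∷ [] ⊑ T → ∀ {m₁} → val T (i ∷ [] , hd a) ≡ m₁ →
          ∀ σ → Matches (single i) P σ → to σ (image i a) ≡ to τ (ι m₁)
        τ-point i a i⊑T eq σ σv = case point (i ∷ []) (hd a) i⊑T of λ { (x , fx , inc) →
          trans (σv _ (h x) (trans (proj₂ (at (single i) (lift a))) (trans (cong n (sym inc)) (sym (uh x)))))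
            (trans (sym (τf x)) (cong (λ z → to τ (ι z)) (trans fx eq))) }

        τ-fixes : ∀ x → x ∈ A′ → to τ x ≡ x
        τ-fixes x x∈ = case ∈-map⁻ ι (A′⊆A₁ x x∈) of λ { (a , a∈ , refl) → case val-A₁ a∈ of λ { (γ , eγ) →
          case point {T} [] γ (λ _ ()) of λ { (x , fx , inc) →
          case point {[]} [] γ (λ _ ()) of λ { (b , fb , inc′) →
          case over P (hB b) of λ { (q , uq , vq) →
            trans (cong (λ z → to τ (ι z)) (sym (trans fx (eγ _)))) (trans (τf x)
              (trans (cong (v P) (injective (embedding (su P))
                  (trans (uh x) (trans (cong n (trans inc (sym inc′))) (trans (sym (square b)) (sym uq))))))
                (trans vq (trans (hB-f b) (cong ι (trans fb (eγ _))))))) }}}}}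

      identifies-in : ∀ {i j} → j < i → class i ≡ class j →
        ∀ {Y : Set ℓ} {y : Y → Carrier N*} (P : Copy y) →
        (∀ q → ∃ λ q′ → u P q′ ≡ u (single i) q) → (∀ q → ∃ λ q′ → u P q′ ≡ u (single j) q) →
        (∀ x → ∃ λ q′ → u P q′ ≡ n (include (i ∷ j ∷ []) x)) → E Eq (ι ∘ p₁) (ι ∘ p₂)
      identifies-in {i} {j} j<i same P Qi Qj T∈ =
        case factor (transitive (include-strong′ T) sn) (su P) T∈ of λ { (h , sh , uh) →
        case HM′.extend (small′ (small-countable (W↣ℕ ⊚ size (H T)))) (transitive (strong (H T)) ι-strong)
               (transitive sh (sv P)) of λ { (τ , τf) →
        case compare-copies (single i) P Qi of λ { (σ , σv) →
        case compare-copies (single j) P Qj of λ { (σ′ , σ′v) →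
          E-unact τ (Pair.τ-fixes P T h uh τ τf) (E-resp
            (λ a → Pair.τ-point P T h uh τ τf i a (λ _ → λ { (here eq) → here eq }) (proj₁ (coordinate j<i a)) σ σv)
            (λ a → Pair.τ-point P T h uh τ τf j a (λ _ → λ { (here eq) → there (here eq) }) (proj₂ (coordinate j<i a)) σ′ σ′v)
            (E-trans (to-rep P i σ σv)
              (E-sym (E-resp (λ _ → refl) (λ a → cong (λ κ → reps κ a) (sym same)) (to-rep P j σ′ σ′v))))) }}}}
        where
        T = i ∷ j ∷ []

      identifies : ∀ {i j} → j < i → class i ≡ class j → E Eq (ι ∘ p₁) (ι ∘ p₂)
      identifies {i} {j} j<i same =
        identifies-in j<i same P (λ q → at P (inj₁ q)) (λ q → at P (inj₂ (inj₁ q))) (λ x → at P (inj₂ (inj₂ x)))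
        where
        T = i ∷ j ∷ []
        P : Copy {Carrier (Q (single i)) ⊎ (Carrier (Q (single j)) ⊎ Carrier (A (H T)))}
              [ u (single i) , [ u (single j) , (λ x → n (include T x)) ]′ ]′
        P = copy _ (⊎↣Z (Q↣Z (single i)) (⊎↣Z (Q↣Z (single j)) (ℕ↣Z ⊚ W↣ℕ ⊚ size (H T))))

      collision : E Eq (ι ∘ p₁) (ι ∘ p₂)
      collision = case dne noncollision of λ { (i , j , same , i≢j) → order i j same i≢j (compare i j) }
        where
        noncollision : ¬ ¬ ∃₂ λ i j → class i ≡ class j × i ≢ j
        noncollision none = proj₂ I₀<M′ (mk↣ {to = class} λ {i} {j} same → dne λ i≢j → none (i , j , same , i≢j))
        order : ∀ i j → class i ≡ class j → i ≢ j → Tri (i < j) (i ≡ j) (j < i) → E Eq (ι ∘ p₁) (ι ∘ p₂)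
        order i j same i≢j (tri< i<j _ _) = identifies i<j (sym same)
        order i j same i≢j (tri≈ _ eq _) = ⊥-elim (i≢j eq)
        order i j same i≢j (tri> _ _ j<i) = identifies j<i same

    identified : E Eq (ι ∘ p₁) (ι ∘ p₂)
    identified =
      case bounded of λ { (I₀ , I₀<M′ , reps , hits) →
      case absorbing ℕ<M′ I₀<M′ of λ { (Z , Z<M′ , I₀↣Z , Z×ℕ↣Z , ℕ↣Z) →
      case ls 𝕄′∈K {Carrier (A (H [])) ⊎ (I₀ × Lift ℓ (Fin m))}
             [ (λ b → ι (f (H []) b)) , (λ { (i , lift a) → reps i a }) ]′ of λ { (D , fD , sD , cov , sizeD) →
      case (absorb-⊎ Z×ℕ↣Z (Injection.to ℕ↣Z 0)
             (absorb-⊎ Z×ℕ↣Z (Injection.to ℕ↣Z 0) (ℕ↣Z ⊚ W↣ℕ ⊚ size (H []))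
               (Z×ℕ↣Z ⊚ ×↣ I₀↣Z (fin↣ℕ m ⊚ lift↣ ℓ))) ℕ↣Z ⊚ sizeD) of λ D↣Z →
      case factor (transitive (strong (H [])) ι-strong) sD (λ b → cov (inj₁ b)) of λ { (hB , shB , hB-f) →
      -- The common part is the hull of the empty sequence. It contains `A₁`, so the parameters of
      -- `Eq` are the same on both sides.
      case IsFUR.AP fur shB (include-strong′ []) of λ { (N* , d , n , sd , sn , square) →
        Amalgam.collision Z<M′ Z×ℕ↣Z ℕ↣Z sD D↣Z hB-f sd sn square
          {reps = reps} (λ i a → cov (inj₂ (i , lift a))) I₀<M′ hits }}}}}

  SameLascar′ : ∀ {m} → List M → Rel (Fin m → M) (lsuc ℓ)
  SameLascar′ A₁ c d = T′.SameLascar T′.⟨ map ι A₁ ⟩ (ι ∘ c) (ι ∘ d)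

  -- The pair `p₁`, `p₂` is fixed before any `Eq` is given. Every `Eq` over `A₁` identifies it, so
  -- its members have the same Lascar type, against the choice of the pattern.
  few-lascar-types : ∀ (A₁ : List M) m → ∃ λ (J : Set ℓ) → J <# δ ×
    ∃ λ (r : J → Fin m → M) → ∀ c → ∃ λ j → SameLascar′ A₁ c (r j)
  few-lascar-types A₁ m = dne λ many →
    let spread : ∀ {J : Set ℓ} → J <# δ → (f : J → Fin m → M) → ∃ λ p → ∀ j → ¬ SameLascar′ A₁ p (f j)
        spread = λ {J} J<δ f → dne λ none → many (J , J<δ , f , λ c → dne λ bad → none (c , λ j same → bad (j , same)))
    in separated spread
    where
    separated : (∀ {J : Set ℓ} → J <# δ → (f : J → Fin m → M) → ∃ λ p → ∀ j → ¬ SameLascar′ A₁ p (f j)) → ⊥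
    separated spread = p₁≁p₂ λ A′ A′⊆ Eq →
      Pigeonhole.identified A₁ m W↣ℕ w val coherent hulls within p₁ p₂ hd coordinate val-A₁
        A′ (λ x x∈ → All.lookup A′⊆ x∈) Eq
      where
      w = Exhaustion.wellOrder M′
      open Hulls A₁ m
      open Indiscernible (SameLascar′ A₁) spread w

-- Imaginaries, global types and canonical bases

module Bases (em : ∀ a → ExcludedMiddle a) (ext : ∀ a b → Extensionality a b)
    {ℓ k : Level} {L : Language ℓ} (𝒦 : AEC L k) (monster : MonsterModel 𝒦)
    (fur : FUR.IsFUR 𝒦 monster) (super : FUR.SuperMonster 𝒦 monster)
    (Im : FUR.Imaginaries 𝒦 monster) where
  open Classical em ext
  open Cardinals em ext
  open AECTools em ext
  open Monsters em ext 𝒦 monster fur super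
  open MonsterModel monster using (δ; 𝕄)
  open FUR 𝒦 monster using (M; 𝕄-space; module Eq; module Global; module Imaginaries; module IsFUR)
  open FUR.SuperMonster super using (𝕄′; 𝕄′∈K; ι)
  open Global super using (GlobalType; ι[_]; ι[𝕄]; module T′; module CanonicalBases)
  open CanonicalBases Im
  open Eq Im
  open Imaginaries Im using (invariant)
  open Automorphism using (to)
  open Strongs 𝒦 using (Hull; enumerate)
  open Bounding em ext 𝒦 monster fur super using (SameLascar′; few-lascar-types; module EquivalenceTools)
  open Data.Vec.Functional using (toList)
  module Tᵉ = Types 𝕄-eq-space

  open IsEquivalence (Setoid.isEquivalence points) public
    using () renaming (refl to ≈-refl; sym to ≈-sym; trans to ≈-trans; reflexive to ≈-reflexive)

  coords : M-eq → List M
  coords (_ , t) = tabulate t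

  coordsᵛ : ∀ {m} → Vector M-eq m → List M
  coordsᵛ c = concat (tabulate (coords ∘ c))

  coords-∈ : ∀ {m} (c : Vector M-eq m) i {x} → x ∈ coords (c i) → x ∈ coordsᵛ c
  coords-∈ c i x∈ = ∈-concat⁺′ x∈ (∈-tabulate⁺ {f = coords ∘ c} i)

  actᵉ : Automorphism 𝕄 → M-eq → M-eq
  actᵉ σ (s , t) = s , to σ ∘ t

  actᵉ-cong : ∀ σ {x y} → x ≈ᵉᑫ y → actᵉ σ x ≈ᵉᑫ actᵉ σ y
  actᵉ-cong σ (class {e = e} p) = class (invariant e σ p)

  actᵉ-agree : ∀ σ τ x → (∀ y → y ∈ coords x → to σ y ≡ to τ y) → actᵉ σ x ≡ actᵉ τ x
  actᵉ-agree σ τ (s , t) eq = cong (s ,_) (ext _ _ λ i → eq (t i) (∈-tabulate⁺ i))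

  actᵉ-fixed : ∀ σ x → (∀ y → y ∈ coords x → to σ y ≡ y) → actᵉ σ x ≡ x
  actᵉ-fixed σ x eq = actᵉ-agree σ (idᵃ 𝕄) x eq

  actᵉ-inverseˡ : ∀ σ x → actᵉ (σ ⁻¹) (actᵉ σ x) ≡ x
  actᵉ-inverseˡ σ (s , t) = cong (s ,_) (ext _ _ λ i → σ⁻¹σ σ (t i))

  actᵉ-inverseʳ : ∀ σ x → actᵉ σ (actᵉ (σ ⁻¹) x) ≡ x
  actᵉ-inverseʳ σ (s , t) = cong (s ,_) (ext _ _ λ i → σσ⁻¹ σ (t i))

  actᵉ-unfix : ∀ σ {x y} → actᵉ σ x ≈ᵉᑫ y → x ≈ᵉᑫ actᵉ (σ ⁻¹) y
  actᵉ-unfix σ {x} p = ≈-trans (≈-reflexive (sym (actᵉ-inverseˡ σ x))) (actᵉ-cong (σ ⁻¹) p)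

  lift-auto : Automorphism 𝕄 → Automorphism-eq
  lift-auto σ = record
    { bijection = record
      { to = actᵉ σ ; from = actᵉ (σ ⁻¹)
      ; to-cong = actᵉ-cong σ ; from-cong = actᵉ-cong (σ ⁻¹)
      ; inverse = (λ {x} p → ≈-trans (actᵉ-cong σ p) (≈-reflexive (actᵉ-inverseʳ σ x))) ,
                  (λ {x} p → ≈-trans (actᵉ-cong (σ ⁻¹) p) (≈-reflexive (actᵉ-inverseˡ σ x))) }
    ; onM = σ
    ; onM-≈ = λ x → ≈-refl
    ; P-iff = λ e x → mk⇔
        (λ { (a , p) → to σ ∘ a , actᵉ-cong σ p })
        (λ { (a , p) → to (σ ⁻¹) ∘ a , actᵉ-unfix σ p })
    ; F-hom = λ e a → ≈-refl }

  auto-act : ∀ (f : Automorphism-eq) x → Automorphism-eq.to f x ≈ᵉᑫ actᵉ (Automorphism-eq.onM f) x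
  auto-act f ((_ , e) , t) = Automorphism-eq.F-hom f e t

  -- Global types

  -- d realizes over B what b′ realizes over ι(B).
  Follows : ∀ {n} → (Fin n → M′) → List M → (Fin n → M) → Set ℓ
  Follows b′ B d = ∃ λ (τ : Automorphism 𝕄′) → (∀ x → x ∈ B → to τ (ι x) ≡ ι x) × ∀ i → to τ (ι (d i)) ≡ b′ i

  follows-⊆ : ∀ {n} {b′ : Fin n → M′} {B C d} → (∀ x → x ∈ B → x ∈ C) → Follows b′ C d → Follows b′ B d
  follows-⊆ B⊆C (τ , fix , eq) = τ , (λ x x∈ → fix x (B⊆C x x∈)) , eq

  -- Composing one witness with the inverse of the other sends `c` to `d` over `B` within `𝕄`, so it
  -- can be replaced by an automorphism of `𝕄`.
  follows-unique : ∀ {n} {b′ : Fin n → M′} {B c d} → Follows b′ B c → Follows b′ B d →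
    ∃ λ (σ : Automorphism 𝕄) → (∀ x → x ∈ B → to σ x ≡ x) × ∀ i → to σ (c i) ≡ d i
  follows-unique {b′ = b′} {B} {c} {d} (τ , fix , eq) (τ′ , fix′ , eq′) =
    case downL (B ++ˡ tabulate c) ρ in-M of λ { (σ , σρ) → σ ,
      (λ x x∈ → ι-injective (trans (σρ x (∈-++⁺ˡ x∈)) (ρ-B x x∈))) ,
      λ i → ι-injective (trans (σρ (c i) (∈-++⁺ʳ B (∈-tabulate⁺ i))) (ρ-c i)) }
    where
    ρ = τ′ ⁻¹ ∘ᵃ τ
    ρ-B : ∀ x → x ∈ B → to ρ (ι x) ≡ ι x
    ρ-B x x∈ = auto-back τ′ (trans (fix′ x x∈) (sym (fix x x∈)))
    ρ-c : ∀ i → to ρ (ι (c i)) ≡ ι (d i)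
    ρ-c i = auto-back τ′ (trans (eq′ i) (sym (eq i)))
    in-M : ∀ x → x ∈ B ++ˡ tabulate c → ∃ λ m → to ρ (ι x) ≡ ι m
    in-M x x∈ = [ (λ x∈B → x , ρ-B x x∈B) ,
      (λ x∈c → case ∈-tabulate⁻ x∈c of λ { (i , refl) → d i , ρ-c i }) ]′ (∈-++⁻ B x∈)

  follows-move : ∀ {n} {b′ : Fin n → M′} {B c} (σ : Automorphism 𝕄) → (∀ x → x ∈ B → to σ x ≡ x) →
    Follows b′ B c → Follows b′ B (to σ ∘ c)
  follows-move {B = B} {c} σ σ-fix (τ , fix , eq) = case upL (B ++ˡ tabulate c) σ of λ { (σ′ , σ′ι) →
    τ ∘ᵃ σ′ ⁻¹ ,
    (λ x x∈ → trans (cong (to τ) (auto-back σ′ (trans (σ′ι x (∈-++⁺ˡ x∈)) (cong ι (σ-fix x x∈))))) (fix x x∈)) ,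
    λ i → trans (cong (to τ) (auto-back σ′ (σ′ι (c i) (∈-++⁺ʳ B (∈-tabulate⁺ i))))) (eq i) }

  follows-∃ : ∀ {n} (b′ : Fin n → M′) B → ∃ (Follows b′ B)
  follows-∃ b′ B = case pull (elem B) (λ (i : Lift ℓ (Fin _)) → b′ (lower i)) (Elem-small B)
      (small-countable (fin↣ℕ _ ⊚ lift↣ ℓ)) of λ { (σ , fix , into) →
    (λ i → proj₁ (into (lift i))) , σ ⁻¹ ,
    (λ x x∈ → case elem-∈ x∈ of λ { (j , refl) →
      auto-back σ (fix j) }) ,
    λ i → auto-back σ (proj₂ (into (lift i))) }

  module Realization {n} (p : GlobalType n) (b′ : Fin n → M′) (real : GlobalType.Realizes p b′) where

    p⇒follows : ∀ B d → GlobalType.p p B d → Follows b′ B d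
    p⇒follows B d pd = case real B of λ { (c , pc , τ , τ-fix , τc) →
      case GlobalType.galois p B of λ { (c₀ , iff) →
      case to⇔ (iff c) pc of λ { (σ , σ-fix , σc) → case to⇔ (iff d) pd of λ { (ρ , ρ-fix , ρd) →
        subst (Follows b′ B) (ext _ _ λ i → trans (cong (to ρ) (auto-back σ (σc i))) (ρd i))
          (follows-move (ρ ∘ᵃ σ ⁻¹)
            (λ x x∈ → trans (cong (to ρ) (auto-back σ (σ-fix x∈))) (ρ-fix x∈))
            (τ , (λ x x∈ → τ-fix (x , x∈ , refl)) , τc)) }}}}

    follows⇒p : ∀ B d → Follows b′ B d → GlobalType.p p B d
    follows⇒p B d fd = case real B of λ { (c , pc , τ , τ-fix , τc) →
      case GlobalType.galois p B of λ { (c₀ , iff) →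
      case to⇔ (iff c) pc of λ { (σ , σ-fix , σc) →
      case follows-unique (τ , (λ x x∈ → τ-fix (x , x∈ , refl)) , τc) fd of λ { (ρ , ρ-fix , ρc) →
        from⇔ (iff d) (ρ ∘ᵃ σ , (λ x∈ → trans (cong (to ρ) (σ-fix x∈)) (ρ-fix _ x∈)) ,
          λ i → trans (cong (to ρ) (σc i)) (ρc i)) }}}}

    -- No single extension of `σ` fixing `b′` is required: preservation of `p` is tested on one
    -- finite set at a time, and so is the hypothesis.
    fixes-type : ∀ (σ : Automorphism 𝕄) →
      (∀ B → ∃ λ (τ : Automorphism 𝕄′) → (∀ i → to τ (b′ i) ≡ b′ i) × ∀ x → x ∈ B → to τ (ι x) ≡ ι (to σ x)) →
      FixesType (lift-auto σ) p
    fixes-type σ look A B (σB⊆A , A⊆σB) b pb =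
      case p⇒follows B b pb of λ { (τ , τ-fix , τb) → case look B of λ { (ρ , ρb′ , ρB) →
      case upL (B ++ˡ tabulate b) σ of λ { (σ′ , σ′ι) →
        follows⇒p A (to σ ∘ b) (ρ ∘ᵃ τ ∘ᵃ σ′ ⁻¹ ,
          (λ y y∈ → case A⊆σB y∈ of λ { (x , x∈ , refl) →
            trans (cong (to ρ ∘ to τ) (auto-back σ′ (σ′ι x (∈-++⁺ˡ x∈)))) (trans (cong (to ρ) (τ-fix x x∈)) (ρB x x∈)) }) ,
          λ i → trans (cong (to ρ ∘ to τ) (auto-back σ′ (σ′ι (b i) (∈-++⁺ʳ B (∈-tabulate⁺ i)))))
            (trans (cong (to ρ) (τb i)) (ρb′ i))) }}}

    fixed-type-move : ∀ f → FixesType f p → ∀ B d → Follows b′ B d →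
      Follows b′ (map (to (Automorphism-eq.onM f)) B) (to (Automorphism-eq.onM f) ∘ d)
    fixed-type-move f fixes B d fd = p⇒follows _ _ (fixes _ B
      ((λ { (x , x∈ , refl) → ∈-map⁺ _ x∈ }) , λ y∈ → case ∈-map⁻ _ y∈ of λ { (x , x∈ , refl) → x , x∈ , refl })
      d (follows⇒p B d fd))

  All-lift : ∀ {A : Pred M ℓ} {l : List M} → All A l → All ι[ A ] (map ι l)
  All-lift [] = []
  All-lift (p ∷ ps) = (_ , p , refl) ∷ All-lift ps

  -- All that is used of the independence of b′ from 𝕄 over A.
  NonSplitting : ∀ {n} → (Fin n → M′) → List M → Set (lsuc ℓ)
  NonSplitting b′ A₁ = ∀ {m} (c d : Fin m → M) → SameLascar′ A₁ c d →
    ∃ λ (τ : Automorphism 𝕄′) → (∀ i → to τ (b′ i) ≡ b′ i) × ∀ i → to τ (ι (c i)) ≡ ι (d i)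

  indep⇒nonsplitting : ∀ {n} (b′ : Fin n → M′) (A : Pred M ℓ) → T′.Indep b′ ι[ A ] ι[𝕄] →
    ∃ λ A₁ → All A A₁ × NonSplitting b′ A₁
  indep⇒nonsplitting {n} b′ A (A₁′ , A₁′⊆A , extend) =
    case preimage A₁′ A₁′⊆A of λ { (A₁ , A₁⊆A , refl) →
    -- All of `𝕄` counts as bounded in `𝕄′`, so it may serve as the extended parameter set.
    case extend ι[𝕄] (M , FUR.SuperMonster.larger super , ι , id) ι⊆ of λ { (b″ , same , ¬split) →
      A₁ , A₁⊆A , λ {m} c d lt → nonsplit A₁ b″ same ¬split c d lt }}
    where
    ι⊆ : ∀ {x} → ι[ A ] x ⊎ ι[𝕄] x → ι[𝕄] x
    ι⊆ (inj₁ (x , _ , eq)) = x , eq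
    ι⊆ (inj₂ p) = p
    preimage : ∀ l → All ι[ A ] l → ∃ λ l₀ → All A l₀ × map ι l₀ ≡ l
    preimage [] [] = [] , [] , refl
    preimage (_ ∷ l) ((x , p , refl) ∷ ps) = case preimage l ps of λ { (l₀ , qs , refl) → x ∷ l₀ , p ∷ qs , refl }
    nonsplit : ∀ A₁ (b″ : Fin n → M′) → T′.SameType (λ x → ι[ A ] x ⊎ ι[𝕄] x) b″ b′ →
      ¬ T′.LascarSplits b″ ι[𝕄] (map ι A₁) → NonSplitting b′ A₁
    nonsplit A₁ b″ same ¬split {m} c d lt =
      case dne (λ ¬same → ¬split (m , ι ∘ c , ι ∘ d , (λ i → c i , refl) , (λ i → d i , refl) , lt , ¬same)) [] [] of
        λ { (τ , _ , τeq) →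
      -- Non-splitting is known for `b″`; as `b″` and `b′` have the same type over `c` and `d`,
      -- conjugation by `ρ` transfers it.
      case same (map ι (tabulate c ++ˡ tabulate d)) (Allₚ.map⁺ (All.universal (λ x → inj₂ (x , refl)) _)) of
        λ { (ρ , ρ-fix , ρb″) → ρ ∘ᵃ τ ∘ᵃ ρ ⁻¹ ,
          (λ i → trans (cong (to ρ ∘ to τ) (auto-back ρ (ρb″ i))) (trans (cong (to ρ) (left τ τeq i)) (ρb″ i))) ,
          λ i → trans (cong (to ρ ∘ to τ) (auto-back ρ (ρ-fix (∈-map⁺ ι (∈-++⁺ˡ (∈-tabulate⁺ {f = c} i))))))
            (trans (cong (to ρ) (right τ τeq i)) (ρ-fix (∈-map⁺ ι (∈-++⁺ʳ (tabulate c) (∈-tabulate⁺ {f = d} i))))) }}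
      where
      module _ (τ : Automorphism 𝕄′) (τeq : ∀ i → to τ ((b″ ++ᵛ (ι ∘ c)) i) ≡ (b″ ++ᵛ (ι ∘ d)) i) where
        left : ∀ i → to τ (b″ i) ≡ b″ i
        left i = trans (cong (to τ) (sym (lookup-++ˡ b″ (ι ∘ c) i))) (trans (τeq (i ↑ˡ m)) (lookup-++ˡ b″ (ι ∘ d) i))
        right : ∀ i → to τ (ι (c i)) ≡ ι (d i)
        right i = trans (cong (to τ) (sym (lookup-++ʳ b″ (ι ∘ c) i))) (trans (τeq (n ↑ʳ i)) (lookup-++ʳ b″ (ι ∘ d) i))

  -- Lascar equivalence

  lascar-move : ∀ {A₁ : List M} {m} {c d : Fin m → M} (σ : Automorphism 𝕄) → (∀ x → x ∈ A₁ → to σ x ≡ x) →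
    SameLascar′ A₁ c d → SameLascar′ A₁ (to σ ∘ c) (to σ ∘ d)
  lascar-move {A₁} {m} {c} {d} σ fix same A′ A′⊆ Eq = case upL (A₁ ++ˡ (tabulate c ++ˡ tabulate d)) σ of λ { (σ′ , σ′ι) →
    E-resp (λ i → σ′ι (c i) (∈-++⁺ʳ A₁ (∈-++⁺ˡ (∈-tabulate⁺ i))))
           (λ i → σ′ι (d i) (∈-++⁺ʳ A₁ (∈-++⁺ʳ (tabulate c) (∈-tabulate⁺ i))))
      (E-act σ′ (λ x x∈ → case ∈-map⁻ ι (All.lookup A′⊆ x∈) of λ { (a , a∈ , refl) →
          trans (σ′ι a (∈-++⁺ˡ a∈)) (cong ι (fix a a∈)) })
        (same A′ A′⊆ Eq)) }
    where open EquivalenceTools Eq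

  lascar-resp : ∀ {A₁ : List M} {m} {c c′ d d′ : Fin m → M} → (∀ i → c i ≡ c′ i) → (∀ i → d i ≡ d′ i) →
    SameLascar′ A₁ c d → SameLascar′ A₁ c′ d′
  lascar-resp p q same A′ A′⊆ Eq = EquivalenceTools.E-resp Eq (λ i → cong ι (p i)) (λ i → cong ι (q i)) (same A′ A′⊆ Eq)

  lascar-join : ∀ {A₁ : List M} {m} {c d e : Fin m → M} → SameLascar′ A₁ c e → SameLascar′ A₁ d e → SameLascar′ A₁ c d
  lascar-join p q A′ A′⊆ Eq = EquivalenceTools.E-trans Eq (p A′ A′⊆ Eq) (EquivalenceTools.E-sym Eq (q A′ A′⊆ Eq))

  -- Automorphisms fixing the canonical base

  module CanonicalBase {n r} (p : GlobalType n) (b′ : Fin n → M′) (real : GlobalType.Realizes p b′)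
      (α : Vector M-eq r) (canon : IsCanonicalBase α p)
      (A₁ : List M) (nonsplit : NonSplitting b′ A₁) where
    open Realization p b′ real

    fixes-α : ∀ σ → (∀ B → ∃ λ (τ : Automorphism 𝕄′) → (∀ i → to τ (b′ i) ≡ b′ i) ×
                       ∀ x → x ∈ B → to τ (ι x) ≡ ι (to σ x)) →
      ∀ i → actᵉ σ (α i) ≈ᵉᑫ α i
    fixes-α σ look = to⇔ (canon (lift-auto σ)) (fixes-type σ look)

    -- A small family meeting every Lascar type over A₁ of finite tuples of 𝕄, and containing A₁₂.
    module _ (A₁₂ : List M) where
      private
        J : ℕ → Set ℓ
        J m = proj₁ (few-lascar-types A₁ m)

      X : Set ℓ
      X = Σ (Lift ℓ ℕ) (λ m → J (lower m) × Lift ℓ (Fin (lower m))) ⊎ Elem A₁₂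

      X<δ : X <# δ
      X<δ = small-⊎ (small-Σ (small-countable (lift↣ ℓ)) λ m →
        small-× (proj₁ (proj₂ (few-lascar-types A₁ (lower m)))) (small-countable (fin↣ℕ _ ⊚ lift↣ ℓ)))
        (Elem-small A₁₂)

      repr : ∀ m → J m → Fin m → M
      repr m = proj₁ (proj₂ (proj₂ (few-lascar-types A₁ m)))

      x̂ : X → M
      x̂ (inj₁ (lift m , j , lift i)) = repr m j i
      x̂ (inj₂ e) = elem A₁₂ e

      x̂-A₁₂ : ∀ {a} → a ∈ A₁₂ → ∃ λ ξ → x̂ ξ ≡ a
      x̂-A₁₂ a∈ = case elem-∈ a∈ of λ { (e , eq) → inj₂ e , eq }

      -- An automorphism fixing a conjugate of this family over A₁ preserves all Lascar types over A₁, hence p.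
      family-fixes-α : (∀ a → a ∈ A₁ → a ∈ A₁₂) → (s g : Automorphism 𝕄) → (∀ a → a ∈ A₁ → to s a ≡ a) →
        (∀ ξ → to g (to s (x̂ ξ)) ≡ to s (x̂ ξ)) → ∀ i → actᵉ g (α i) ≈ᵉᑫ α i
      family-fixes-α A₁⊆ s g s-fix g-fix = fixes-α g look
        where
        g-A₁ : ∀ a → a ∈ A₁ → to g a ≡ a
        g-A₁ a a∈ = case x̂-A₁₂ (A₁⊆ a a∈) of λ { (ξ , refl) →
          trans (cong (to g) (sym (s-fix _ a∈))) (trans (g-fix ξ) (s-fix _ a∈)) }
        look : ∀ B → ∃ λ (τ : Automorphism 𝕄′) → (∀ i → to τ (b′ i) ≡ b′ i) × ∀ x → x ∈ B → to τ (ι x) ≡ ι (to g x)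
        -- Moving `B` back by `s` finds a representative whose `s`-image has the Lascar type of `B`.
        -- As `g` fixes that image, `B` and its image under `g` have the same Lascar type, and
        -- non-splitting applies.
        look B = case proj₂ (proj₂ (proj₂ (few-lascar-types A₁ (length B)))) (to (s ⁻¹) ∘ lookup B) of λ { (j , same) →
          case lascar-resp (λ i → σσ⁻¹ s (lookup B i)) (λ _ → refl) (lascar-move s s-fix same) of λ same′ →
          case nonsplit (lookup B) (to g ∘ lookup B) (lascar-join same′
                 (lascar-resp (λ _ → refl) (λ i → g-fix (inj₁ (lift (length B) , j , lift i))) (lascar-move g g-A₁ same′)))
            of λ { (τ , τb′ , τB) → τ , τb′ , λ x x∈ → case elem-∈ x∈ of λ { (lift i , refl) → τB i } }}

    -- Chains of conjugates

    module Chain (A₁₂ : List M) (A₁⊆ : ∀ a → a ∈ A₁ → a ∈ A₁₂) where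
      private
        X̂ = X A₁₂
        x = x̂ A₁₂

      Fixes₁₂ : Automorphism 𝕄′ → Set ℓ
      Fixes₁₂ σ = ∀ a → a ∈ A₁₂ → to σ (ι a) ≡ ι a

      -- The conjugating `σ` makes the relation invariant over `A₁₂`. With the family itself in its
      -- place, invariance would hold only over an infinite set.
      Θ : Rel (Fin n → M′) ℓ
      Θ y z = ∃₂ λ (σ g : Automorphism 𝕄′) → Fixes₁₂ σ × (∀ ξ → to g (to σ (ι (x ξ))) ≡ to σ (ι (x ξ))) ×
        ∀ i → to g (y i) ≡ z i

      Θ-sym : ∀ {y z} → Θ y z → Θ z y
      Θ-sym (σ , g , fix , gx , gy) = σ , g ⁻¹ , fix , (λ ξ → auto-back g (gx ξ)) , λ i → auto-back g (gy i)

      Θ-act : ∀ f → Fixes₁₂ f → ∀ {y z} → Θ y z → Θ (to f ∘ y) (to f ∘ z)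
      Θ-act f f-fix {y} (σ , g , fix , gx , gy) = f ∘ᵃ σ , f ∘ᵃ g ∘ᵃ f ⁻¹ ,
        (λ a a∈ → trans (cong (to f) (fix a a∈)) (f-fix a a∈)) ,
        (λ ξ → cong (to f) (trans (cong (to g) (σ⁻¹σ f _)) (gx ξ))) ,
        λ i → cong (to f) (trans (cong (to g) (σ⁻¹σ f (y i))) (gy i))

      private
        -- The extra point is there because `enumerate` needs an inhabited index set.
        V : Set ℓ
        V = X̂ ⊎ (Lift ℓ (Fin n) ⊎ Lift ℓ ⊤)

        family : (Fin n → M′) → V → M′
        family y (inj₁ ξ) = ι (x ξ)
        family y (inj₂ (inj₁ (lift i))) = y i
        family y (inj₂ (inj₂ _)) = ι m₀

        W : Set ℓ
        W = V ⊎ (V ⊎ ℕ)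

        W<δ : W <# δ
        W<δ = small-⊎ V<δ (small-⊎ℕ V<δ)
          where
          V<δ : V <# δ
          V<δ = small-⊎ (X<δ A₁₂) (small-⊎ (small-countable (fin↣ℕ n ⊚ lift↣ ℓ))
            (small-countable (mk↣ {to = λ _ → 0} λ _ → refl)))

        hull : ∀ y → ∃ λ (e : V ⊎ ℕ → M′) → Hull 𝕄′ [ family y , e ]′
        hull y = enumerate (IsFUR.LS≡ω fur) 𝕄′∈K (family y) (inj₂ (inj₂ (lift tt))) ↣-refl

        type-of : (Fin n → M′) → List W → ℕ
        type-of y l = code′ (map [ family y , proj₁ (hull y) ]′ l)

        -- The codes describe an enumerated model around the family and `y`, so equal codes give an
        -- automorphism fixing the whole infinite family. Here the conjugating automorphism is the
        -- identity.
        type-of-sound : ∀ y z → type-of y ≡ type-of z → Θ y z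
        type-of-sound y z eq =
          case HM′.fin⇒conj (small′ W<δ) (proj₂ (hull y)) (proj₂ (hull z)) (λ l → code′-sound (cong (λ t → t l) eq)) of
            λ { (g , gw) → idᵃ 𝕄′ , g , (λ _ _ → refl) , (λ ξ → gw (inj₁ (inj₁ ξ))) ,
                λ i → gw (inj₁ (inj₂ (inj₁ (lift i)))) }

      chains : T′.InvariantEquivalence (map ι A₁₂) n
      chains = record
        { E = Star Θ
        ; isEquivalence = record { refl = ε ; sym = Star.reverse Θ-sym ; trans = _◅◅_ }
        ; equality = λ eq → (idᵃ 𝕄′ , idᵃ 𝕄′ , (λ _ _ → refl) , (λ _ → refl) , eq) ◅ ε
        ; invariant = λ f f-fix → Star.gmap _ (Θ-act f λ a a∈ → f-fix (∈-map⁺ ι a∈))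
        ; bounded = (List W → ℕ) , small′ (small-→ℕ (small-List W<δ)) ,
            proj₁ reps , λ y → type-of y , type-of-sound _ _ (proj₂ reps y) ◅ ε }
        where
        reps = representatives type-of (λ _ → ι m₀)

      module _ (β : List M) (A₁₂⊆β : ∀ a → a ∈ A₁₂ → a ∈ β) (α⊆β : ∀ i y → y ∈ coords (α i) → y ∈ β)
               (b : Fin n → M) where

        -- Whatever looks like y over β is the image of b under an automorphism fixing α and A₁₂.
        Reached : (Fin n → M′) → Set ℓ
        Reached y = ∀ y° → Follows y β y° →
          ∃ λ (h : Automorphism 𝕄) → (∀ i → to h (b i) ≡ y° i) × (∀ i → actᵉ h (α i) ≈ᵉᑫ α i) ×
            ∀ a → a ∈ A₁₂ → to h a ≡ a

        β-fixes-α : ∀ h → (∀ y → y ∈ β → to h y ≡ y) → ∀ i → actᵉ h (α i) ≈ᵉᑫ α i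
        β-fixes-α h fix i = ≈-reflexive (actᵉ-fixed h (α i) λ y y∈ → fix y (α⊆β i y y∈))

        reached-start : ∀ {y} → Follows y β b → Reached y
        reached-start fb y° fy = case follows-unique fb fy of λ { (h , fix , hb) →
          h , hb , β-fixes-α h fix , λ a a∈ → fix a (A₁₂⊆β a a∈) }

        -- The link lives in `𝕄′`. An automorphism `u` over `β` pulls the conjugated family, `y` and
        -- `z` into `𝕄`, where the link becomes `g¹` fixing the image of the family under `s`; so
        -- `g¹` fixes `α`. Finally `k` exchanges the pulled `z` for the given `z°` over `β`.
        reached-step : ∀ {y z} → Θ y z → Reached y → Reached z
        reached-step {y} {z} (σ , g , fix , gx , gy) reached-y z° fz =
          case pull (elem β) targets (Elem-small β) targets-small of λ { (u , u-fix , into) → go u u-fix into }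
          where
          targets : X̂ ⊎ (Lift ℓ (Fin n) ⊎ Lift ℓ (Fin n)) → M′
          targets = [ (λ ξ → to σ (ι (x ξ))) , [ y ∘ lower , z ∘ lower ]′ ]′
          targets-small : (X̂ ⊎ (Lift ℓ (Fin n) ⊎ Lift ℓ (Fin n))) <# δ
          targets-small = small-⊎ (X<δ A₁₂) (small-⊎ n<δ n<δ)
            where n<δ = small-countable (fin↣ℕ n ⊚ lift↣ ℓ)
          go : ∀ u → (∀ e → to u (ι (elem β e)) ≡ ι (elem β e)) → (∀ t → ∃ λ m → to u (targets t) ≡ ι m) →
            ∃ λ (h : Automorphism 𝕄) → (∀ i → to h (b i) ≡ z° i) × (∀ i → actᵉ h (α i) ≈ᵉᑫ α i) ×
              ∀ a → a ∈ A₁₂ → to h a ≡ a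
          go u u-fix into =
            case reached-y y¹ (u ⁻¹ , (λ e e∈ → auto-back u (u-β e e∈)) , λ i → auto-back u (uy i)) of λ { (h , hb , hα , h-fix) →
            case down [ x¹ , y¹ ∘ lower ]′ (small-⊎ (X<δ A₁₂) (small-countable (fin↣ℕ n ⊚ lift↣ ℓ))) (u ∘ᵃ g ∘ᵃ u ⁻¹)
                   (λ { (inj₁ ξ) → x¹ ξ , gx¹ ξ ; (inj₂ (lift i)) → z¹ i , gy¹ i }) of λ { (g¹ , g¹-eq) →
            case down x (X<δ A₁₂) (u ∘ᵃ σ) (λ ξ → x¹ ξ , ux ξ) of λ { (s , s-eq) →
            case follows-unique (u ⁻¹ , (λ e e∈ → auto-back u (u-β e e∈)) , λ i → auto-back u (uz i)) fz of λ { (k , k-fix , kz) →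
              k ∘ᵃ g¹ ∘ᵃ h ,
              (λ i → trans (cong (to k ∘ to g¹) (hb i)) (trans (cong (to k)
                (ι-injective (trans (g¹-eq (inj₂ (lift i))) (gy¹ i)))) (kz i))) ,
              (λ i → ≈-trans (actᵉ-cong k (≈-trans (actᵉ-cong g¹ (hα i)) (g¹α s g¹ s-eq (g¹-x g¹ g¹-eq) i)))
                (β-fixes-α k k-fix i)) ,
              λ a a∈ → trans (cong (to k ∘ to g¹) (h-fix a a∈)) (trans (cong (to k) (g¹-A s g¹ s-eq (g¹-x g¹ g¹-eq) a a∈))
                (k-fix a (A₁₂⊆β a a∈))) }}}}
            where
            x¹ : X̂ → M
            x¹ ξ = proj₁ (into (inj₁ ξ))
            y¹ z¹ : Fin n → M
            y¹ i = proj₁ (into (inj₂ (inj₁ (lift i))))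
            z¹ i = proj₁ (into (inj₂ (inj₂ (lift i))))
            ux : ∀ ξ → to u (to σ (ι (x ξ))) ≡ ι (x¹ ξ)
            ux ξ = proj₂ (into (inj₁ ξ))
            uy : ∀ i → to u (y i) ≡ ι (y¹ i)
            uy i = proj₂ (into (inj₂ (inj₁ (lift i))))
            uz : ∀ i → to u (z i) ≡ ι (z¹ i)
            uz i = proj₂ (into (inj₂ (inj₂ (lift i))))
            u-β : ∀ e → e ∈ β → to u (ι e) ≡ ι e
            u-β e e∈ = case elem-∈ e∈ of λ { (j , refl) → u-fix j }
            gx¹ : ∀ ξ → to (u ∘ᵃ g ∘ᵃ u ⁻¹) (ι (x¹ ξ)) ≡ ι (x¹ ξ)
            gx¹ ξ = trans (cong (to u ∘ to g) (auto-back u (ux ξ))) (trans (cong (to u) (gx ξ)) (ux ξ))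
            gy¹ : ∀ i → to (u ∘ᵃ g ∘ᵃ u ⁻¹) (ι (y¹ i)) ≡ ι (z¹ i)
            gy¹ i = trans (cong (to u ∘ to g) (auto-back u (uy i))) (trans (cong (to u) (gy i)) (uz i))
            g¹-x : ∀ g¹ → (∀ t → ι (to g¹ ([ x¹ , y¹ ∘ lower {ℓ = ℓ} ]′ t)) ≡ to (u ∘ᵃ g ∘ᵃ u ⁻¹) (ι ([ x¹ , y¹ ∘ lower ]′ t))) →
              ∀ ξ → to g¹ (x¹ ξ) ≡ x¹ ξ
            g¹-x g¹ g¹-eq ξ = ι-injective (trans (g¹-eq (inj₁ ξ)) (gx¹ ξ))
            module _ (s g¹ : Automorphism 𝕄) (s-eq : ∀ ξ → ι (to s (x ξ)) ≡ to (u ∘ᵃ σ) (ι (x ξ)))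
                     (g¹-x : ∀ ξ → to g¹ (x¹ ξ) ≡ x¹ ξ) where
              s-x : ∀ ξ → to s (x ξ) ≡ x¹ ξ
              s-x ξ = ι-injective (trans (s-eq ξ) (ux ξ))
              s-A : ∀ a → a ∈ A₁₂ → to s a ≡ a
              s-A a a∈ = case x̂-A₁₂ A₁₂ a∈ of λ { (ξ , refl) →
                ι-injective (trans (s-eq ξ) (trans (cong (to u) (fix _ a∈)) (u-β _ (A₁₂⊆β _ a∈)))) }
              g¹α : ∀ i → actᵉ g¹ (α i) ≈ᵉᑫ α i
              g¹α = family-fixes-α A₁₂ A₁⊆ s g¹ (λ a a∈ → s-A a (A₁⊆ a a∈))
                λ ξ → trans (cong (to g¹) (s-x ξ)) (trans (g¹-x ξ) (sym (s-x ξ)))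
              g¹-A : ∀ a → a ∈ A₁₂ → to g¹ a ≡ a
              g¹-A a a∈ = case x̂-A₁₂ A₁₂ a∈ of λ { (ξ , refl) →
                trans (cong (to g¹) (trans (sym (s-A _ a∈)) (s-x ξ))) (trans (g¹-x ξ) (trans (sym (s-x ξ)) (s-A _ a∈))) }

        reached-chain : ∀ {y z} → Star Θ y z → Reached y → Reached z
        reached-chain ε reached = reached
        reached-chain (θ ◅ θs) reached = reached-chain θs (reached-step θ reached)

    moves : (A : Pred M ℓ) → All A A₁ → (a : Fin n → M) → T′.SameLascar ι[ A ] b′ (ι ∘ a) →
      ∀ A₂ → All A A₂ → ∀ b → Follows b′ ((A₁ ++ˡ A₂) ++ˡ coordsᵛ α) b →
      ∃ λ (h : Automorphism 𝕄) → (∀ i → to h (b i) ≡ a i) × (∀ i → actᵉ h (α i) ≈ᵉᑫ α i) × ∀ x → x ∈ A₂ → to h x ≡ x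
    moves A A₁⊆A a lascar A₂ A₂⊆A b fb =
      case reached-chain β (λ _ → ∈-++⁺ˡ) α⊆β b
             (lascar (map ι A₁₂) (All-lift (Allₚ.++⁺ A₁⊆A A₂⊆A)) chains)
             (reached-start β (λ _ → ∈-++⁺ˡ) α⊆β b fb)
             -- At the end of the chain `a` already lies in `𝕄` and follows itself.
             a (idᵃ 𝕄′ , (λ _ _ → refl) , λ _ → refl) of λ { (h , hb , hα , h-fix) →
        h , hb , hα , λ x x∈ → h-fix x (∈-++⁺ʳ A₁ x∈) }
      where
      A₁₂ = A₁ ++ˡ A₂
      β = A₁₂ ++ˡ coordsᵛ α
      α⊆β : ∀ i y → y ∈ coords (α i) → y ∈ β
      α⊆β i y y∈ = ∈-++⁺ʳ A₁₂ (coords-∈ α i y∈)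
      open Chain A₁₂ (λ _ → ∈-++⁺ˡ)

  tabulate-split : ∀ {a b m} {A : Set a} {B : Set b} {s : A → B} (t : Fin m → A) (t′ : Fin m → B) {l l′} →
    map s (tabulate t ++ˡ l) ≡ tabulate t′ ++ˡ l′ → (∀ i → s (t i) ≡ t′ i) × map s l ≡ l′
  tabulate-split {m = zero} t t′ eq = (λ ()) , eq
  tabulate-split {m = suc m} t t′ eq =
    case tabulate-split (t ∘ fsuc) (t′ ∘ fsuc) (proj₂ (∷-injective eq)) of λ { (eqs , rest) →
      (λ { fzero → proj₁ (∷-injective eq) ; (fsuc i) → eqs i }) , rest }

  tabulate-injective : ∀ {a m} {A : Set a} {t t′ : Fin m → A} → tabulate t ≡ tabulate t′ → ∀ i → t i ≡ t′ i
  tabulate-injective eq fzero = proj₁ (∷-injective eq)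
  tabulate-injective eq (fsuc i) = tabulate-injective (proj₂ (∷-injective eq)) i

  -- Equal sorts have equally many coordinates, so an equality of concatenated lists can be cut
  -- where each imaginary ends.
  coordsᵛ-split : ∀ {m} σ (c d : Vector M-eq m) → (∀ j → proj₁ (c j) ≡ proj₁ (d j)) → ∀ {l l′} →
    map (to σ) (coordsᵛ c ++ˡ l) ≡ coordsᵛ d ++ˡ l′ → (∀ j → actᵉ σ (c j) ≡ d j) × map (to σ) l ≡ l′
  coordsᵛ-split {zero} σ c d sorts eq = (λ ()) , eq
  coordsᵛ-split {suc m} σ c d sorts {l} {l′} eq = go (c fzero) (d fzero) (sorts fzero)
    (trans (cong (map (to σ)) (sym (++-assoc (coords (c fzero)) _ l))) (trans eq (++-assoc (coords (d fzero)) _ l′)))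
    refl refl
    where
    go : ∀ x y → proj₁ x ≡ proj₁ y →
      map (to σ) (coords x ++ˡ (coordsᵛ (c ∘ fsuc) ++ˡ l)) ≡ coords y ++ˡ (coordsᵛ (d ∘ fsuc) ++ˡ l′) →
      c fzero ≡ x → d fzero ≡ y → (∀ j → actᵉ σ (c j) ≡ d j) × map (to σ) l ≡ l′
    go (s , t) (.s , t′) refl eq p q =
      case tabulate-split t t′ eq of λ { (tt′ , rest) →
      case coordsᵛ-split σ (c ∘ fsuc) (d ∘ fsuc) (sorts ∘ fsuc) rest of λ { (eqs , rest′) →
        (λ { fzero → trans (cong (actᵉ σ) p) (trans (cong (s ,_) (ext _ _ tt′)) (sym q)) ; (fsuc j) → eqs j }) , rest′ } }

  ∈-toList : ∀ {m} (v : Vector M-eq m) i → Tᵉ.⟨ toList v ⟩ (v i)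
  ∈-toList v i = Anyₚ.tabulate⁺ i ≈-refl

  toList-∈ : ∀ {m} (v : Vector M-eq m) {x} → Tᵉ.⟨ toList v ⟩ x → ∃ λ i → x ≈ᵉᑫ v i
  toList-∈ v = Anyₚ.tabulate⁻

  act-fixes : ∀ σ {x y} → x ≈ᵉᑫ y → actᵉ σ y ≈ᵉᑫ y → actᵉ σ x ≈ᵉᑫ x
  act-fixes σ p q = ≈-trans (actᵉ-cong σ p) (≈-trans q (≈-sym p))

  -- Independence over the canonical base

  module Independence {n r} (p : GlobalType n) (b′ : Fin n → M′) (real : GlobalType.Realizes p b′)
      (α : Vector M-eq r) (canon : IsCanonicalBase α p) where
    open Realization p b′ real

    Carries : (Fin n → M) → ∀ {m} → Vector M-eq m → Vector M-eq m → Automorphism 𝕄 → Set ℓ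
    Carries b c d σ = (∀ i → to σ (b i) ≡ b i) × (∀ i → actᵉ σ (α i) ≈ᵉᑫ α i) × (∀ j → actᵉ σ (c j) ≈ᵉᑫ d j)

    Covers : ∀ {m} → List M → Vector M-eq m → Set ℓ
    Covers B c = ∀ x → x ∈ coordsᵛ c → x ∈ B

    covers-fixes : ∀ {m B} (c : Vector M-eq m) → Covers B c → ∀ σ → (∀ x → x ∈ B → to σ x ≡ x) →
      ∀ j → actᵉ σ (c j) ≈ᵉᑫ c j
    covers-fixes c B⊇c σ fix j = ≈-reflexive (actᵉ-fixed σ (c j) λ y y∈ → fix y (B⊇c y (coords-∈ c j y∈)))

    -- c and d have the same type over α and some, equivalently any, realization of p over c, d and α.
    Alike : ∀ {m} → Rel (Vector M-eq m) ℓ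
    Alike c d = ∀ B b → Covers B c → Covers B d → Covers B α → Follows b′ B b → ∃ (Carries b c d)

    carries-sym : ∀ {b m} (c d : Vector M-eq m) σ → Carries b c d σ → Carries b d c (σ ⁻¹)
    carries-sym c d σ (σb , σα , σc) = (λ i → auto-back σ (σb i)) ,
      (λ i → ≈-sym (actᵉ-unfix σ (σα i))) , λ j → ≈-sym (actᵉ-unfix σ (σc j))

    carries-trans : ∀ {b m} (c d e : Vector M-eq m) σ τ → Carries b c d σ → Carries b d e τ → Carries b c e (τ ∘ᵃ σ)
    carries-trans c d e σ τ (σb , σα , σc) (τb , τα , τd) = (λ i → trans (cong (to τ) (σb i)) (τb i)) ,
      (λ i → ≈-trans (actᵉ-cong τ (σα i)) (τα i)) , λ j → ≈-trans (actᵉ-cong τ (σc j)) (τd j)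

    -- Two realizations of `p` over `B` are conjugate over `B`; conjugation preserves the effect on
    -- `c`, `d` and `α`, whose coordinates lie in `B`.
    carries-change : ∀ {b b₁ m B} (c d : Vector M-eq m) → Covers B c → Covers B d → Covers B α →
      Follows b′ B b₁ → Follows b′ B b → ∃ (Carries b₁ c d) → ∃ (Carries b c d)
    carries-change c d B⊇c B⊇d B⊇α fb₁ fb (σ , σb , σα , σc) =
      case follows-unique fb₁ fb of λ { (κ , fix , κb) → κ ∘ᵃ σ ∘ᵃ κ ⁻¹ ,
        (λ i → trans (cong (to κ ∘ to σ) (auto-back κ (κb i))) (trans (cong (to κ) (σb i)) (κb i))) ,
        (λ i → ≈-trans (actᵉ-cong κ (≈-trans (actᵉ-cong σ (covers-fixes α B⊇α (κ ⁻¹) (fix⁻¹ κ fix) i)) (σα i)))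
                 (covers-fixes α B⊇α κ fix i)) ,
        λ j → ≈-trans (actᵉ-cong κ (≈-trans (actᵉ-cong σ (covers-fixes c B⊇c (κ ⁻¹) (fix⁻¹ κ fix) j)) (σc j)))
                 (covers-fixes d B⊇d κ fix j) }
      where
      fix⁻¹ : ∀ {B} κ → (∀ x → x ∈ B → to κ x ≡ x) → ∀ x → x ∈ B → to (κ ⁻¹) x ≡ x
      fix⁻¹ κ fix x x∈ = auto-back κ (fix x x∈)

    -- The two hypotheses need a common realization over the middle tuple as well; the result is
    -- then transferred to the given one.
    alike-trans : ∀ {m} {c d e : Vector M-eq m} → Alike c d → Alike d e → Alike c e
    alike-trans {c = c} {d} {e} p q B b B⊇c B⊇e B⊇α fb =
      case follows-∃ b′ (B ++ˡ coordsᵛ d) of λ { (b⁺ , fb⁺) →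
      case p (B ++ˡ coordsᵛ d) b⁺ (λ x → ∈-++⁺ˡ ∘ B⊇c x) (λ x → ∈-++⁺ʳ B) (λ x → ∈-++⁺ˡ ∘ B⊇α x) fb⁺ of λ { (σ , σ-carries) →
      case q (B ++ˡ coordsᵛ d) b⁺ (λ x → ∈-++⁺ʳ B) (λ x → ∈-++⁺ˡ ∘ B⊇e x) (λ x → ∈-++⁺ˡ ∘ B⊇α x) fb⁺ of λ { (τ , τ-carries) →
        carries-change c e B⊇c B⊇e B⊇α (follows-⊆ (λ x → ∈-++⁺ˡ) fb⁺) fb (τ ∘ᵃ σ , carries-trans c d e σ τ σ-carries τ-carries) }}}

    -- This is where canonicity enters: fixing `α`, the automorphism preserves `p`, so it sends a
    -- realization of `p` over a finite set to one over the image of that set.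
    alike-act : ∀ f → (∀ i → Automorphism-eq.to f (α i) ≈ᵉᑫ α i) → ∀ {m} {c d : Vector M-eq m} →
      Alike c d → Alike (Automorphism-eq.to f ∘ c) (Automorphism-eq.to f ∘ d)
    alike-act f fα {m} {c} {d} alike B b B⊇fc B⊇fd B⊇α fb =
      case follows-∃ b′ B₁ of λ { (b₁ , fb₁) →
      case alike B₁ b₁ (λ x → ∈-++⁺ˡ) (λ x → ∈-++⁺ʳ (coordsᵛ c) ∘ ∈-++⁺ˡ)
             (λ x → ∈-++⁺ʳ (coordsᵛ c) ∘ ∈-++⁺ʳ (coordsᵛ d) ∘ ∈-++⁺ˡ) fb₁ of λ { (ρ , ρb , ρα , ρc) →
        carries-change (Automorphism-eq.to f ∘ c) (Automorphism-eq.to f ∘ d) B⊇fc B⊇fd B⊇α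
          (follows-⊆ B⊆σB₁ (fixed-type-move f (from⇔ (canon f) fα) B₁ b₁ fb₁)) fb
          (σ ∘ᵃ ρ ∘ᵃ σ ⁻¹ ,
           (λ i → cong (to σ) (trans (cong (to ρ) (σ⁻¹σ σ (b₁ i))) (ρb i))) ,
           (λ i → ≈-trans (actᵉ-cong σ (≈-trans (actᵉ-cong ρ (≈-sym (actᵉ-unfix σ (σα i)))) (ρα i))) (σα i)) ,
           λ j → ≈-trans (actᵉ-cong σ (≈-trans (actᵉ-cong ρ (≈-sym (actᵉ-unfix σ (≈-sym (auto-act f (c j)))))) (ρc j)))
                   (≈-sym (auto-act f (d j)))) }}
      where
      σ = Automorphism-eq.onM f
      -- The preimage of `B` is included so that the image of `B₁` covers `B`.
      B₁ = coordsᵛ c ++ˡ (coordsᵛ d ++ˡ (coordsᵛ α ++ˡ map (to (σ ⁻¹)) B))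
      σα : ∀ i → actᵉ σ (α i) ≈ᵉᑫ α i
      σα i = ≈-trans (≈-sym (auto-act f (α i))) (fα i)
      B⊆σB₁ : ∀ x → x ∈ B → x ∈ map (to σ) B₁
      B⊆σB₁ x x∈ = subst (_∈ map (to σ) B₁) (σσ⁻¹ σ x) (∈-map⁺ (to σ)
        (∈-++⁺ʳ (coordsᵛ c) (∈-++⁺ʳ (coordsᵛ d) (∈-++⁺ʳ (coordsᵛ α) (∈-map⁺ (to (σ ⁻¹)) x∈)))))

    alike-bounded : ∀ {m} (type-of : Vector M-eq m → ℕ × ℕ) → (∀ c d → type-of c ≡ type-of d → Alike c d) →
      Tᵉ.InvariantEquivalence (toList α) m
    alike-bounded type-of type-of-sound = record
      { E = Alike
      ; isEquivalence = record
        { refl = λ _ _ _ _ _ _ → idᵃ 𝕄 , (λ _ → refl) , (λ _ → ≈-refl) , λ _ → ≈-refl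
        ; sym = λ alike B b B⊇c B⊇d B⊇α fb → case alike B b B⊇d B⊇c B⊇α fb of λ { (σ , carries) →
            σ ⁻¹ , carries-sym _ _ σ carries }
        ; trans = alike-trans }
      ; equality = λ eq _ _ _ _ _ _ → idᵃ 𝕄 , (λ _ → refl) , (λ _ → ≈-refl) , eq
      ; invariant = λ f f-fix → alike-act f (λ i → f-fix (∈-toList α i))
      ; bounded = Lift ℓ (ℕ × ℕ) , small-countable (countable-× ↣-refl ↣-refl ⊚ lift↣ ℓ) ,
          (λ t → proj₁ reps (lower t)) , λ c → lift (type-of c) , type-of-sound c _ (proj₂ reps c) }
      where
      reps = representatives type-of (λ _ → ι₌ m₀)

    module Few (m : ℕ) where
      private
        sorts : List Sort ↣ ℕ
        sorts = countable-List (Imaginaries.countable Im)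

        params : Vector M-eq m → List M
        params c = coordsᵛ c ++ˡ coordsᵛ α

        b̂ : Vector M-eq m → Fin n → M
        b̂ c = proj₁ (follows-∃ b′ (params c))

        b̂-follows : ∀ c → Follows b′ (params c) (b̂ c)
        b̂-follows c = proj₂ (follows-∃ b′ (params c))

        -- The list of coordinates forgets which equivalence relations are meant and where one
        -- imaginary ends. The sorts restore this, and countability of the collection keeps the
        -- count countable.
        type-of : Vector M-eq m → ℕ × ℕ
        type-of c = Injection.to sorts (tabulate (proj₁ ∘ c)) , code (tabulate (b̂ c) ++ˡ (coordsᵛ c ++ˡ (coordsᵛ α ++ˡ [])))

        alike-from : ∀ c d σ → (∀ i → to σ (b̂ c i) ≡ b̂ d i) → (∀ j → actᵉ σ (c j) ≡ d j) →
          (∀ i → actᵉ σ (α i) ≡ α i) → Alike c d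
        alike-from c d σ σb σc σα B b B⊇c B⊇d B⊇α fb =
          case follows-unique (follows-⊆ (params-⊆ c B⊇c) fb) (b̂-follows c) of λ { (κ , κ-fix , κb) →
          case follows-unique (b̂-follows d) (follows-⊆ (params-⊆ d B⊇d) fb) of λ { (μ , μ-fix , μb) →
            μ ∘ᵃ σ ∘ᵃ κ ,
            (λ i → trans (cong (to μ ∘ to σ) (κb i)) (trans (cong (to μ) (σb i)) (μb i))) ,
            (λ i → ≈-trans (actᵉ-cong μ (≈-trans (actᵉ-cong σ (covers-fixes α (λ x → ∈-++⁺ʳ (coordsᵛ c)) κ κ-fix i))
                     (≈-reflexive (σα i)))) (covers-fixes α (λ x → ∈-++⁺ʳ (coordsᵛ d)) μ μ-fix i)) ,
            λ j → ≈-trans (actᵉ-cong μ (≈-trans (actᵉ-cong σ (covers-fixes c (λ x → ∈-++⁺ˡ) κ κ-fix j))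
                     (≈-reflexive (σc j)))) (covers-fixes d (λ x → ∈-++⁺ˡ) μ μ-fix j) }}
          where
          params-⊆ : ∀ c → Covers B c → ∀ x → x ∈ params c → x ∈ B
          params-⊆ c B⊇c x x∈ = [ B⊇c x , B⊇α x ]′ (∈-++⁻ (coordsᵛ c) x∈)

        type-of-sound : ∀ c d → type-of c ≡ type-of d → Alike c d
        type-of-sound c d eq = case code-sound (cong proj₂ eq) of λ { (σ , σeq) →
          case tabulate-split (b̂ c) (b̂ d) σeq of λ { (σb , rest) →
          case coordsᵛ-split σ c d same-sorts rest of λ { (σc , rest′) →
          case coordsᵛ-split σ α α (λ _ → refl) rest′ of λ { (σα , _) → alike-from c d σ σb σc σα }}}}
          where
          same-sorts : ∀ j → proj₁ (c j) ≡ proj₁ (d j)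
          same-sorts = tabulate-injective (Injection.injective sorts (cong proj₁ eq))

      alike-invariant : Tᵉ.InvariantEquivalence (toList α) m
      alike-invariant = alike-bounded type-of type-of-sound

    -- The finite set witnessing independence is `α`. One realization `b` of `p` serves both facts:
    -- it is taken over `A`, `A₁`, the coordinates of `α` and those of representatives of `D`.
    indep : (A : Pred M ℓ) → Types.Bounded 𝕄-space A → (a : Fin n → M) →
      T′.SameLascar ι[ A ] b′ (ι ∘ a) →
      (A₁ : List M) → All A A₁ → NonSplitting b′ A₁ → a ↓[ α ] A
    indep A (J , J<δ , s , A⊆s) a lascar A₁ A₁⊆A nonsplit =
      toList α , All.tabulate (λ x∈ → case toList-∈ α (Any.map ≈-reflexive x∈) of λ { (i , x≈) → i , ≈-sym x≈ }) ,
      λ { D (K , K<δ , t , D⊆t) params⊆D →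
        case pull (family K t) (b′ ∘ lower) (family-small {K} {t} K<δ) (small-countable (fin↣ℕ n ⊚ lift↣ ℓ)) of λ { (u , fix , into) →
        case (λ B (B⊆ : ∀ x → x ∈ B → ∃ λ ξ → family K t ξ ≡ x) → u ⁻¹ ,
                (λ x x∈ → case B⊆ x x∈ of λ { (ξ , refl) → auto-back u (fix ξ) }) ,
                λ i → auto-back u (proj₂ (into (lift i)))) of λ follows →
          (λ i → ι₌ (proj₁ (into (lift i)))) ,
          same-type {K} {t} (λ i → proj₁ (into (lift i))) follows ,
          ¬splits {K} {t} (λ i → proj₁ (into (lift i))) follows D⊆t }}
      where
      β = A₁ ++ˡ coordsᵛ α

      Index : (K : Set ℓ) → (K → M-eq) → Set ℓ
      Index K t = J ⊎ (Elem β ⊎ Σ K λ κ → Elem (coords (t κ)))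

      family : ∀ K (t : K → M-eq) → Index K t → M
      family K t (inj₁ j) = s j
      family K t (inj₂ (inj₁ e)) = elem β e
      family K t (inj₂ (inj₂ (κ , e))) = elem (coords (t κ)) e

      family-small : ∀ {K t} → K <# δ → Index K t <# δ
      family-small {K} {t} K<δ = small-⊎ J<δ (small-⊎ (Elem-small β) (small-Σ K<δ λ κ → Elem-small (coords (t κ))))

      module _ {K : Set ℓ} {t : K → M-eq} (b : Fin n → M)
          (follows : ∀ B → (∀ x → x ∈ B → ∃ λ ξ → family K t ξ ≡ x) → Follows b′ B b) where

        in-A : ∀ {x} → A x → ∃ λ ξ → family K t ξ ≡ x
        in-A ax = case A⊆s ax of λ { (j , eq) → inj₁ j , eq }

        in-β : ∀ {x} → x ∈ β → ∃ λ ξ → family K t ξ ≡ x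
        in-β x∈ = case elem-∈ x∈ of λ { (e , eq) → inj₂ (inj₁ e) , eq }

        in-t : ∀ {x} κ → x ∈ coords (t κ) → ∃ λ ξ → family K t ξ ≡ x
        in-t κ x∈ = case elem-∈ x∈ of λ { (e , eq) → inj₂ (inj₂ (κ , e)) , eq }

        Parameter : Pred M-eq ℓ
        Parameter x = (∃ λ i → α i ≈ᵉᑫ x) ⊎ embed A x

        -- Members of `α` are fixed by every automorphism that `moves` supplies; only the real
        -- parameters, collected in `A₂`, have to be passed to it.
        real-part : ∀ l → All Parameter l → ∃ λ A₂ → All A A₂ ×
          All (λ x → (∃ λ i → α i ≈ᵉᑫ x) ⊎ ∃ λ y → y ∈ A₂ × x ≈ᵉᑫ ι₌ y) l
        real-part [] [] = [] , [] , []
        real-part (x ∷ l) (q ∷ qs) = case real-part l qs of λ { (A₂ , A₂⊆A , ps) → add q A₂⊆A ps }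
          where
          add : ∀ {A₂} → Parameter x → All A A₂ → All (λ x → (∃ λ i → α i ≈ᵉᑫ x) ⊎ ∃ λ y → y ∈ A₂ × x ≈ᵉᑫ ι₌ y) l →
            ∃ λ A₂ → All A A₂ × All (λ x → (∃ λ i → α i ≈ᵉᑫ x) ⊎ ∃ λ y → y ∈ A₂ × x ≈ᵉᑫ ι₌ y) (x ∷ l)
          add {A₂} (inj₁ q) A₂⊆A ps = A₂ , A₂⊆A , inj₁ q ∷ ps
          add {A₂} (inj₂ (y , ay , x≈)) A₂⊆A ps = y ∷ A₂ , ay ∷ A₂⊆A ,
            inj₂ (y , here refl , x≈) ∷ All.map (λ { (inj₁ q) → inj₁ q ; (inj₂ (z , z∈ , z≈)) → inj₂ (z , there z∈ , z≈) }) ps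

        same-type : Tᵉ.SameType Parameter (ι₌ ∘ b) (ι₌ ∘ a)
        same-type l l⊆ = case real-part l l⊆ of λ { (A₂ , A₂⊆A , ps) →
          case CanonicalBase.moves p b′ real α canon A₁ nonsplit A A₁⊆A a lascar A₂ A₂⊆A b
                 (follows _ λ x x∈ → [ (λ q → [ (λ q′ → in-β (∈-++⁺ˡ q′)) , (λ q′ → in-A (All.lookup A₂⊆A q′)) ]′ (∈-++⁻ A₁ q)) ,
                                       (λ q → in-β (∈-++⁺ʳ A₁ q)) ]′ (∈-++⁻ (A₁ ++ˡ A₂) x∈)) of λ { (h , hb , hα , h-fix) →
            lift-auto h ,
            (λ {x} x∈ → fixed h hα h-fix (All.lookupAny ps x∈)) ,
            λ i → ≈-reflexive (cong ι₌ (hb i)) } }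
          where
          fixed : ∀ h → (∀ i → actᵉ h (α i) ≈ᵉᑫ α i) → ∀ {A₂} → (∀ x → x ∈ A₂ → to h x ≡ x) →
            ∀ {x y} → ((∃ λ i → α i ≈ᵉᑫ y) ⊎ ∃ λ z → z ∈ A₂ × y ≈ᵉᑫ ι₌ z) × x ≈ᵉᑫ y → actᵉ h x ≈ᵉᑫ x
          fixed h hα h-fix (inj₁ (i , q) , x≈) = act-fixes h (≈-trans x≈ (≈-sym q)) (hα i)
          fixed h hα h-fix (inj₂ (z , z∈ , q) , x≈) = act-fixes h (≈-trans x≈ q) (≈-reflexive (cong ι₌ (h-fix z z∈)))

        ¬splits : ∀ {D : Pred M-eq ℓ} → (∀ {x} → D x → Tᵉ.range t x) → ¬ Tᵉ.LascarSplits (ι₌ ∘ b) D (toList α)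
        ¬splits D⊆t (m , c , d , c⊏D , d⊏D , same , ¬same) =
          case alike° B b (λ x → ∈-++⁺ˡ) (λ x → ∈-++⁺ʳ (coordsᵛ c°) ∘ ∈-++⁺ˡ)
                 (λ x → ∈-++⁺ʳ (coordsᵛ c°) ∘ ∈-++⁺ʳ (coordsᵛ d°)) (follows B B-covered) of λ { (σ , σb , σα , σc) →
            ¬same λ l l⊆ → lift-auto σ ,
              (λ {x} x∈ → case All.lookupAny l⊆ x∈ of λ { (y∈ , x≈) → case toList-∈ α y∈ of λ { (i , y≈) →
                act-fixes σ (≈-trans x≈ y≈) (σα i) } }) ,
              joint σ σb (λ j → ≈-trans (actᵉ-cong σ (≈-sym (c≈ j))) (≈-trans (σc j) (d≈ j))) }
          where
          -- Membership in `D` is only up to equivalence of representatives, and `b` was chosen over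
          -- the coordinates of the family `t`. Hence `c` and `d` are replaced by entries of `t`.
          c° d° : Vector M-eq m
          c° j = t (proj₁ (D⊆t (c⊏D j)))
          d° j = t (proj₁ (D⊆t (d⊏D j)))
          c≈ : ∀ j → c° j ≈ᵉᑫ c j
          c≈ j = proj₂ (D⊆t (c⊏D j))
          d≈ : ∀ j → d° j ≈ᵉᑫ d j
          d≈ j = proj₂ (D⊆t (d⊏D j))
          B = coordsᵛ c° ++ˡ (coordsᵛ d° ++ˡ coordsᵛ α)
          in-vector : ∀ (κ : Fin m → K) {x} → x ∈ coordsᵛ (t ∘ κ) → ∃ λ ξ → family K t ξ ≡ x
          in-vector κ x∈ = case ∈-concat⁻′ (tabulate (coords ∘ t ∘ κ)) x∈ of λ { (l , x∈l , l∈) →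
            case ∈-tabulate⁻ l∈ of λ { (j , refl) → in-t (κ j) x∈l } }
          B-covered : ∀ x → x ∈ B → ∃ λ ξ → family K t ξ ≡ x
          B-covered x x∈ = [ in-vector _ , (λ q → [ in-vector _ , (λ q′ → in-β (∈-++⁺ʳ A₁ q′)) ]′ (∈-++⁻ (coordsᵛ d°) q)) ]′
            (∈-++⁻ (coordsᵛ c°) x∈)
          open Tᵉ.InvariantEquivalence (Few.alike-invariant m) using (equality)
          alike° : Alike c° d°
          alike° = alike-trans {c = c°} {c} {d°} (equality c≈) (alike-trans {c = c} {d} {d°}
            (same (toList α) (All.tabulate (Any.map ≈-reflexive)) (Few.alike-invariant m)) (equality (≈-sym ∘ d≈)))
          joint : ∀ σ → (∀ i → to σ (b i) ≡ b i) → (∀ j → actᵉ σ (c j) ≈ᵉᑫ d j) →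
            ∀ i → actᵉ σ (((ι₌ ∘ b) ++ᵛ c) i) ≈ᵉᑫ ((ι₌ ∘ b) ++ᵛ d) i
          joint σ σb σc i with Data.Fin.splitAt n i
          ... | inj₁ i₁ = ≈-reflexive (cong ι₌ (σb i₁))
          ... | inj₂ j = σc j

lemma2p81 : (∀ a → ExcludedMiddle a) →
    (∀ a b → Extensionality a b) →
    ∀ {ℓ k : Level} {L : Language ℓ} (𝒦 : AEC L k) (monster : MonsterModel 𝒦) →
    let open FUR 𝒦 monster in
    IsFUR →
    (supermonster : SuperMonster) (I : Imaginaries) →
    let open Global supermonster in
    let open CanonicalBases I in
    let open Eq I in
    CanonicalChoice I →
    ∀ {n r : ℕ} (a : Types.Tuple 𝕄-space n) (A : Types.Subset 𝕄-space) →
    Types.Bounded 𝕄-space A →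
    (α : Vector M-eq r) → IsCb α a A → a ↓[ α ] A
lemma2p81 em ext 𝒦 monster fur super I _ a A bounded α (b′ , lascar , indep , p , real , canon) =
  case indep⇒nonsplitting b′ A indep of λ { (A₁ , A₁⊆A , nonsplit) →
    Independence.indep p b′ real α canon A bounded a lascar A₁ A₁⊆A nonsplit }
  where
  open Bases em ext 𝒦 monster fur super I using (indep⇒nonsplitting; module Independence)
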